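{- The following (formalized Priess-Crampe \& Ribenboim fixed point theorem) is provable in $\mathsf{RCA}_0$: if $\mathcal X$ is a coded complete separable metric space which is an ultrametric space and is spherically complete, and $f\colon\mathcal X\to\mathcal X$ is a coded continuous function which is strictly contracting, then $f$ has a unique fixed point, i.e. there is a unique point $x_*\in\mathcal X$ with $f(x_*)=x_*$.
   Context: $\mathsf{RCA}_0$ is the usual base system of second-order arithmetic ($\Sigma^0_1$-induction and $\Delta^0_1$-comprehension). A (code for a) complete separable metric space $\mathcal X=\widehat X$ is a nonempty set $X\subseteq\mathbb N$ with a sequence of reals $d\colon X\times X\to\mathbb R$ such that $d(a,a)=0$, $d(a,b)=d(b,a)\ge 0$ and $d(a,b)+d(b,c)\ge d(a,c)$. A point of $\mathcal X$ is a sequence $x=\langle x_i\rangle_{i\in\mathbb N}$ of elements of $X$ with $d(x_i,x_j)\le 2^{ -i}$ for all $i\le j$; $d(x,y)=\lim_n d(x_n,y_n)$, and $x=y$ means $d(x,y)=0$. Continuous functions are coded in the standard way of reverse mathematics (Simpson, Definition II.6.1); equivalently over $\mathsf{RCA}_0$, by a code assigning uniformly to each rational open ball of the codomain a code (as a union of rational open balls) for its open preimage. $\mathcal X$ is an ultrametric space if $d(x,y)\le\max\{d(x,z),d(z,y)\}$ for all $x,y,z\in\mathcal X$. For $x\in\mathcal X$ and a real $\rho>0$, $\overline B_\rho(x)$ denotes the class of $y\in\mathcal X$ with $d(x,y)\le\rho$. For such (codes of) closed balls in an ultrametric space, write $\overline B_\rho(x)\preceq\overline B_\delta(y)$ if $\max\{d(x,y),\rho\}\le\delta$.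 $\mathcal X$ is spherically complete if for every sequence $\langle\overline B_{\rho_i}(x_i)\rangle_{i\in\mathbb N}$ of closed balls with $\overline B_{\rho_{i+1}}(x_{i+1})\preceq\overline B_{\rho_i}(x_i)$ for all $i$, there is a point $x\in\bigcap_{i\in\mathbb N}\overline B_{\rho_i}(x_i)$. $f\colon\mathcal X\to\mathcal X$ is strictly contracting if $d(f(x),f(y))<d(x,y)$ for all $x\ne y$ in $\mathcal X$. -}

module Defs where

open import Data.Nat.Base as ℕ using (ℕ; zero; suc)
open import Data.Fin.Base using (Fin; zero; suc; fromℕ; inject₁; _↑ˡ_; _↑ʳ_)
open import Data.List.Base using (List; []; _∷_; map)
import Data.List.Membership.Propositional as List
open import Function.Base using (id; _∘_)

------------------------------------------------------------------------
-- The two-sorted language L₂.  A formula of type Formula n m has its free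
-- set variables in Fin n and its free number variables in Fin m.

infixl 9 _*_
infixl 8 _+_
infix  7 _≐_ _≺_ _∈_
infixr 6 _∧_
infixr 5 _∨_
infixr 4 _⇒_
infix  3 _⇔_

data Term (m : ℕ) : Set where
  var     : Fin m → Term m
  𝟎 𝟏     : Term m
  _+_ _*_ : Term m → Term m → Term m

data Formula (n m : ℕ) : Set where
  _≐_ _≺_     : Term m → Term m → Formula n m
  _∈_         : Term m → Fin n → Formula n m
  ⊥           : Formula n m
  _∧_ _∨_ _⇒_ : Formula n m → Formula n m → Formula n m
  ∀¹ ∃¹       : Formula n (suc m) → Formula n m
  ∀² ∃²       : Formula (suc n) m → Formula n m

¬_ : ∀ {n m} → Formula n m → Formula n m
¬ φ = φ ⇒ ⊥

infix 8 ¬_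

_⇔_ : ∀ {n m} → Formula n m → Formula n m → Formula n m
φ ⇔ ψ = (φ ⇒ ψ) ∧ (ψ ⇒ φ)

subᵗ : ∀ {m m'} → (Fin m → Term m') → Term m → Term m'
subᵗ σ (var i) = σ i
subᵗ σ 𝟎       = 𝟎
subᵗ σ 𝟏       = 𝟏
subᵗ σ (s + t) = subᵗ σ s + subᵗ σ t
subᵗ σ (s * t) = subᵗ σ s * subᵗ σ t

wkᵗ : ∀ {m} → Term m → Term (suc m)
wkᵗ = subᵗ (var ∘ suc)

ext¹ : ∀ {m m'} → (Fin m → Term m') → Fin (suc m) → Term (suc m')
ext¹ σ zero    = var zero
ext¹ σ (suc i) = wkᵗ (σ i)

ext² : ∀ {n n'} → (Fin n → Fin n') → Fin (suc n) → Fin (suc n')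
ext² τ zero    = zero
ext² τ (suc X) = suc (τ X)

sub : ∀ {n n' m m'} → (Fin n → Fin n') → (Fin m → Term m') →
      Formula n m → Formula n' m'
sub τ σ (s ≐ t) = subᵗ σ s ≐ subᵗ σ t
sub τ σ (s ≺ t) = subᵗ σ s ≺ subᵗ σ t
sub τ σ (t ∈ X) = subᵗ σ t ∈ τ X
sub τ σ ⊥       = ⊥
sub τ σ (φ ∧ ψ) = sub τ σ φ ∧ sub τ σ ψ
sub τ σ (φ ∨ ψ) = sub τ σ φ ∨ sub τ σ ψ
sub τ σ (φ ⇒ ψ) = sub τ σ φ ⇒ sub τ σ ψ
sub τ σ (∀¹ φ)  = ∀¹ (sub τ (ext¹ σ) φ)
sub τ σ (∃¹ φ)  = ∃¹ (sub τ (ext¹ σ) φ)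
sub τ σ (∀² φ)  = ∀² (sub (ext² τ) σ φ)
sub τ σ (∃² φ)  = ∃² (sub (ext² τ) σ φ)

wk¹ : ∀ {n m} → Formula n m → Formula n (suc m)
wk¹ = sub id (var ∘ suc)

wk² : ∀ {n m} → Formula n m → Formula (suc n) m
wk² = sub suc var

inst¹ : ∀ {m} → Term m → Fin (suc m) → Term m
inst¹ t zero    = t
inst¹ t (suc i) = var i

inst² : ∀ {n} → Fin n → Fin (suc n) → Fin n
inst² X zero    = X
inst² X (suc Y) = Y

_[_]¹ : ∀ {n m} → Formula n (suc m) → Term m → Formula n m
φ [ t ]¹ = sub id (inst¹ t) φ

_[_]² : ∀ {n m} → Formula (suc n) m → Fin n → Formula n m
φ [ X ]² = sub (inst² X) var φ

-- φ(x) ↦ φ(x + 1), for x the most recently bound number variable.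
shift : ∀ {n m} → Formula n (suc m) → Formula n (suc m)
shift φ = sub id (λ { zero → var zero + 𝟏 ; (suc i) → var (suc i) }) φ

------------------------------------------------------------------------
-- Classical two-sorted natural deduction with equality on numbers.
-- The axioms of a theory may contain free variables (parameters).

Theory : Set₁
Theory = ∀ {n m} → Formula n m → Set

infix 2 _∣_⊢_

data _∣_⊢_ (T : Theory) :
           ∀ {n m} → List (Formula n m) → Formula n m → Set where
  axiom  : ∀ {n m Γ} {φ : Formula n m} → T φ → T ∣ Γ ⊢ φ
  hyp    : ∀ {n m Γ} {φ : Formula n m} → φ List.∈ Γ → T ∣ Γ ⊢ φ

  ⇒I     : ∀ {n m Γ} {φ ψ : Formula n m} → T ∣ φ ∷ Γ ⊢ ψ → T ∣ Γ ⊢ φ ⇒ ψ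
  ⇒E     : ∀ {n m Γ} {φ ψ : Formula n m} →
           T ∣ Γ ⊢ φ ⇒ ψ → T ∣ Γ ⊢ φ → T ∣ Γ ⊢ ψ
  ∧I     : ∀ {n m Γ} {φ ψ : Formula n m} →
           T ∣ Γ ⊢ φ → T ∣ Γ ⊢ ψ → T ∣ Γ ⊢ φ ∧ ψ
  ∧E₁    : ∀ {n m Γ} {φ ψ : Formula n m} → T ∣ Γ ⊢ φ ∧ ψ → T ∣ Γ ⊢ φ
  ∧E₂    : ∀ {n m Γ} {φ ψ : Formula n m} → T ∣ Γ ⊢ φ ∧ ψ → T ∣ Γ ⊢ ψ
  ∨I₁    : ∀ {n m Γ} {φ ψ : Formula n m} → T ∣ Γ ⊢ φ → T ∣ Γ ⊢ φ ∨ ψ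
  ∨I₂    : ∀ {n m Γ} {φ ψ : Formula n m} → T ∣ Γ ⊢ ψ → T ∣ Γ ⊢ φ ∨ ψ
  ∨E     : ∀ {n m Γ} {φ ψ χ : Formula n m} → T ∣ Γ ⊢ φ ∨ ψ →
           T ∣ φ ∷ Γ ⊢ χ → T ∣ ψ ∷ Γ ⊢ χ → T ∣ Γ ⊢ χ
  raa    : ∀ {n m Γ} {φ : Formula n m} → T ∣ ¬ φ ∷ Γ ⊢ ⊥ → T ∣ Γ ⊢ φ

  ∀¹I    : ∀ {n m Γ} {φ : Formula n (suc m)} →
           T ∣ map wk¹ Γ ⊢ φ → T ∣ Γ ⊢ ∀¹ φ
  ∀¹E    : ∀ {n m Γ} {φ : Formula n (suc m)} →
           T ∣ Γ ⊢ ∀¹ φ → (t : Term m) → T ∣ Γ ⊢ φ [ t ]¹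
  ∃¹I    : ∀ {n m Γ} {φ : Formula n (suc m)} →
           (t : Term m) → T ∣ Γ ⊢ φ [ t ]¹ → T ∣ Γ ⊢ ∃¹ φ
  ∃¹E    : ∀ {n m Γ} {φ : Formula n (suc m)} {ψ : Formula n m} →
           T ∣ Γ ⊢ ∃¹ φ → T ∣ φ ∷ map wk¹ Γ ⊢ wk¹ ψ → T ∣ Γ ⊢ ψ

  ∀²I    : ∀ {n m Γ} {φ : Formula (suc n) m} →
           T ∣ map wk² Γ ⊢ φ → T ∣ Γ ⊢ ∀² φ
  ∀²E    : ∀ {n m Γ} {φ : Formula (suc n) m} →
           T ∣ Γ ⊢ ∀² φ → (X : Fin n) → T ∣ Γ ⊢ φ [ X ]²
  ∃²I    : ∀ {n m Γ} {φ : Formula (suc n) m} →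
           (X : Fin n) → T ∣ Γ ⊢ φ [ X ]² → T ∣ Γ ⊢ ∃² φ
  ∃²E    : ∀ {n m Γ} {φ : Formula (suc n) m} {ψ : Formula n m} →
           T ∣ Γ ⊢ ∃² φ → T ∣ φ ∷ map wk² Γ ⊢ wk² ψ → T ∣ Γ ⊢ ψ

  ≐refl  : ∀ {n m Γ} (t : Term m) → T ∣ Γ ⊢ _≐_ {n} t t
  ≐subst : ∀ {n m Γ} (φ : Formula n (suc m)) {s t : Term m} →
           T ∣ Γ ⊢ s ≐ t → T ∣ Γ ⊢ φ [ s ]¹ → T ∣ Γ ⊢ φ [ t ]¹

------------------------------------------------------------------------
data Δ₀ {n m : ℕ} : Formula n m → Set where
  eq   : ∀ {s t} → Δ₀ (s ≐ t)
  lt   : ∀ {s t} → Δ₀ (s ≺ t)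
  mem  : ∀ {t X} → Δ₀ (t ∈ X)
  bot  : Δ₀ ⊥
  and  : ∀ {φ ψ} → Δ₀ φ → Δ₀ ψ → Δ₀ (φ ∧ ψ)
  or   : ∀ {φ ψ} → Δ₀ φ → Δ₀ ψ → Δ₀ (φ ∨ ψ)
  imp  : ∀ {φ ψ} → Δ₀ φ → Δ₀ ψ → Δ₀ (φ ⇒ ψ)
  ball : ∀ {φ} (t : Term m) → Δ₀ φ → Δ₀ (∀¹ (var zero ≺ wkᵗ t ⇒ φ))
  bex  : ∀ {φ} (t : Term m) → Δ₀ φ → Δ₀ (∃¹ (var zero ≺ wkᵗ t ∧ φ))

data Σ⁰₁ {n m : ℕ} : Formula n m → Set where
  ex  : ∀ {θ} → Δ₀ θ → Σ⁰₁ (∃¹ θ)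

data Π⁰₁ {n m : ℕ} : Formula n m → Set where
  all : ∀ {θ} → Δ₀ θ → Π⁰₁ (∀¹ θ)

data RCA₀ {n m : ℕ} : Formula n m → Set where
  +1≢0 : ∀ s   → RCA₀ (¬ (s + 𝟏 ≐ 𝟎))
  +1-inj : ∀ s t → RCA₀ (s + 𝟏 ≐ t + 𝟏 ⇒ s ≐ t)
  +-0  : ∀ s   → RCA₀ (s + 𝟎 ≐ s)
  +-+1 : ∀ s t → RCA₀ (s + (t + 𝟏) ≐ (s + t) + 𝟏)
  *-0  : ∀ s   → RCA₀ (s * 𝟎 ≐ 𝟎)
  *-+1 : ∀ s t → RCA₀ (s * (t + 𝟏) ≐ s * t + s)
  ≺-0  : ∀ s   → RCA₀ (¬ (s ≺ 𝟎))
  ≺-+1 : ∀ s t → RCA₀ (s ≺ t + 𝟏 ⇔ (s ≺ t ∨ s ≐ t))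
  Σ⁰₁-ind  : ∀ {φ} → Σ⁰₁ φ →
             RCA₀ (φ [ 𝟎 ]¹ ∧ ∀¹ (φ ⇒ shift φ) ⇒ ∀¹ φ)
  Δ⁰₁-comp : ∀ {φ ψ} → Σ⁰₁ φ → Π⁰₁ ψ →
             RCA₀ (∀¹ (φ ⇔ ψ) ⇒ ∃² (∀¹ (var zero ∈ zero ⇔ wk² φ)))

RCA₀⊢_ : Formula 0 0 → Set
RCA₀⊢ φ = RCA₀ ∣ [] ⊢ φ

infix 1 RCA₀⊢_

------------------------------------------------------------------------
infix 7 _≼_

_≼_ : ∀ {n m} → Term m → Term m → Formula n m
s ≼ t = s ≺ t ∨ s ≐ t

-- The injective (not surjective) pairing (i , j) ↦ (i + j)² + i.
⟨_,_⟩ : ∀ {m} → Term m → Term m → Term m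
⟨ s , t ⟩ = (s + t) * (s + t) + s

-- frac a b c stands for the rational (a - b) / (c + 1).
record Rat (m : ℕ) : Set where
  constructor frac
  field pos neg den-1 : Term m

  den : Term m
  den = den-1 + 𝟏

open Rat

-- A rational has many codes; all comparisons below are up to its value.
code : ∀ {m} → Rat m → Term m
code q = ⟨ ⟨ pos q , neg q ⟩ , den-1 q ⟩

infixl 8 _+ℚ_
infix  7 _≤ℚ_ _<ℚ_

_+ℚ_ : ∀ {m} → Rat m → Rat m → Rat m
q +ℚ r = frac (pos q * den r + pos r * den q)
              (neg q * den r + neg r * den q)
              (den-1 q * den-1 r + den-1 q + den-1 r)

_≤ℚ_ _<ℚ_ : ∀ {n m} → Rat m → Rat m → Formula n m
q ≤ℚ r = pos q * den r + neg r * den q ≼ pos r * den q + neg q * den r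
q <ℚ r = pos q * den r + neg r * den q ≺ pos r * den q + neg q * den r

0ℚ : ∀ {m} → Rat m
0ℚ = frac 𝟎 𝟎 𝟎

1/1+_ : ∀ {m} → Term m → Rat m
1/1+ c = frac 𝟏 𝟎 c

------------------------------------------------------------------------
-- Blocks of like quantifiers with named variables, outermost first:
-- ∀ⁿ (ν ∷ ρ ∷ []) λ k q → …  binds a number k and a rational q, the latter
-- being a triple of number variables;  ∀ˢ 2 λ X Y → …  binds two sets.

data Sort : Set where
  ν ρ : Sort

size : List Sort → ℕ
size []      = zero
size (ν ∷ s) = suc (size s)
size (ρ ∷ s) = suc (suc (suc (size s)))

Bind : List Sort → ℕ → Set → Set
Bind []      m F = F
Bind (ν ∷ s) m F = Term m → Bind s m F
Bind (ρ ∷ s) m F = Rat m → Bind s m F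

-- Apply f to the variables of a block; the outermost one has index size s - 1.
supply : ∀ s {m F} → (Fin (size s) → Term m) → Bind s m F → F
supply []      x f = f
supply (ν ∷ s) x f = supply s (x ∘ inject₁) (f (x (fromℕ (size s))))
supply (ρ ∷ s) x f =
  supply s (x ∘ inject₁ ∘ inject₁ ∘ inject₁)
    (f (frac (x (fromℕ (suc (suc (size s)))))
             (x (inject₁ (fromℕ (suc (size s)))))
             (x (inject₁ (inject₁ (fromℕ (size s)))))))

BindSets : ℕ → ℕ → Set → Set
BindSets zero    n F = F
BindSets (suc k) n F = Fin n → BindSets k n F

supplySets : ∀ k {n F} → (Fin k → Fin n) → BindSets k n F → F
supplySets zero    X f = f
supplySets (suc k) X f = supplySets k (X ∘ inject₁) (f (X (fromℕ k)))

∀¹* ∃¹* : ∀ k {n m} → Formula n (k ℕ.+ m) → Formula n m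
∀¹* zero    φ = φ
∀¹* (suc k) φ = ∀¹* k (∀¹ φ)
∃¹* zero    φ = φ
∃¹* (suc k) φ = ∃¹* k (∃¹ φ)

∀²* ∃²* : ∀ k {n m} → Formula (k ℕ.+ n) m → Formula n m
∀²* zero    φ = φ
∀²* (suc k) φ = ∀²* k (∀² φ)
∃²* zero    φ = φ
∃²* (suc k) φ = ∃²* k (∃² φ)

∀ⁿ ∃ⁿ : ∀ s {n m} →
        Bind s (size s ℕ.+ m) (Formula n (size s ℕ.+ m)) → Formula n m
∀ⁿ s {m = m} f = ∀¹* (size s) (supply s (λ i → var (i ↑ˡ m)) f)
∃ⁿ s {m = m} f = ∃¹* (size s) (supply s (λ i → var (i ↑ˡ m)) f)

∀ˢ ∃ˢ : ∀ k {n m} →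
        BindSets k (k ℕ.+ n) (Formula (k ℕ.+ n) m) → Formula n m
∀ˢ k {n} f = ∀²* k (supplySets k (_↑ˡ n) f)
∃ˢ k {n} f = ∃²* k (supplySets k (_↑ˡ n) f)

-- Weakening by k number variables (↑) or k set variables (⇑).
infix 30 _↑ᵗ_ _↑ᵠ_

_↑ᵗ_ : ∀ {m} → Term m → ∀ k → Term (k ℕ.+ m)
t ↑ᵗ k = subᵗ (λ i → var (k ↑ʳ i)) t

_↑ᵠ_ : ∀ {m} → Rat m → ∀ k → Rat (k ℕ.+ m)
frac a b c ↑ᵠ k = frac (a ↑ᵗ k) (b ↑ᵗ k) (c ↑ᵗ k)

------------------------------------------------------------------------
-- Sequences of numbers, given by sets.  row X j is the j-th sequence of
-- the sequence of sequences coded by X.  A set used as a function may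
-- contain numbers that are not of the relevant shape; they are ignored.

data Seq (n m : ℕ) : Set where
  seq   : Fin n → Seq n m
  row   : Fin n → Term m → Seq n m
  const : Term m → Seq n m

infix 30 _↑_ _⇑_

_↑_ : ∀ {n m} → Seq n m → ∀ k → Seq n (k ℕ.+ m)
seq X   ↑ k = seq X
row X j ↑ k = row X (j ↑ᵗ k)
const t ↑ k = const (t ↑ᵗ k)

_⇑_ : ∀ {n m} → Seq n m → ∀ k → Seq (k ℕ.+ n) m
seq X   ⇑ k = seq (k ↑ʳ X)
row X j ⇑ k = row (k ↑ʳ X) j
const t ⇑ k = const t

infix 7 _⟨_⟩≐_

_⟨_⟩≐_ : ∀ {n m} → Seq n m → Term m → Term m → Formula n m
seq X   ⟨ i ⟩≐ v = ⟨ i , v ⟩ ∈ X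
row X j ⟨ i ⟩≐ v = ⟨ ⟨ j , i ⟩ , v ⟩ ∈ X
const t ⟨ i ⟩≐ v = v ≐ t

SingleValued : ∀ {n m} → Seq n m → Formula n m
SingleValued A = ∀ⁿ (ν ∷ ν ∷ ν ∷ []) λ i v w →
  A ↑ 3 ⟨ i ⟩≐ v ∧ A ↑ 3 ⟨ i ⟩≐ w ⇒ v ≐ w

-- p = 2ᵏ, the function E being i ↦ 2ⁱ.  As L₂ has no exponentiation, E is
-- quantified; RCA₀ proves that it exists and is unique as a function.
Pow2 : ∀ {n m} → Term m → Term m → Formula n m
Pow2 k p = ∃ˢ 1 λ E →
  SingleValued (seq E) ∧
  (∀ⁿ (ν ∷ []) λ i → ∃ⁿ (ν ∷ []) λ v → seq E ⟨ i ↑ᵗ 1 ⟩≐ v) ∧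
  seq E ⟨ 𝟎 ⟩≐ 𝟏 ∧
  (∀ⁿ (ν ∷ ν ∷ []) λ i v → seq E ⟨ i ⟩≐ v ⇒ seq E ⟨ i + 𝟏 ⟩≐ v + v) ∧
  seq E ⟨ k ⟩≐ p

------------------------------------------------------------------------
-- Reals: sequences of rationals with ∣ qᵢ - qⱼ ∣ ≤ 2⁻ⁱ for i ≤ j.  Here and
-- below 2⁻ⁱ is 1/(c + 1) with c + 1 = 2ⁱ.

IsReal : ∀ {n m} → Seq n m → Formula n m
IsReal A =
  SingleValued A ∧
  (∀ⁿ (ν ∷ []) λ k → ∃ⁿ (ρ ∷ []) λ q → A ↑ 4 ⟨ k ↑ᵗ 3 ⟩≐ code q) ∧
  (∀ⁿ (ν ∷ ν ∷ ν ∷ ρ ∷ ρ ∷ []) λ i j c q r →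
     i ≼ j ∧ Pow2 i (c + 𝟏) ∧ A ↑ 9 ⟨ i ⟩≐ code q ∧ A ↑ 9 ⟨ j ⟩≐ code r ⇒
     q ≤ℚ r +ℚ 1/1+ c ∧ r ≤ℚ q +ℚ 1/1+ c)

data Real (n m : ℕ) : Set where
  [_]     : Seq n m → Real n m
  _⊕_ _⊔_ : Seq n m → Seq n m → Real n m

infix 8 _⊕_ _⊔_

_↑ᴿ_ : ∀ {n m} → Real n m → ∀ k → Real n (k ℕ.+ m)
[ A ]   ↑ᴿ k = [ A ↑ k ]
(A ⊕ B) ↑ᴿ k = A ↑ k ⊕ B ↑ k
(A ⊔ B) ↑ᴿ k = A ↑ k ⊔ B ↑ k

infix 30 _↑ᴿ_

-- approx A k s: the rational s is the k-th term of A.  A sum has k-th term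
-- q_{k+1} + r_{k+1}, a maximum has k-th term max(q_k , r_k).
approx : ∀ {n m} → Real n m → Term m → Rat m → Formula n m
approx [ A ]   k s = A ⟨ k ⟩≐ code s
approx (A ⊕ B) k s = ∃ⁿ (ρ ∷ ρ ∷ []) λ q r →
  A ↑ 6 ⟨ k ↑ᵗ 6 + 𝟏 ⟩≐ code q ∧ B ↑ 6 ⟨ k ↑ᵗ 6 + 𝟏 ⟩≐ code r ∧
  code (s ↑ᵠ 6) ≐ code (q +ℚ r)
approx (A ⊔ B) k s = ∃ⁿ (ρ ∷ ρ ∷ []) λ q r →
  A ↑ 6 ⟨ k ↑ᵗ 6 ⟩≐ code q ∧ B ↑ 6 ⟨ k ↑ᵗ 6 ⟩≐ code r ∧
  (q ≤ℚ r ∧ code (s ↑ᵠ 6) ≐ code r ∨ r <ℚ q ∧ code (s ↑ᵠ 6) ≐ code q)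

infix 7 _≤ᴿ_ _<ᴿ_ _≈ᴿ_

-- ⟨q_k⟩ ≤ ⟨r_k⟩  iff  q_k ≤ r_k + 2·2⁻ᵏ for all k
_≤ᴿ_ _<ᴿ_ _≈ᴿ_ : ∀ {n m} → Real n m → Real n m → Formula n m
A ≤ᴿ B = ∀ⁿ (ν ∷ ν ∷ ρ ∷ ρ ∷ []) λ k c q r →
  Pow2 k (c + 𝟏) ∧ approx (A ↑ᴿ 8) k q ∧ approx (B ↑ᴿ 8) k r ⇒
  q ≤ℚ r +ℚ (1/1+ c +ℚ 1/1+ c)
A <ᴿ B = ¬ (B ≤ᴿ A)
A ≈ᴿ B = A ≤ᴿ B ∧ B ≤ᴿ A

rat : ∀ {n m} → Rat m → Seq n m
rat q = const (code q)

0ᴿ : ∀ {n m} → Seq n m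
0ᴿ = rat 0ℚ

------------------------------------------------------------------------

-- D is the double sequence of reals d(a , b), indexed by ⟨ a , b ⟩.
record Space (n : ℕ) : Set where
  constructor space
  field X D : Fin n

open Space

infix 30 _⇑ᴹ_

_⇑ᴹ_ : ∀ {n} → Space n → ∀ k → Space (k ℕ.+ n)
M ⇑ᴹ k = space (k ↑ʳ X M) (k ↑ʳ D M)

dist : ∀ {n m} → Space n → Term m → Term m → Seq n m
dist M a b = row (D M) ⟨ a , b ⟩

IsSpace : ∀ {n m} → Space n → Formula n m
IsSpace M =
  (∃ⁿ (ν ∷ []) λ a → a ∈ X M) ∧
  (∀ⁿ (ν ∷ ν ∷ []) λ a b → a ∈ X M ∧ b ∈ X M ⇒
     IsReal (dist M a b) ∧
     [ dist M a a ] ≈ᴿ [ 0ᴿ ] ∧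
     [ dist M a b ] ≈ᴿ [ dist M b a ] ∧
     [ 0ᴿ ] ≤ᴿ [ dist M a b ]) ∧
  (∀ⁿ (ν ∷ ν ∷ ν ∷ []) λ a b c → a ∈ X M ∧ b ∈ X M ∧ c ∈ X M ⇒
     [ dist M a c ] ≤ᴿ dist M a b ⊕ dist M b c)

IsPoint : ∀ {n m} → Space n → Seq n m → Formula n m
IsPoint M x =
  SingleValued x ∧
  (∀ⁿ (ν ∷ []) λ i → ∃ⁿ (ν ∷ []) λ a → a ∈ X M ∧ x ↑ 2 ⟨ i ↑ᵗ 1 ⟩≐ a) ∧
  (∀ⁿ (ν ∷ ν ∷ ν ∷ ν ∷ ν ∷ []) λ i j c a b →
     i ≼ j ∧ Pow2 i (c + 𝟏) ∧ x ↑ 5 ⟨ i ⟩≐ a ∧ x ↑ 5 ⟨ j ⟩≐ b ⇒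
     [ dist M a b ] ≤ᴿ [ rat (1/1+ c) ])

-- d(x , y) = R, that is, R = limₙ d(xₙ , yₙ).  An element a of X is
-- regarded as the point  const a.
Dist : ∀ {n m} → Space n → Seq n m → Seq n m → Seq n m → Formula n m
Dist M x y R =
  IsReal R ∧
  (∀ⁿ (ρ ∷ []) λ ε → 0ℚ <ℚ ε ⇒
     (∃ⁿ (ν ∷ []) λ N → ∀ⁿ (ν ∷ ν ∷ ν ∷ []) λ i a b →
        N ↑ᵗ 3 ≼ i ∧ x ↑ 7 ⟨ i ⟩≐ a ∧ y ↑ 7 ⟨ i ⟩≐ b ⇒
        [ dist M a b ] <ᴿ R ↑ 7 ⊕ rat (ε ↑ᵠ 4) ∧
        [ R ↑ 7 ] <ᴿ dist M a b ⊕ rat (ε ↑ᵠ 4)))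

EqPoint : ∀ {n m} → Space n → Seq n m → Seq n m → Formula n m
EqPoint M x y = Dist M x y 0ᴿ

-- d(x , y) ≤ A and d(x , y) < A
Dist≤ Dist< : ∀ {n m} → Space n → Seq n m → Seq n m → Seq n m → Formula n m
Dist≤ M x y A = ∃ˢ 1 λ R →
  Dist (M ⇑ᴹ 1) (x ⇑ 1) (y ⇑ 1) (seq R) ∧ [ seq R ] ≤ᴿ [ A ⇑ 1 ]
Dist< M x y A = ∃ˢ 1 λ R →
  Dist (M ⇑ᴹ 1) (x ⇑ 1) (y ⇑ 1) (seq R) ∧ [ seq R ] <ᴿ [ A ⇑ 1 ]

IsUltrametric : ∀ {n m} → Space n → Formula n m
IsUltrametric M₀ = ∀ˢ 6 λ x y z R S T → let M = M₀ ⇑ᴹ 6 in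
  IsPoint M (seq x) ∧ IsPoint M (seq y) ∧ IsPoint M (seq z) ∧
  Dist M (seq x) (seq y) (seq R) ∧
  Dist M (seq x) (seq z) (seq S) ∧
  Dist M (seq z) (seq y) (seq T) ⇒
  [ seq R ] ≤ᴿ seq S ⊔ seq T

InBall : ∀ {n m} → Space n → Seq n m → Seq n m → Seq n m → Formula n m
InBall M x r y = Dist≤ M x y r

-- The ball of radius r about x is ⪯ the ball of radius s about y.
SubBall : ∀ {n m} → Space n → Seq n m → Seq n m → Seq n m → Seq n m →
          Formula n m
SubBall M x r y s = ∃ˢ 1 λ R →
  Dist (M ⇑ᴹ 1) (x ⇑ 1) (y ⇑ 1) (seq R) ∧ seq R ⊔ r ⇑ 1 ≤ᴿ [ s ⇑ 1 ]

IsSphericallyComplete : ∀ {n m} → Space n → Formula n m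
IsSphericallyComplete M₀ = ∀ˢ 2 λ x r → let M = M₀ ⇑ᴹ 2 in
  (∀ⁿ (ν ∷ []) λ i →
     IsPoint M (row x i) ∧ IsReal (row r i) ∧ [ 0ᴿ ] <ᴿ [ row r i ]) ∧
  (∀ⁿ (ν ∷ []) λ i →
     SubBall M (row x (i + 𝟏)) (row r (i + 𝟏)) (row x i) (row r i)) ⇒
  (∃ˢ 1 λ y → IsPoint (M ⇑ᴹ 1) (seq y) ∧
     (∀ⁿ (ν ∷ []) λ i →
        InBall (M ⇑ᴹ 1) (row x i ⇑ 1) (row r i ⇑ 1) (seq y)))

------------------------------------------------------------------------
-- Coded continuous functions (Simpson, Definition II.6.1)

quint : ∀ {m} → Term m → Term m → Term m → Term m → Term m → Term m
quint k a r b s = ⟨ k , ⟨ a , ⟨ r , ⟨ b , s ⟩ ⟩ ⟩ ⟩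

-- (a , r) Φ (b , s)
Rel : ∀ {n m} → Fin n → Term m → Rat m → Term m → Rat m → Formula n m
Rel Φ a r b s = ∃ⁿ (ν ∷ []) λ k →
  quint k (a ↑ᵗ 1) (code (r ↑ᵠ 1)) (b ↑ᵗ 1) (code (s ↑ᵠ 1)) ∈ Φ

-- (a' , r') < (a , r)  iff  d(a , a') + r' < r
_∋_,_<_,_ : ∀ {n m} → Space n → Term m → Rat m → Term m → Rat m → Formula n m
M ∋ a' , r' < a , r = dist M a a' ⊕ rat r' <ᴿ [ rat r ]

IsPartialContinuous : ∀ {n m} → Space n → Fin n → Formula n m
IsPartialContinuous M Φ =
  (∀ⁿ (ν ∷ []) λ z → z ∈ Φ ⇒
     (∃ⁿ (ν ∷ ν ∷ ρ ∷ ν ∷ ρ ∷ []) λ k a r b s →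
        z ↑ᵗ 9 ≐ quint k a (code r) b (code s) ∧
        a ∈ X M ∧ 0ℚ <ℚ r ∧ b ∈ X M ∧ 0ℚ <ℚ s)) ∧
  (∀ⁿ (ν ∷ ρ ∷ ν ∷ ρ ∷ ν ∷ ρ ∷ []) λ a r b s b' s' →
     Rel Φ a r b s ∧ Rel Φ a r b' s' ⇒
     [ dist M b b' ] ≤ᴿ rat s ⊕ rat s') ∧
  (∀ⁿ (ν ∷ ρ ∷ ν ∷ ρ ∷ ν ∷ ρ ∷ []) λ a r b s a' r' →
     a' ∈ X M ∧ 0ℚ <ℚ r' ∧ Rel Φ a r b s ∧ (M ∋ a' , r' < a , r) ⇒
     Rel Φ a' r' b s) ∧
  (∀ⁿ (ν ∷ ρ ∷ ν ∷ ρ ∷ ν ∷ ρ ∷ []) λ a r b s b' s' →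
     b' ∈ X M ∧ 0ℚ <ℚ s' ∧ Rel Φ a r b s ∧ (M ∋ b , s < b' , s') ⇒
     Rel Φ a r b' s')

InDomain : ∀ {n m} → Space n → Fin n → Seq n m → Formula n m
InDomain M Φ x = ∀ⁿ (ρ ∷ []) λ ε → 0ℚ <ℚ ε ⇒
  (∃ⁿ (ν ∷ ρ ∷ ν ∷ ρ ∷ []) λ a r b s →
     Rel Φ a r b s ∧ Dist< M (x ↑ 11) (const a) (rat r) ∧ s <ℚ ε ↑ᵠ 8)

IsContinuous : ∀ {n m} → Space n → Fin n → Formula n m
IsContinuous M Φ =
  IsPartialContinuous M Φ ∧
  (∀ˢ 1 λ x → IsPoint (M ⇑ᴹ 1) (seq x) ⇒ InDomain (M ⇑ᴹ 1) (1 ↑ʳ Φ) (seq x))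

-- Φ determines its value at x only up to EqPoint, so Value M Φ x x says that
-- f(x) = x.
Value : ∀ {n m} → Space n → Fin n → Seq n m → Seq n m → Formula n m
Value M Φ x y = ∀ⁿ (ν ∷ ρ ∷ ν ∷ ρ ∷ []) λ a r b s →
  Rel Φ a r b s ∧ Dist< M (x ↑ 8) (const a) (rat r) ⇒
  Dist≤ M (y ↑ 8) (const b) (rat s)

IsStrictlyContracting : ∀ {n m} → Space n → Fin n → Formula n m
IsStrictlyContracting M₀ Φ₀ = ∀ˢ 6 λ x y u v R S →
  let M = M₀ ⇑ᴹ 6 ; Φ = 6 ↑ʳ Φ₀ in
  IsPoint M (seq x) ∧ IsPoint M (seq y) ∧
  IsPoint M (seq u) ∧ IsPoint M (seq v) ∧
  ¬ EqPoint M (seq x) (seq y) ∧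
  Value M Φ (seq x) (seq u) ∧ Value M Φ (seq y) (seq v) ∧
  Dist M (seq u) (seq v) (seq R) ∧ Dist M (seq x) (seq y) (seq S) ⇒
  [ seq R ] <ᴿ [ seq S ]

HasUniqueFixedPoint : ∀ {n m} → Space n → Fin n → Formula n m
HasUniqueFixedPoint M Φ = ∃ˢ 1 λ x →
  (IsPoint (M ⇑ᴹ 1) (seq x) ∧ Value (M ⇑ᴹ 1) (1 ↑ʳ Φ) (seq x) (seq x)) ∧
  (∀ˢ 1 λ y →
     IsPoint (M ⇑ᴹ 2) (seq y) ∧ Value (M ⇑ᴹ 2) (2 ↑ʳ Φ) (seq y) (seq y) ⇒
     EqPoint (M ⇑ᴹ 2) (seq x ⇑ 1) (seq y))

{-# OPTIONS --safe #-}

-- RCA₀ is complete for classical structures in which ⊥ may hold and ∃, ∨ are read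
-- double-negated, by a Henkin construction that is constructive because the
-- consistency required of each added formula is relative to the falsity to be derived.
-- So it suffices to argue in such a structure, with double negation as a monad.
--
-- There, strict contraction and the ultrametric inequality give
-- d(x , y) ≤ max (d(x , f(x)) , d(y , f(y))): otherwise d(f(x) , f(y)) = d(x , y).
-- This yields uniqueness, and closed balls about points a of the dense set X with
-- rational radii ≥ d(a , f(a)) are nested as soon as the radii decrease.  Call q an
-- admissible radius for a if (a , r) Φ (a , q) for some r.  Choose among the first n
-- elements of Φ one with the least admissible radius, for each n; the balls obtained
-- have a common point z.  If d(f(z) , f(f(z))) < d(z , f(z)), any a in X near f(z) has
-- an admissible radius below d(z , f(z)), but z moves by at most each chosen radius.
--
-- The existence of i ↦ 2ⁱ needs no coding of sequences: it is contained in the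
-- hypothesis that Φ is defined at some point.

module Submission where

import Defs as D
open import Defs using
  ( Term; var; 𝟎; 𝟏; _+_; _*_
  ; Formula; _≐_; _≺_; _∈_; ⊥; _∧_; _∨_; _⇒_; ∀¹; ∃¹; ∀²; ∃²; ¬_; _⇔_; _≼_; ⟨_,_⟩
  ; subᵗ; wkᵗ; ext¹; ext²; sub; wk¹; wk²; inst¹; inst²; _[_]¹; _[_]²; shift
  ; Theory; _∣_⊢_; axiom; hyp; ⇒I; ⇒E; ∧I; ∧E₁; ∧E₂; ∨I₁; ∨I₂; ∨E; raa
  ; ∀¹I; ∀¹E; ∃¹I; ∃¹E; ∀²I; ∀²E; ∃²I; ∃²E; ≐refl; ≐subst
  ; Δ₀; eq; lt; mem; bot; and; or; imp; ball; bex; Σ⁰₁; ex; Π⁰₁; all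
  ; RCA₀; +1≢0; +1-inj; +-0; +-+1; *-0; *-+1; ≺-0; ≺-+1; Σ⁰₁-ind; Δ⁰₁-comp; RCA₀⊢_ )
open import Algebra.Bundles using (CommutativeMonoid; CommutativeSemiring)
import Algebra.Solver.CommutativeMonoid
import Algebra.Solver.Ring.NaturalCoefficients.Default
open import Data.Empty as Empty using ()
open import Data.Fin.Base using (Fin; zero; suc; toℕ)
open import Data.Fin.Patterns using (0F; 1F; 2F; 3F; 4F; 5F; 6F; 7F; 8F; 9F)
open import Data.List.Base using (List; []; _∷_; map; _++_)
import Data.List.Membership.Propositional as List
open import Data.List.Properties using (map-∘)
open import Data.List.Relation.Binary.Subset.Propositional using (_⊆_)
open import Data.List.Relation.Binary.Subset.Propositional.Properties
  using (map⁺; ∷⁺ʳ; xs⊆xs++ys; xs⊆ys++xs)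
open import Data.List.Relation.Unary.All as All using (All; []; _∷_)
open import Data.List.Relation.Unary.All.Properties using (++⁺)
open import Data.List.Relation.Unary.Any using (here; there)
open import Data.Maybe.Base as Maybe using (Maybe; just; nothing)
open import Data.Maybe.Properties using (just-injective)
open import Data.Nat.Base as ℕ using (ℕ; zero; suc; s≤s; z≤n)
import Data.Nat.Properties as ℕ
open import Data.Product.Base using (Σ; _×_; _,_; proj₁; proj₂)
open import Data.Sum.Base using (_⊎_; inj₁; inj₂)
open import Function.Base using (id; _∘_)
open import Relation.Binary.Bundles using (Setoid)
open import Relation.Binary.PropositionalEquality as ≡
  using (_≡_; refl; sym; trans; cong; cong₂; subst; subst₂; _≗_)
import Relation.Binary.Reasoning.Setoid
open import Relation.Nullary.Decidable using (yes; no)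

-- Completeness of the deduction system

-- What makes a search possible is that d(a , f(a)) < q yields a single element of Φ, one that
-- relates a ball about `a` to the ball of radius q about the same `a`, and that such an element
-- conversely gives d(a , f(a)) ≤ q. Minimising over the elements of Φ below n is then a bounded
-- search among rationals: Σ⁰₁-induction finds the minimum, and Δ⁰₁-comprehension collects the
-- choices. A starting pair with a known radius serves as long as no element of Φ does better.
--
-- No real number is compared effectively. A distance enters only through its rational upper bounds,
-- and a strict inequality through a rational that bounds one side but not the other.
--
-- The hypotheses quantify over sets, whereas constants, rows and distances first occur as definable
-- graphs; hence the repeated passage to sets by a choice principle for Δ₀ conditions.

subᵗ-cong : ∀ {m m'} {σ σ' : Fin m → Term m'} → σ ≗ σ' → subᵗ σ ≗ subᵗ σ'
subᵗ-cong e (var i) = e i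
subᵗ-cong e 𝟎       = refl
subᵗ-cong e 𝟏       = refl
subᵗ-cong e (s + t) = cong₂ _+_ (subᵗ-cong e s) (subᵗ-cong e t)
subᵗ-cong e (s * t) = cong₂ _*_ (subᵗ-cong e s) (subᵗ-cong e t)

subᵗ-subᵗ : ∀ {l m n} (σ' : Fin m → Term n) (σ : Fin l → Term m) t →
            subᵗ σ' (subᵗ σ t) ≡ subᵗ (subᵗ σ' ∘ σ) t
subᵗ-subᵗ σ' σ (var i) = refl
subᵗ-subᵗ σ' σ 𝟎       = refl
subᵗ-subᵗ σ' σ 𝟏       = refl
subᵗ-subᵗ σ' σ (s + t) = cong₂ _+_ (subᵗ-subᵗ σ' σ s) (subᵗ-subᵗ σ' σ t)
subᵗ-subᵗ σ' σ (s * t) = cong₂ _*_ (subᵗ-subᵗ σ' σ s) (subᵗ-subᵗ σ' σ t)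

subᵗ-var : ∀ {m} (t : Term m) → subᵗ var t ≡ t
subᵗ-var (var i) = refl
subᵗ-var 𝟎       = refl
subᵗ-var 𝟏       = refl
subᵗ-var (s + t) = cong₂ _+_ (subᵗ-var s) (subᵗ-var t)
subᵗ-var (s * t) = cong₂ _*_ (subᵗ-var s) (subᵗ-var t)

ext¹-cong : ∀ {m m'} {σ σ' : Fin m → Term m'} → σ ≗ σ' → ext¹ σ ≗ ext¹ σ'
ext¹-cong e zero    = refl
ext¹-cong e (suc i) = cong wkᵗ (e i)

ext²-cong : ∀ {n n'} {τ τ' : Fin n → Fin n'} → τ ≗ τ' → ext² τ ≗ ext² τ'
ext²-cong e zero    = refl
ext²-cong e (suc i) = cong suc (e i)

ext¹-var : ∀ {m} → ext¹ (var {m}) ≗ var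
ext¹-var zero    = refl
ext¹-var (suc i) = refl

ext²-id : ∀ {n} → ext² (id {A = Fin n}) ≗ id
ext²-id zero    = refl
ext²-id (suc i) = refl

subᵗ-ext¹ : ∀ {l m n} (σ' : Fin m → Term n) (σ : Fin l → Term m) →
            subᵗ (ext¹ σ') ∘ ext¹ σ ≗ ext¹ (subᵗ σ' ∘ σ)
subᵗ-ext¹ σ' σ zero    = refl
subᵗ-ext¹ σ' σ (suc i) =
  trans (subᵗ-subᵗ (ext¹ σ') (var ∘ suc) (σ i))
        (sym (subᵗ-subᵗ (var ∘ suc) σ' (σ i)))

ext²-∘ : ∀ {l m n} (τ' : Fin m → Fin n) (τ : Fin l → Fin m) →
         ext² τ' ∘ ext² τ ≗ ext² (τ' ∘ τ)
ext²-∘ τ' τ zero    = refl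
ext²-∘ τ' τ (suc i) = refl

sub-cong : ∀ {n n' m m'} {τ τ' : Fin n → Fin n'} {σ σ' : Fin m → Term m'} →
           τ ≗ τ' → σ ≗ σ' → sub τ σ ≗ sub τ' σ'
sub-cong e f (s ≐ t) = cong₂ _≐_ (subᵗ-cong f s) (subᵗ-cong f t)
sub-cong e f (s ≺ t) = cong₂ _≺_ (subᵗ-cong f s) (subᵗ-cong f t)
sub-cong e f (t ∈ X) = cong₂ _∈_ (subᵗ-cong f t) (e X)
sub-cong e f ⊥       = refl
sub-cong e f (φ ∧ ψ) = cong₂ _∧_ (sub-cong e f φ) (sub-cong e f ψ)
sub-cong e f (φ ∨ ψ) = cong₂ _∨_ (sub-cong e f φ) (sub-cong e f ψ)
sub-cong e f (φ ⇒ ψ) = cong₂ _⇒_ (sub-cong e f φ) (sub-cong e f ψ)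
sub-cong e f (∀¹ φ)  = cong ∀¹ (sub-cong e (ext¹-cong f) φ)
sub-cong e f (∃¹ φ)  = cong ∃¹ (sub-cong e (ext¹-cong f) φ)
sub-cong e f (∀² φ)  = cong ∀² (sub-cong (ext²-cong e) f φ)
sub-cong e f (∃² φ)  = cong ∃² (sub-cong (ext²-cong e) f φ)

sub-sub : ∀ {n n' n'' m m' m''}
          (τ' : Fin n' → Fin n'') (σ' : Fin m' → Term m'')
          (τ : Fin n → Fin n') (σ : Fin m → Term m') φ →
          sub τ' σ' (sub τ σ φ) ≡ sub (τ' ∘ τ) (subᵗ σ' ∘ σ) φ
sub-sub τ' σ' τ σ (s ≐ t) = cong₂ _≐_ (subᵗ-subᵗ σ' σ s) (subᵗ-subᵗ σ' σ t)
sub-sub τ' σ' τ σ (s ≺ t) = cong₂ _≺_ (subᵗ-subᵗ σ' σ s) (subᵗ-subᵗ σ' σ t)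
sub-sub τ' σ' τ σ (t ∈ X) = cong (_∈ _) (subᵗ-subᵗ σ' σ t)
sub-sub τ' σ' τ σ ⊥       = refl
sub-sub τ' σ' τ σ (φ ∧ ψ) = cong₂ _∧_ (sub-sub τ' σ' τ σ φ) (sub-sub τ' σ' τ σ ψ)
sub-sub τ' σ' τ σ (φ ∨ ψ) = cong₂ _∨_ (sub-sub τ' σ' τ σ φ) (sub-sub τ' σ' τ σ ψ)
sub-sub τ' σ' τ σ (φ ⇒ ψ) = cong₂ _⇒_ (sub-sub τ' σ' τ σ φ) (sub-sub τ' σ' τ σ ψ)
sub-sub τ' σ' τ σ (∀¹ φ)  = cong ∀¹
  (trans (sub-sub τ' (ext¹ σ') τ (ext¹ σ) φ) (sub-cong (λ _ → refl) (subᵗ-ext¹ σ' σ) φ))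
sub-sub τ' σ' τ σ (∃¹ φ)  = cong ∃¹
  (trans (sub-sub τ' (ext¹ σ') τ (ext¹ σ) φ) (sub-cong (λ _ → refl) (subᵗ-ext¹ σ' σ) φ))
sub-sub τ' σ' τ σ (∀² φ)  = cong ∀²
  (trans (sub-sub (ext² τ') σ' (ext² τ) σ φ) (sub-cong (ext²-∘ τ' τ) (λ _ → refl) φ))
sub-sub τ' σ' τ σ (∃² φ)  = cong ∃²
  (trans (sub-sub (ext² τ') σ' (ext² τ) σ φ) (sub-cong (ext²-∘ τ' τ) (λ _ → refl) φ))

sub-id : ∀ {n m} (φ : Formula n m) → sub id var φ ≡ φ
sub-id (s ≐ t) = cong₂ _≐_ (subᵗ-var s) (subᵗ-var t)
sub-id (s ≺ t) = cong₂ _≺_ (subᵗ-var s) (subᵗ-var t)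
sub-id (t ∈ X) = cong (_∈ _) (subᵗ-var t)
sub-id ⊥       = refl
sub-id (φ ∧ ψ) = cong₂ _∧_ (sub-id φ) (sub-id ψ)
sub-id (φ ∨ ψ) = cong₂ _∨_ (sub-id φ) (sub-id ψ)
sub-id (φ ⇒ ψ) = cong₂ _⇒_ (sub-id φ) (sub-id ψ)
sub-id (∀¹ φ)  = cong ∀¹ (trans (sub-cong (λ _ → refl) ext¹-var φ) (sub-id φ))
sub-id (∃¹ φ)  = cong ∃¹ (trans (sub-cong (λ _ → refl) ext¹-var φ) (sub-id φ))
sub-id (∀² φ)  = cong ∀² (trans (sub-cong ext²-id (λ _ → refl) φ) (sub-id φ))
sub-id (∃² φ)  = cong ∃² (trans (sub-cong ext²-id (λ _ → refl) φ) (sub-id φ))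

wk¹-inst : ∀ {n m} (φ : Formula n m) t → wk¹ φ [ t ]¹ ≡ φ
wk¹-inst φ t = trans (sub-sub id (inst¹ t) id (var ∘ suc) φ) (sub-id φ)

wk²-inst : ∀ {n m} (φ : Formula n m) X → wk² φ [ X ]² ≡ φ
wk²-inst φ X = trans (sub-sub (inst² X) var suc var φ) (sub-id φ)

-- Structural rules

weaken : ∀ {T : Theory} {n m} {Γ Δ : List (Formula n m)} {φ} →
         Γ ⊆ Δ → T ∣ Γ ⊢ φ → T ∣ Δ ⊢ φ
weaken ι (axiom a)      = axiom a
weaken ι (hyp x)        = hyp (ι x)
weaken ι (⇒I d)         = ⇒I (weaken (∷⁺ʳ _ ι) d)
weaken ι (⇒E d e)       = ⇒E (weaken ι d) (weaken ι e)
weaken ι (∧I d e)       = ∧I (weaken ι d) (weaken ι e)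
weaken ι (∧E₁ d)        = ∧E₁ (weaken ι d)
weaken ι (∧E₂ d)        = ∧E₂ (weaken ι d)
weaken ι (∨I₁ d)        = ∨I₁ (weaken ι d)
weaken ι (∨I₂ d)        = ∨I₂ (weaken ι d)
weaken ι (∨E d e f)     = ∨E (weaken ι d) (weaken (∷⁺ʳ _ ι) e) (weaken (∷⁺ʳ _ ι) f)
weaken ι (raa d)        = raa (weaken (∷⁺ʳ _ ι) d)
weaken ι (∀¹I d)        = ∀¹I (weaken (map⁺ wk¹ ι) d)
weaken ι (∀¹E d t)      = ∀¹E (weaken ι d) t
weaken ι (∃¹I t d)      = ∃¹I t (weaken ι d)
weaken ι (∃¹E d e)      = ∃¹E (weaken ι d) (weaken (∷⁺ʳ _ (map⁺ wk¹ ι)) e)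
weaken ι (∀²I d)        = ∀²I (weaken (map⁺ wk² ι) d)
weaken ι (∀²E d X)      = ∀²E (weaken ι d) X
weaken ι (∃²I X d)      = ∃²I X (weaken ι d)
weaken ι (∃²E d e)      = ∃²E (weaken ι d) (weaken (∷⁺ʳ _ (map⁺ wk² ι)) e)
weaken ι (≐refl t)      = ≐refl t
weaken ι (≐subst φ d e) = ≐subst φ (weaken ι d) (weaken ι e)

strip¹ : ∀ {T : Theory} {n m} {Γ : List (Formula n m)} {φ} →
         T ∣ map wk¹ Γ ⊢ wk¹ φ → T ∣ Γ ⊢ φ
strip¹ {φ = φ} d = subst (_ ∣ _ ⊢_) (wk¹-inst φ 𝟎) (∀¹E (∀¹I d) 𝟎)

-- The only set terms are variables, so the generalised variable can be instantiated only if another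
-- set variable is in scope; this explains `suc n`.
strip² : ∀ {T : Theory} {n m} {Γ : List (Formula (suc n) m)} {φ} →
         T ∣ map wk² Γ ⊢ wk² φ → T ∣ Γ ⊢ φ
strip² {φ = φ} d = subst (_ ∣ _ ⊢_) (wk²-inst φ zero) (∀²E (∀²I d) zero)

cut : ∀ {T : Theory} {n m} {Γ : List (Formula n m)} {φ ψ} →
      T ∣ Γ ⊢ φ → T ∣ φ ∷ Γ ⊢ ψ → T ∣ Γ ⊢ ψ
cut d e = ⇒E (⇒I e) d

⊥E : ∀ {T : Theory} {n m} {Γ : List (Formula n m)} {φ} → T ∣ Γ ⊢ ⊥ → T ∣ Γ ⊢ φ
⊥E d = raa (weaken there d)

-- Structures and the interpretation of formulas

infix 3 _⟺_
_⟺_ : Set → Set → Set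
A ⟺ B = (A → B) × (B → A)

∅ : ∀ {A : Set} → Fin 0 → A
∅ ()

infixr 5 _∷ₑ_

_∷ₑ_ : ∀ {A : Set} {n} → A → (Fin n → A) → Fin (suc n) → A
(x ∷ₑ σ) zero    = x
(x ∷ₑ σ) (suc i) = σ i

-- Bot need not be empty: a structure may satisfy every formula.
record Structure : Set₁ where
  infixl 9 _·_
  infixl 8 _⊹_
  infix  7 _≈_ _<_ _∈ˢ_
  field
    N S       : Set
    Bot       : Set
    0# 1#     : N
    _⊹_ _·_   : N → N → N
    _≈_ _<_   : N → N → Set
    _∈ˢ_      : N → S → Set

  ¬¬ : Set → Set
  ¬¬ A = (A → Bot) → Bot

  ⟦_⟧ᵗ : ∀ {m} → Term m → (Fin m → N) → N
  ⟦ var i ⟧ᵗ σ = σ i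
  ⟦ 𝟎 ⟧ᵗ     σ = 0#
  ⟦ 𝟏 ⟧ᵗ     σ = 1#
  ⟦ s + t ⟧ᵗ σ = ⟦ s ⟧ᵗ σ ⊹ ⟦ t ⟧ᵗ σ
  ⟦ s * t ⟧ᵗ σ = ⟦ s ⟧ᵗ σ · ⟦ t ⟧ᵗ σ

  ⟦_⟧ : ∀ {n m} → Formula n m → (Fin n → S) → (Fin m → N) → Set
  ⟦ s ≐ t ⟧ τ σ = ⟦ s ⟧ᵗ σ ≈ ⟦ t ⟧ᵗ σ
  ⟦ s ≺ t ⟧ τ σ = ⟦ s ⟧ᵗ σ < ⟦ t ⟧ᵗ σ
  ⟦ t ∈ X ⟧ τ σ = ⟦ t ⟧ᵗ σ ∈ˢ τ X
  ⟦ ⊥ ⟧     τ σ = Bot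
  ⟦ φ ∧ ψ ⟧ τ σ = ⟦ φ ⟧ τ σ × ⟦ ψ ⟧ τ σ
  ⟦ φ ∨ ψ ⟧ τ σ = ¬¬ (⟦ φ ⟧ τ σ ⊎ ⟦ ψ ⟧ τ σ)
  ⟦ φ ⇒ ψ ⟧ τ σ = ⟦ φ ⟧ τ σ → ⟦ ψ ⟧ τ σ
  ⟦ ∀¹ φ ⟧  τ σ = ∀ x → ⟦ φ ⟧ τ (x ∷ₑ σ)
  ⟦ ∃¹ φ ⟧  τ σ = ¬¬ (Σ N λ x → ⟦ φ ⟧ τ (x ∷ₑ σ))
  ⟦ ∀² φ ⟧  τ σ = ∀ X → ⟦ φ ⟧ (X ∷ₑ τ) σ
  ⟦ ∃² φ ⟧  τ σ = ¬¬ (Σ S λ X → ⟦ φ ⟧ (X ∷ₑ τ) σ)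

  ⟦⟧ᵗ-sub : ∀ {m m'} (t : Term m) {σ : Fin m → Term m'} {σ' σ''} →
            (∀ i → ⟦ σ i ⟧ᵗ σ' ≡ σ'' i) → ⟦ subᵗ σ t ⟧ᵗ σ' ≡ ⟦ t ⟧ᵗ σ''
  ⟦⟧ᵗ-sub (var i) e = e i
  ⟦⟧ᵗ-sub 𝟎       e = refl
  ⟦⟧ᵗ-sub 𝟏       e = refl
  ⟦⟧ᵗ-sub (s + t) e = cong₂ _⊹_ (⟦⟧ᵗ-sub s e) (⟦⟧ᵗ-sub t e)
  ⟦⟧ᵗ-sub (s * t) e = cong₂ _·_ (⟦⟧ᵗ-sub s e) (⟦⟧ᵗ-sub t e)

  private
    ext¹-env : ∀ {m m'} {σ : Fin m → Term m'} {σ' σ''} → (∀ i → ⟦ σ i ⟧ᵗ σ' ≡ σ'' i) →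
               ∀ x i → ⟦ ext¹ σ i ⟧ᵗ (x ∷ₑ σ') ≡ (x ∷ₑ σ'') i
    ext¹-env e x zero    = refl
    ext¹-env {σ = σ} e x (suc i) = trans (⟦⟧ᵗ-sub (σ i) (λ _ → refl)) (e i)

    ext²-env : ∀ {n n'} {τ : Fin n → Fin n'} {τ' : Fin n' → S} {τ''} → (∀ i → τ' (τ i) ≡ τ'' i) →
               ∀ X i → (X ∷ₑ τ') (ext² τ i) ≡ (X ∷ₑ τ'') i
    ext²-env e X zero    = refl
    ext²-env e X (suc i) = e i

  mutual
    ⟦⟧-sub : ∀ {n n' m m'} (φ : Formula n m) {τ : Fin n → Fin n'} {σ : Fin m → Term m'} {τ' τ'' σ' σ''} →
             (∀ i → τ' (τ i) ≡ τ'' i) → (∀ i → ⟦ σ i ⟧ᵗ σ' ≡ σ'' i) →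
             ⟦ sub τ σ φ ⟧ τ' σ' → ⟦ φ ⟧ τ'' σ''
    ⟦⟧-sub (s ≐ t) e f a = subst₂ _≈_ (⟦⟧ᵗ-sub s f) (⟦⟧ᵗ-sub t f) a
    ⟦⟧-sub (s ≺ t) e f a = subst₂ _<_ (⟦⟧ᵗ-sub s f) (⟦⟧ᵗ-sub t f) a
    ⟦⟧-sub (t ∈ X) e f a = subst₂ _∈ˢ_ (⟦⟧ᵗ-sub t f) (e X) a
    ⟦⟧-sub ⊥       e f a = a
    ⟦⟧-sub (φ ∧ ψ) e f (a , b) = ⟦⟧-sub φ e f a , ⟦⟧-sub ψ e f b
    ⟦⟧-sub (φ ∨ ψ) e f a k = a λ where
      (inj₁ b) → k (inj₁ (⟦⟧-sub φ e f b))
      (inj₂ b) → k (inj₂ (⟦⟧-sub ψ e f b))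
    ⟦⟧-sub (φ ⇒ ψ) e f a b = ⟦⟧-sub ψ e f (a (⟦⟧-sub⁻ φ e f b))
    ⟦⟧-sub (∀¹ φ)  e f a x = ⟦⟧-sub φ e (ext¹-env f x) (a x)
    ⟦⟧-sub (∃¹ φ)  e f a k = a λ (x , b) → k (x , ⟦⟧-sub φ e (ext¹-env f x) b)
    ⟦⟧-sub (∀² φ)  e f a X = ⟦⟧-sub φ (ext²-env e X) f (a X)
    ⟦⟧-sub (∃² φ)  e f a k = a λ (X , b) → k (X , ⟦⟧-sub φ (ext²-env e X) f b)

    ⟦⟧-sub⁻ : ∀ {n n' m m'} (φ : Formula n m) {τ : Fin n → Fin n'} {σ : Fin m → Term m'} {τ' τ'' σ' σ''} →
              (∀ i → τ' (τ i) ≡ τ'' i) → (∀ i → ⟦ σ i ⟧ᵗ σ' ≡ σ'' i) →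
              ⟦ φ ⟧ τ'' σ'' → ⟦ sub τ σ φ ⟧ τ' σ'
    ⟦⟧-sub⁻ (s ≐ t) e f a = subst₂ _≈_ (sym (⟦⟧ᵗ-sub s f)) (sym (⟦⟧ᵗ-sub t f)) a
    ⟦⟧-sub⁻ (s ≺ t) e f a = subst₂ _<_ (sym (⟦⟧ᵗ-sub s f)) (sym (⟦⟧ᵗ-sub t f)) a
    ⟦⟧-sub⁻ (t ∈ X) e f a = subst₂ _∈ˢ_ (sym (⟦⟧ᵗ-sub t f)) (sym (e X)) a
    ⟦⟧-sub⁻ ⊥       e f a = a
    ⟦⟧-sub⁻ (φ ∧ ψ) e f (a , b) = ⟦⟧-sub⁻ φ e f a , ⟦⟧-sub⁻ ψ e f b
    ⟦⟧-sub⁻ (φ ∨ ψ) e f a k = a λ where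
      (inj₁ b) → k (inj₁ (⟦⟧-sub⁻ φ e f b))
      (inj₂ b) → k (inj₂ (⟦⟧-sub⁻ ψ e f b))
    ⟦⟧-sub⁻ (φ ⇒ ψ) e f a b = ⟦⟧-sub⁻ ψ e f (a (⟦⟧-sub φ e f b))
    ⟦⟧-sub⁻ (∀¹ φ)  e f a x = ⟦⟧-sub⁻ φ e (ext¹-env f x) (a x)
    ⟦⟧-sub⁻ (∃¹ φ)  e f a k = a λ (x , b) → k (x , ⟦⟧-sub⁻ φ e (ext¹-env f x) b)
    ⟦⟧-sub⁻ (∀² φ)  e f a X = ⟦⟧-sub⁻ φ (ext²-env e X) f (a X)
    ⟦⟧-sub⁻ (∃² φ)  e f a k = a λ (X , b) → k (X , ⟦⟧-sub⁻ φ (ext²-env e X) f b)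

-- Stability is asked of atoms only, because the double negations in `∨` and `∃` carry it over to
-- all formulas. Substitution of equals is asked of all formulas, as in the rule `≐subst`.
record Model (T : Theory) : Set₁ where
  field
    structure : Structure
  open Structure structure public
  field
    ≈-stable : ∀ {x y} → ¬¬ (x ≈ y) → x ≈ y
    <-stable : ∀ {x y} → ¬¬ (x < y) → x < y
    ∈-stable : ∀ {x X} → ¬¬ (x ∈ˢ X) → x ∈ˢ X
    ≈-refl   : ∀ {x} → x ≈ x
    ≈-subst  : ∀ {n m} (φ : Formula n (suc m)) τ σ {x y} →
               x ≈ y → ⟦ φ ⟧ τ (x ∷ₑ σ) → ⟦ φ ⟧ τ (y ∷ₑ σ)
    axioms   : ∀ {n m} {φ : Formula n m} → T φ → ∀ τ σ → ⟦ φ ⟧ τ σ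

-- Gödel numbering of formulas

data Tree : Set where
  leaf : Tree
  node : ℕ → Tree → Tree → Tree

-- pair a b = 2ᵃ (2 b + 1)
pair : ℕ → ℕ → ℕ
pair zero    b = suc (2 ℕ.* b)
pair (suc a) b = 2 ℕ.* pair a b

pair-injective : ∀ a b a' b' → pair a b ≡ pair a' b' → a ≡ a' × b ≡ b'
pair-injective zero b zero b' e =
  refl , ℕ.*-cancelˡ-≡ b b' 2 (ℕ.suc-injective e)
pair-injective zero b (suc a') b' e = Empty.⊥-elim (ℕ.even≢odd (pair a' b') b (sym e))
pair-injective (suc a) b zero b' e = Empty.⊥-elim (ℕ.even≢odd (pair a b) b' e)
pair-injective (suc a) b (suc a') b' e
  with refl , refl ← pair-injective a b a' b' (ℕ.*-cancelˡ-≡ _ _ 2 e) = refl , refl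

<pair : ∀ a b → a ℕ.< pair a b
<pair zero    b = s≤s z≤n
<pair (suc a) b = ℕ.<-≤-trans (s≤s (<pair a b))
  (ℕ.+-mono-≤ (ℕ.≤-trans (s≤s z≤n) (<pair a b)) (ℕ.≤-reflexive (sym (ℕ.+-identityʳ _))))

number : Tree → ℕ
number leaf         = 0
number (node k l r) = suc (pair k (pair (number l) (number r)))

number-injective : ∀ t t' → number t ≡ number t' → t ≡ t'
number-injective leaf leaf e = refl
number-injective (node k l r) (node k' l' r') e
  with refl , e₁ ← pair-injective k _ k' _ (ℕ.suc-injective e)
  with e₂ , e₃ ← pair-injective (number l) _ (number l') _ e₁
  = cong₂ (node k) (number-injective l l' e₂) (number-injective r r' e₃)

fin : ∀ n → ℕ → Maybe (Fin n)
fin zero    k       = nothing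
fin (suc n) zero    = just zero
fin (suc n) (suc k) = Maybe.map suc (fin n k)

fin-toℕ : ∀ {n} (i : Fin n) → fin n (toℕ i) ≡ just i
fin-toℕ zero    = refl
fin-toℕ (suc i) = cong (Maybe.map suc) (fin-toℕ i)

treeᵗ : ∀ {m} → Term m → Tree
treeᵗ (var i) = node (4 ℕ.+ toℕ i) leaf leaf
treeᵗ 𝟎       = node 0 leaf leaf
treeᵗ 𝟏       = node 1 leaf leaf
treeᵗ (s + t) = node 2 (treeᵗ s) (treeᵗ t)
treeᵗ (s * t) = node 3 (treeᵗ s) (treeᵗ t)

readᵗ : ∀ m → Tree → Maybe (Term m)
readᵗ m leaf = nothing
readᵗ m (node 0 l r) = just 𝟎
readᵗ m (node 1 l r) = just 𝟏
readᵗ m (node 2 l r) = Maybe.zipWith _+_ (readᵗ m l) (readᵗ m r)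
readᵗ m (node 3 l r) = Maybe.zipWith _*_ (readᵗ m l) (readᵗ m r)
readᵗ m (node (suc (suc (suc (suc k)))) l r) = Maybe.map var (fin m k)

readᵗ-treeᵗ : ∀ {m} (t : Term m) → readᵗ m (treeᵗ t) ≡ just t
readᵗ-treeᵗ (var i) rewrite fin-toℕ i = refl
readᵗ-treeᵗ 𝟎 = refl
readᵗ-treeᵗ 𝟏 = refl
readᵗ-treeᵗ (s + t) rewrite readᵗ-treeᵗ s | readᵗ-treeᵗ t = refl
readᵗ-treeᵗ (s * t) rewrite readᵗ-treeᵗ s | readᵗ-treeᵗ t = refl

tree : ∀ {n m} → Formula n m → Tree
tree (s ≐ t) = node 0 (treeᵗ s) (treeᵗ t)
tree (s ≺ t) = node 1 (treeᵗ s) (treeᵗ t)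
tree (t ∈ X) = node 2 (treeᵗ t) (node (toℕ X) leaf leaf)
tree ⊥       = leaf
tree (φ ∧ ψ) = node 3 (tree φ) (tree ψ)
tree (φ ∨ ψ) = node 4 (tree φ) (tree ψ)
tree (φ ⇒ ψ) = node 5 (tree φ) (tree ψ)
tree (∀¹ φ)  = node 6 (tree φ) leaf
tree (∃¹ φ)  = node 7 (tree φ) leaf
tree (∀² φ)  = node 8 (tree φ) leaf
tree (∃² φ)  = node 9 (tree φ) leaf

read : ∀ n m → Tree → Maybe (Formula n m)
read n m leaf = just ⊥
read n m (node 0 l r) = Maybe.zipWith _≐_ (readᵗ m l) (readᵗ m r)
read n m (node 1 l r) = Maybe.zipWith _≺_ (readᵗ m l) (readᵗ m r)
read n m (node 2 l (node k _ _)) = Maybe.zipWith _∈_ (readᵗ m l) (fin n k)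
read n m (node 3 l r) = Maybe.zipWith _∧_ (read n m l) (read n m r)
read n m (node 4 l r) = Maybe.zipWith _∨_ (read n m l) (read n m r)
read n m (node 5 l r) = Maybe.zipWith _⇒_ (read n m l) (read n m r)
read n m (node 6 l r) = Maybe.map ∀¹ (read n (suc m) l)
read n m (node 7 l r) = Maybe.map ∃¹ (read n (suc m) l)
read n m (node 8 l r) = Maybe.map ∀² (read (suc n) m l)
read n m (node 9 l r) = Maybe.map ∃² (read (suc n) m l)
read n m (node _ l r) = nothing

read-tree : ∀ {n m} (φ : Formula n m) → read n m (tree φ) ≡ just φ
read-tree (s ≐ t) rewrite readᵗ-treeᵗ s | readᵗ-treeᵗ t = refl
read-tree (s ≺ t) rewrite readᵗ-treeᵗ s | readᵗ-treeᵗ t = refl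
read-tree (t ∈ X) rewrite readᵗ-treeᵗ t | fin-toℕ X = refl
read-tree ⊥ = refl
read-tree (φ ∧ ψ) rewrite read-tree φ | read-tree ψ = refl
read-tree (φ ∨ ψ) rewrite read-tree φ | read-tree ψ = refl
read-tree (φ ⇒ ψ) rewrite read-tree φ | read-tree ψ = refl
read-tree (∀¹ φ) rewrite read-tree φ = refl
read-tree (∃¹ φ) rewrite read-tree φ = refl
read-tree (∀² φ) rewrite read-tree φ = refl
read-tree (∃² φ) rewrite read-tree φ = refl

gödel : ∀ {n m} → Formula n m → ℕ
gödel φ = number (tree φ)

-- The partial inverse `read` replaces a case distinction over all pairs of constructors.
gödel-injective : ∀ {n m} (φ ψ : Formula n m) → gödel φ ≡ gödel ψ → φ ≡ ψ
gödel-injective {n} {m} φ ψ e = just-injective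
  (trans (sym (read-tree φ))
         (trans (cong (read n m) (number-injective (tree φ) (tree ψ) e)) (read-tree ψ)))

cuts : ∀ {T : Theory} {n m} {Γ Δ : List (Formula n m)} {φ} →
       All (T ∣ Δ ⊢_) Γ → T ∣ Γ ⊢ φ → T ∣ Δ ⊢ φ
cuts []       d = weaken (λ ()) d
cuts (e ∷ es) d = ⇒E (cuts es (⇒I d)) e

-- Stages of the Henkin construction

max : ∀ {n} → (Fin n → ℕ) → ℕ
max {zero}  f = 0
max {suc n} f = f zero ℕ.⊔ max (f ∘ suc)

≤max : ∀ {n} (f : Fin n → ℕ) i → f i ℕ.≤ max f
≤max f zero    = ℕ.m≤m⊔n _ _
≤max f (suc i) = ℕ.≤-trans (≤max (f ∘ suc) i) (ℕ.m≤n⊔m (f zero) _)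

-- The additional set variable makes sure that each stage has some set.
Form : ℕ → Set
Form k = Formula (suc k) k

up : ∀ {n m} → Formula n m → Formula (suc n) (suc m)
up φ = wk¹ (wk² φ)

data Reach {K : ℕ} (ψ : Form K) : ∀ k → Form k → Set where
  base : Reach ψ K ψ
  next : ∀ {k φ} → Reach ψ k φ → Reach ψ (suc k) (up φ)

Reach-≤ : ∀ {K ψ k φ} → Reach {K} ψ k φ → K ℕ.≤ k
Reach-≤ base     = ℕ.≤-refl
Reach-≤ (next r) = ℕ.m≤n⇒m≤1+n (Reach-≤ r)

Reach-functional : ∀ {K ψ k φ φ'} → Reach {K} ψ k φ → Reach ψ k φ' → φ ≡ φ'
Reach-functional base     base      = refl
Reach-functional base     (next r') = Empty.⊥-elim (ℕ.1+n≰n (Reach-≤ r'))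
Reach-functional (next r) base      = Empty.⊥-elim (ℕ.1+n≰n (Reach-≤ r))
Reach-functional (next r) (next r') = cong up (Reach-functional r r')

-- Since the numbering is injective, a stage treats at most one formula, in the form weakened from
-- the stage of its origin. Some stages treat none.
record Stage (k : ℕ) (φ : Form k) : Set where
  constructor stage
  field
    {origin}  : ℕ
    formula   : Form origin
    reach     : Reach formula k φ
    numbering : pair origin (gödel formula) ≡ k

Stage-functional : ∀ {k φ φ'} → Stage k φ → Stage k φ' → φ ≡ φ'
Stage-functional (stage {K} ψ r e) (stage {K'} ψ' r' e')
  with refl , g ← pair-injective K (gödel ψ) K' (gödel ψ') (trans e (sym e'))
  with refl ← gödel-injective ψ ψ' g
  = Reach-functional r r'

-- The Henkin axiom for a universal formula, witnessed by the variable added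
-- in passing to the next stage.
henkin : ∀ {k} → Form k → Form (suc k)
henkin (∀¹ ψ) = wk² ψ ⇒ up (∀¹ ψ)
henkin (∀² ψ) = wk¹ ψ ⇒ up (∀² ψ)
henkin φ      = ⊥ ⇒ ⊥

-- Entailment, and conservativity of the Henkin axioms

module Entailment (T : Theory) where

  _⊩_ : ∀ {n m} → (Formula n m → Set) → Formula n m → Set
  Q ⊩ φ = Σ (List _) λ Γ → All Q Γ × (T ∣ Γ ⊢ φ)

  ⊩-hyp : ∀ {n m} {Q : Formula n m → Set} {φ} → Q φ → Q ⊩ φ
  ⊩-hyp q = _ , q ∷ [] , hyp (here refl)

  ⊩-rule₀ : ∀ {n m} {Q : Formula n m → Set} {φ} → T ∣ [] ⊢ φ → Q ⊩ φ
  ⊩-rule₀ d = [] , [] , d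

  ⊩-rule₁ : ∀ {n m} {Q : Formula n m → Set} {φ ψ} →
            (∀ {Γ} → T ∣ Γ ⊢ φ → T ∣ Γ ⊢ ψ) → Q ⊩ φ → Q ⊩ ψ
  ⊩-rule₁ r (Γ , q , d) = Γ , q , r d

  ⊩-rule₂ : ∀ {n m} {Q : Formula n m → Set} {φ ψ χ} →
            (∀ {Γ} → T ∣ Γ ⊢ φ → T ∣ Γ ⊢ ψ → T ∣ Γ ⊢ χ) → Q ⊩ φ → Q ⊩ ψ → Q ⊩ χ
  ⊩-rule₂ r (Γ , q , d) (Δ , p , e) =
    Γ ++ Δ , ++⁺ q p , r (weaken (xs⊆xs++ys Γ Δ) d) (weaken (xs⊆ys++xs Δ Γ) e)

  ⊩-cuts : ∀ {n m} {Q : Formula n m → Set} {Γ φ} → All (Q ⊩_) Γ → T ∣ Γ ⊢ φ → Q ⊩ φ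
  ⊩-cuts []       d = ⊩-rule₀ d
  ⊩-cuts (q ∷ qs) d = ⊩-rule₂ ⇒E (⊩-cuts qs (⇒I d)) q

  neg-⇒₁ : ∀ {n m} {Γ : List (Formula n m)} {φ ψ} → T ∣ Γ ⊢ ¬ (φ ⇒ ψ) → T ∣ Γ ⊢ φ
  neg-⇒₁ d = raa (⇒E (weaken there d) (⇒I (⊥E (⇒E (hyp (there (here refl))) (hyp (here refl))))))

  neg-⇒₂ : ∀ {n m} {Γ : List (Formula n m)} {φ ψ} → T ∣ Γ ⊢ ¬ (φ ⇒ ψ) → T ∣ Γ ⊢ ¬ ψ
  neg-⇒₂ d = ⇒I (⇒E (weaken there d) (⇒I (hyp (there (here refl)))))

  strip : ∀ {n m} {Γ : List (Formula (suc n) m)} {φ} → T ∣ map up Γ ⊢ up φ → T ∣ Γ ⊢ φ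
  strip {Γ = Γ} d = strip² (strip¹ (subst (T ∣_⊢ _) (map-∘ Γ) d))

  no-∃¹ : ∀ {n m} {Γ : List (Formula n m)} {φ} → T ∣ Γ ⊢ ∀¹ (¬ φ) → T ∣ Γ ⊢ ∃¹ φ → T ∣ Γ ⊢ ⊥
  no-∃¹ {Γ = Γ} {φ} d e = cut d (∃¹E (weaken there e)
    (⇒E (subst (λ ψ → T ∣ φ ∷ map wk¹ (∀¹ (¬ φ) ∷ Γ) ⊢ ¬ ψ) same (∀¹E (hyp (there (here refl))) (var zero))) (hyp (here refl))))
    where
    same : sub id (inst¹ (var zero)) (sub id (ext¹ (var ∘ suc)) φ) ≡ φ
    same = trans (sub-sub _ _ _ _ φ) (trans (sub-cong (λ _ → refl) (λ where
      zero    → refl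
      (suc i) → refl) φ) (sub-id φ))

  no-∃² : ∀ {n m} {Γ : List (Formula n m)} {φ} → T ∣ Γ ⊢ ∀² (¬ φ) → T ∣ Γ ⊢ ∃² φ → T ∣ Γ ⊢ ⊥
  no-∃² {Γ = Γ} {φ} d e = cut d (∃²E (weaken there e)
    (⇒E (subst (λ ψ → T ∣ φ ∷ map wk² (∀² (¬ φ) ∷ Γ) ⊢ ¬ ψ) same (∀²E (hyp (there (here refl))) zero)) (hyp (here refl))))
    where
    same : sub (inst² zero) var (sub (ext² suc) var φ) ≡ φ
    same = trans (sub-sub _ _ _ _ φ) (trans (sub-cong (λ where
      zero    → refl
      (suc i) → refl) (λ _ → refl) φ) (sub-id φ))

  no-∨ : ∀ {n m} {Γ : List (Formula n m)} {φ ψ} → T ∣ Γ ⊢ ¬ φ → T ∣ Γ ⊢ ¬ ψ → T ∣ Γ ⊢ ¬ (φ ∨ ψ)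
  no-∨ d e = ⇒I (∨E (hyp (here refl)) (⇒E (weaken (there ∘ there) d) (hyp (here refl)))
                                       (⇒E (weaken (there ∘ there) e) (hyp (here refl))))

  drop-trivial : ∀ {n m} {Γ : List (Formula n m)} {φ} →
                 T ∣ (⊥ ⇒ ⊥) ∷ Γ ⊢ φ → T ∣ Γ ⊢ φ
  drop-trivial = cut (⇒I (hyp (here refl)))

  -- Refuting the Henkin axiom proves its premise and refutes its conclusion. The premise is about a
  -- variable fresh for `Γ`, so it generalises to the universal formula, which is the conclusion.
  henkin-conservative : ∀ {k} (φ : Form k) {Γ} →
                        T ∣ henkin φ ∷ map up Γ ⊢ ⊥ → T ∣ Γ ⊢ ⊥
  henkin-conservative (∀¹ ψ) {Γ} d =
    strip² (⇒E (strip¹ (neg-⇒₂ d')) (subst (T ∣ map wk² Γ ⊢_) same (∀¹I (neg-⇒₁ d'))))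
    where
    d' : T ∣ map wk¹ (map wk² Γ) ⊢ ¬ (wk² ψ ⇒ up (∀¹ ψ))
    d' = subst (T ∣_⊢ _) (map-∘ Γ) (⇒I d)
    same : ∀¹ (wk² ψ) ≡ wk² (∀¹ ψ)
    same = cong ∀¹ (sub-cong (λ _ → refl) (sym ∘ ext¹-var) ψ)
  henkin-conservative (∀² ψ) {Γ} d = ⇒E (strip² (neg-⇒₂ d')) (∀²I (neg-⇒₁ d'))
    where
    d' : T ∣ map wk² Γ ⊢ ¬ (ψ ⇒ wk² (∀² ψ))
    d' = strip¹ (subst (T ∣_⊢ _) (map-∘ Γ) (⇒I d))
  henkin-conservative (_ ≐ _) d = strip (drop-trivial d)
  henkin-conservative (_ ≺ _) d = strip (drop-trivial d)
  henkin-conservative (_ ∈ _) d = strip (drop-trivial d)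
  henkin-conservative ⊥       d = strip (drop-trivial d)
  henkin-conservative (_ ∧ _) d = strip (drop-trivial d)
  henkin-conservative (_ ∨ _) d = strip (drop-trivial d)
  henkin-conservative (_ ⇒ _) d = strip (drop-trivial d)
  henkin-conservative (∃¹ _)  d = strip (drop-trivial d)
  henkin-conservative (∃² _)  d = strip (drop-trivial d)

-- The term structure and its truth lemma

module Henkin (T : Theory) (φ₀ : Formula 1 0) where

  open Entailment T

  -- The structure satisfies falsity exactly if the negation of the goal is refutable, and that is
  -- all that `raa` asks for.
  Bot : Set
  Bot = T ∣ ¬ φ₀ ∷ [] ⊢ ⊥

  -- The theories Pₖ are closed under consequence in passing to the next
  -- stage, which makes weakening by variables available.
  P : ∀ k → Form k → Set
  P zero    χ = χ ≡ ¬ φ₀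
  P (suc k) χ =
    (Σ (Form k) λ γ → P k ⊩ γ × χ ≡ up γ) ⊎
    (Σ (Form k) λ φ → Stage k φ × (P k ⊩ (¬ φ) → Bot) × χ ≡ up φ) ⊎
    (Σ (Form k) λ φ → Stage k φ × χ ≡ henkin φ)

  infix 3 _⊫_
  _⊫_ : ∀ k → Form k → Set
  k ⊫ φ = P k ⊩ φ

  -- Since a stage treats one formula only, a finite list from `P (suc k)` involves, besides
  -- consequences of the earlier stage, at most that formula and its Henkin axiom.
  data Shape (k : ℕ) (Γ : List (Form (suc k))) : Set where
    none   : ∀ Δ → All (k ⊫_) Δ → Γ ⊆ map up Δ → Shape k Γ
    single : ∀ φ → Stage k φ → ∀ Δ → All (k ⊫_) Δ → Γ ⊆ henkin φ ∷ map up Δ → Shape k Γ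
    both   : ∀ φ → Stage k φ → (k ⊫ ¬ φ → Bot) → ∀ Δ → All (k ⊫_) Δ →
             Γ ⊆ henkin φ ∷ map up (φ ∷ Δ) → Shape k Γ

  ∷-⊆ : ∀ {A : Set} {x : A} {Γ Δ} → x List.∈ Δ → Γ ⊆ Δ → x ∷ Γ ⊆ Δ
  ∷-⊆ x∈ ι (here refl) = x∈
  ∷-⊆ x∈ ι (there y)   = ι y

  swap-⊆ : ∀ {A : Set} {x y : A} {Γ} → x ∷ Γ ⊆ x ∷ y ∷ Γ
  swap-⊆ (here e)  = here e
  swap-⊆ (there i) = there (there i)

  shape : ∀ {k} Γ → All (P (suc k)) Γ → Shape k Γ
  shape []      []      = none [] [] (λ ())
  shape (_ ∷ Γ) (p ∷ ps) with p | shape Γ ps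
  ... | inj₁ (γ , d , refl) | none Δ q ι = none (γ ∷ Δ) (d ∷ q) (∷⁺ʳ _ ι)
  ... | inj₁ (γ , d , refl) | single φ s Δ q ι =
    single φ s (γ ∷ Δ) (d ∷ q) (∷-⊆ (there (here refl)) (swap-⊆ ∘ ι))
  ... | inj₁ (γ , d , refl) | both φ s c Δ q ι =
    both φ s c (γ ∷ Δ) (d ∷ q) (∷-⊆ (there (there (here refl))) (∷⁺ʳ _ swap-⊆ ∘ ι))
  ... | inj₂ (inj₁ (φ , s , c , refl)) | none Δ q ι =
    both φ s c Δ q (∷-⊆ (there (here refl)) (there ∘ there ∘ ι))
  ... | inj₂ (inj₁ (φ , s , c , refl)) | single φ' s' Δ q ι
    with refl ← Stage-functional s s' =
    both φ s c Δ q (∷-⊆ (there (here refl)) (swap-⊆ ∘ ι))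
  ... | inj₂ (inj₁ (φ , s , c , refl)) | both φ' s' _ Δ q ι
    with refl ← Stage-functional s s' =
    both φ s c Δ q (∷-⊆ (there (here refl)) ι)
  ... | inj₂ (inj₂ (φ , s , refl)) | none Δ q ι = single φ s Δ q (∷⁺ʳ _ ι)
  ... | inj₂ (inj₂ (φ , s , refl)) | single φ' s' Δ q ι
    with refl ← Stage-functional s s' = single φ s Δ q (∷-⊆ (here refl) ι)
  ... | inj₂ (inj₂ (φ , s , refl)) | both φ' s' c Δ q ι
    with refl ← Stage-functional s s' = both φ s c Δ q (∷-⊆ (here refl) ι)

  consistent : ∀ k → k ⊫ ⊥ → Bot
  consistent zero (Γ , ps , d) = cuts (All.map (λ { refl → hyp (here refl) }) ps) d
  consistent (suc k) (Γ , ps , d) with shape Γ ps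
  ... | none Δ q ι       = consistent k (⊩-cuts q (strip (weaken ι d)))
  ... | single φ s Δ q ι = consistent k (⊩-cuts q (henkin-conservative φ (weaken ι d)))
  ... | both φ s c Δ q ι = c (⊩-cuts q (⇒I (henkin-conservative φ (weaken ι d))))

  -- Objects with Henkin constants are given by their values at all
  -- sufficiently late stages.
  record Family (A : ℕ → Set) (wk : ∀ {k} → A k → A (suc k)) : Set where
    field
      at     : ∀ k → A k
      from   : ℕ
      stable : ∀ {k} → from ℕ.≤ k → at (suc k) ≡ wk (at k)
  open Family

  Num  = Family Term wkᵗ
  SetV = Family (λ k → Fin (suc k)) suc
  Fam  = Family Form up

  record True (F : Fam) : Set where
    constructor true-from
    field
      start : ℕ
      holds : ∀ {k} → start ℕ.≤ k → k ⊫ at F k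
  open True

  up-⊫ : ∀ {k φ} → k ⊫ φ → suc k ⊫ up φ
  up-⊫ d = ⊩-hyp (inj₁ (_ , d , refl))

  persist : ∀ (F : Fam) {k} → from F ℕ.≤ k → k ⊫ at F k → ∀ d → (d ℕ.+ k) ⊫ at F (d ℕ.+ k)
  persist F l p zero    = p
  persist F l p (suc d) = subst (_ ⊫_) (sym (stable F (ℕ.m≤n⇒m≤o+n d l))) (up-⊫ (persist F l p d))

  true : ∀ {F : Fam} {k} → from F ℕ.≤ k → k ⊫ at F k → True F
  true {F} {k} l p = true-from k λ {j} k≤j →
    subst (λ j → j ⊫ at F j) (ℕ.m∸n+n≡m k≤j) (persist F l p (j ℕ.∸ k))

  reach : ∀ (F : Fam) {K} → from F ℕ.≤ K → ∀ d → Reach (at F K) (d ℕ.+ K) (at F (d ℕ.+ K))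
  reach F l zero    = base
  reach F l (suc d) = subst (Reach _ _) (sym (stable F (ℕ.m≤n⇒m≤o+n d l))) (next (reach F l d))

  -- The formula that `F` has at stage K is treated at the stage named by its own number, and
  -- `<pair` puts that stage after K.
  staged : ∀ (F : Fam) K → from F ℕ.≤ K → Σ ℕ λ k → (K ℕ.≤ k) × Stage k (at F k)
  staged F K l = k , K≤k , stage (at F K)
    (subst (λ j → Reach (at F K) j (at F j)) (ℕ.m∸n+n≡m K≤k) (reach F l (k ℕ.∸ K))) refl
    where
    k = pair K (gödel (at F K))
    K≤k = ℕ.<⇒≤ (<pair K (gödel (at F K)))

  -- This stands in for Lindenbaum's decision whether a formula is consistent: the hypothesis is the
  -- relative consistency that lets the formula be added at the stage treating it.
  maximal : ∀ {F : Fam} K → (∀ {k} → K ℕ.≤ k → k ⊫ ¬ at F k → Bot) → True F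
  maximal {F} K c =
    let k , l , s = staged F (K ℕ.⊔ from F) (ℕ.m≤n⊔m K _)
        f≤k = ℕ.m⊔n≤o⇒n≤o K _ l
    in true (ℕ.m≤n⇒m≤1+n f≤k) (⊩-hyp (inj₂ (inj₁
         (at F k , s , c (ℕ.m⊔n≤o⇒m≤o K _ l) , stable F f≤k))))

  rule₀ : ∀ {F : Fam} → (∀ k → T ∣ [] ⊢ at F k) → True F
  rule₀ r = true-from 0 λ _ → ⊩-rule₀ (r _)

  rule₁ : ∀ {F G : Fam} → (∀ k {Γ} → T ∣ Γ ⊢ at F k → T ∣ Γ ⊢ at G k) → True F → True G
  rule₁ r t = true-from (start t) λ l → ⊩-rule₁ (r _) (holds t l)

  rule₂ : ∀ {F G H : Fam} → (∀ k {Γ} → T ∣ Γ ⊢ at F k → T ∣ Γ ⊢ at G k → T ∣ Γ ⊢ at H k) →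
          True F → True G → True H
  rule₂ r t u = true-from (start t ℕ.⊔ start u) λ l →
    ⊩-rule₂ (r _) (holds t (ℕ.m⊔n≤o⇒m≤o _ _ l)) (holds u (ℕ.m⊔n≤o⇒n≤o (start t) _ l))

  agree : ∀ {F G : Fam} → (∀ k → at F k ≡ at G k) → True F → True G
  agree e = rule₁ λ k → subst (T ∣ _ ⊢_) (e k)

  infixr 4 _⇛_
  _⇛_ : Fam → Fam → Fam
  (F ⇛ G) .at k = at F k ⇒ at G k
  (F ⇛ G) .from = from F ℕ.⊔ from G
  (F ⇛ G) .stable l = cong₂ _⇒_
    (stable F (ℕ.m⊔n≤o⇒m≤o _ _ l)) (stable G (ℕ.m⊔n≤o⇒n≤o (from F) _ l))

  falsum : Fam
  falsum .at k     = ⊥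
  falsum .from     = 0
  falsum .stable _ = refl

  True-falsum : True falsum → Bot
  True-falsum t = consistent _ (holds t ℕ.≤-refl)

  contradict : ∀ {F} → True (F ⇛ falsum) → True F → Bot
  contradict t u = True-falsum (rule₂ (λ _ → ⇒E) t u)

  -- By maximality it suffices to treat a refutation of the implication. It entails `F` and the
  -- negation of `G`, which the hypothesis makes contradictory.
  ⇛-intro : ∀ {F G} → (True F → True G) → True (F ⇛ G)
  ⇛-intro {F} {G} h = maximal (from F ℕ.⊔ from G) λ {k} l d → contradict
    (true (ℕ.≤-trans (ℕ.≤-reflexive (ℕ.⊔-identityʳ _)) (ℕ.m⊔n≤o⇒n≤o (from F) _ l)) (⊩-rule₁ neg-⇒₂ d))
    (h (true (ℕ.m⊔n≤o⇒m≤o _ _ l) (⊩-rule₁ neg-⇒₁ d)))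

  negate : ∀ {F} → (True F → Bot) → True (F ⇛ falsum)
  negate {F} h = ⇛-intro {F} {falsum} λ t → maximal 0 λ _ _ → h t

  True-stable : ∀ {F} → ((True F → Bot) → Bot) → True F
  True-stable {F} h = maximal (from F) λ l d → h
    (contradict (true (ℕ.≤-trans (ℕ.≤-reflexive (ℕ.⊔-identityʳ _)) l) d))

  numᶠ : ∀ {m} → (Fin m → Num) → ∀ k → Fin m → Term k
  numᶠ σ k i = at (σ i) k

  setᶠ : ∀ {n} → (Fin n → SetV) → ∀ k → Fin n → Fin (suc k)
  setᶠ τ k i = at (τ i) k

  from≤ : ∀ {n m} (τ : Fin n → SetV) (σ : Fin m → Num) {K} → max (from ∘ τ) ℕ.⊔ max (from ∘ σ) ℕ.≤ K →
          (∀ i → from (τ i) ℕ.≤ K) × (∀ i → from (σ i) ℕ.≤ K)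
  from≤ τ σ l =
    (λ i → ℕ.≤-trans (≤max (from ∘ τ) i) (ℕ.m⊔n≤o⇒m≤o _ _ l)) ,
    (λ i → ℕ.≤-trans (≤max (from ∘ σ) i) (ℕ.m⊔n≤o⇒n≤o (max (from ∘ τ)) _ l))

  inst : ∀ {n m} → Formula n m → (Fin n → SetV) → (Fin m → Num) → Fam
  inst φ τ σ .at k = sub (setᶠ τ k) (numᶠ σ k) φ
  inst φ τ σ .from = max (from ∘ τ) ℕ.⊔ max (from ∘ σ)
  inst φ τ σ .stable {k} l = let lτ , lσ = from≤ τ σ l in trans
    (sub-cong (λ i → stable (τ i) (lτ i))
      (λ i → trans (stable (σ i) (lσ i)) (cong wkᵗ (sym (subᵗ-var (at (σ i) k))))) φ)
    (sym (trans (cong wk¹ (sub-sub suc var (setᶠ τ k) (numᶠ σ k) φ))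
                (sub-sub id (var ∘ suc) (suc ∘ setᶠ τ k) (subᵗ var ∘ numᶠ σ k) φ)))

  termˢ : Structure
  termˢ = record
    { N = Num ; S = SetV ; Bot = Bot
    ; 0# = record { at = λ _ → 𝟎 ; from = 0 ; stable = λ _ → refl }
    ; 1# = record { at = λ _ → 𝟏 ; from = 0 ; stable = λ _ → refl }
    ; _⊹_ = λ s t → record
        { at = λ k → at s k + at t k ; from = from s ℕ.⊔ from t
        ; stable = λ l → cong₂ _+_ (stable s (ℕ.m⊔n≤o⇒m≤o _ _ l)) (stable t (ℕ.m⊔n≤o⇒n≤o (from s) _ l)) }
    ; _·_ = λ s t → record
        { at = λ k → at s k * at t k ; from = from s ℕ.⊔ from t
        ; stable = λ l → cong₂ _*_ (stable s (ℕ.m⊔n≤o⇒m≤o _ _ l)) (stable t (ℕ.m⊔n≤o⇒n≤o (from s) _ l)) }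
    ; _≈_ = λ s t → True (inst (var zero ≐ var (suc zero)) ∅ (s ∷ₑ t ∷ₑ ∅))
    ; _<_ = λ s t → True (inst (var zero ≺ var (suc zero)) ∅ (s ∷ₑ t ∷ₑ ∅))
    ; _∈ˢ_ = λ t X → True (inst (var zero ∈ zero) (X ∷ₑ ∅) (t ∷ₑ ∅))
    }

  open Structure termˢ using (⟦_⟧ᵗ; ⟦_⟧)

  at-⟦⟧ᵗ : ∀ {m} (t : Term m) σ k → at (⟦ t ⟧ᵗ σ) k ≡ subᵗ (numᶠ σ k) t
  at-⟦⟧ᵗ (var i) σ k = refl
  at-⟦⟧ᵗ 𝟎       σ k = refl
  at-⟦⟧ᵗ 𝟏       σ k = refl
  at-⟦⟧ᵗ (s + t) σ k = cong₂ _+_ (at-⟦⟧ᵗ s σ k) (at-⟦⟧ᵗ t σ k)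
  at-⟦⟧ᵗ (s * t) σ k = cong₂ _*_ (at-⟦⟧ᵗ s σ k) (at-⟦⟧ᵗ t σ k)

  inst¹-ext¹ : ∀ {n m k} (φ : Formula n (suc m)) (τ : Fin n → Fin (suc k)) σ (x : Num) →
               sub τ (ext¹ (numᶠ σ k)) φ [ at x k ]¹ ≡ sub τ (numᶠ (x ∷ₑ σ) k) φ
  inst¹-ext¹ φ τ σ x = trans (sub-sub _ _ _ _ φ) (sub-cong (λ _ → refl) (λ where
    zero    → refl
    (suc i) → trans (subᵗ-subᵗ _ _ (at (σ i) _)) (subᵗ-var _)) φ)

  inst²-ext² : ∀ {n m k} (φ : Formula (suc n) m) τ (σ : Fin m → Term k) (X : SetV) →
               sub (ext² (setᶠ τ k)) σ φ [ at X k ]² ≡ sub (setᶠ (X ∷ₑ τ) k) σ φ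
  inst²-ext² φ τ σ X = trans (sub-sub _ _ _ _ φ) (sub-cong (λ where
    zero    → refl
    (suc i) → refl) (λ i → subᵗ-var _) φ)

  -- The constants introduced at stage K, with a junk value at earlier stages.
  num-at : ℕ → ∀ k → Term k
  num-at K zero    = 𝟎
  num-at K (suc k) with K ℕ.≟ k
  ... | yes _ = var zero
  ... | no  _ = wkᵗ (num-at K k)

  num-old : ∀ {K k} → suc K ℕ.≤ k → num-at K (suc k) ≡ wkᵗ (num-at K k)
  num-old {K} {k} l with K ℕ.≟ k
  ... | yes refl = Empty.⊥-elim (ℕ.1+n≰n l)
  ... | no  _    = refl

  num-new : ∀ k → num-at k (suc k) ≡ var zero
  num-new k with k ℕ.≟ k
  ... | yes _ = refl
  ... | no ne = Empty.⊥-elim (ne refl)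

  num : ℕ → Num
  num K = record { at = num-at K ; from = suc K ; stable = num-old }

  setV-at : ℕ → ∀ k → Fin (suc k)
  setV-at K zero    = zero
  setV-at K (suc k) with K ℕ.≟ k
  ... | yes _ = zero
  ... | no  _ = suc (setV-at K k)

  setV-old : ∀ {K k} → suc K ℕ.≤ k → setV-at K (suc k) ≡ suc (setV-at K k)
  setV-old {K} {k} l with K ℕ.≟ k
  ... | yes refl = Empty.⊥-elim (ℕ.1+n≰n l)
  ... | no  _    = refl

  setV-new : ∀ k → setV-at k (suc k) ≡ zero
  setV-new k with k ℕ.≟ k
  ... | yes _ = refl
  ... | no ne = Empty.⊥-elim (ne refl)

  setV : ℕ → SetV
  setV K = record { at = setV-at K ; from = suc K ; stable = setV-old }

  -- At the stage that treats the universal formula, its Henkin axiom reduces it to the instance at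
  -- `num k`, the variable introduced there.
  ∀¹-intro : ∀ {n m} (φ : Formula n (suc m)) τ σ →
             (∀ x → True (inst φ τ (x ∷ₑ σ))) → True (inst (∀¹ φ) τ σ)
  ∀¹-intro φ τ σ h =
    let F = inst (∀¹ φ) τ σ
        k , l , s = staged F (from F) ℕ.≤-refl
        lτ , lσ = from≤ τ σ l
        l' = ℕ.m≤n⇒m≤1+n l
        same : sub (setᶠ τ (suc k)) (numᶠ (num k ∷ₑ σ) (suc k)) φ ≡ wk² (sub (setᶠ τ k) (ext¹ (numᶠ σ k)) φ)
        same = trans
          (sub-cong (λ i → stable (τ i) (lτ i)) (λ where
            zero    → num-new k
            (suc i) → trans (stable (σ i) (lσ i)) (sym (subᵗ-var _))) φ)
          (sym (sub-sub suc var (setᶠ τ k) (ext¹ (numᶠ σ k)) φ))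
    in rule₂ (λ _ → ⇒E)
         (true {inst φ τ (num k ∷ₑ σ) ⇛ F}
           (ℕ.⊔-lub (ℕ.⊔-lub (ℕ.m⊔n≤o⇒m≤o (max (from ∘ τ)) _ l')
             (ℕ.⊔-lub ℕ.≤-refl (ℕ.m⊔n≤o⇒n≤o (max (from ∘ τ)) _ l'))) l')
           (subst (suc k ⊫_) (cong₂ _⇒_ (sym same) (sym (stable F l)))
             (⊩-hyp (inj₂ (inj₂ (_ , s , refl))))))
         (h (num k))

  ∀²-intro : ∀ {n m} (φ : Formula (suc n) m) τ σ →
             (∀ X → True (inst φ (X ∷ₑ τ) σ)) → True (inst (∀² φ) τ σ)
  ∀²-intro φ τ σ h =
    let F = inst (∀² φ) τ σ
        k , l , s = staged F (from F) ℕ.≤-refl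
        lτ , lσ = from≤ τ σ l
        l' = ℕ.m≤n⇒m≤1+n l
        same : sub (setᶠ (setV k ∷ₑ τ) (suc k)) (numᶠ σ (suc k)) φ ≡ wk¹ (sub (ext² (setᶠ τ k)) (numᶠ σ k) φ)
        same = trans
          (sub-cong (λ where
            zero    → setV-new k
            (suc i) → stable (τ i) (lτ i)) (λ i → stable (σ i) (lσ i)) φ)
          (sym (sub-sub id (var ∘ suc) (ext² (setᶠ τ k)) (numᶠ σ k) φ))
    in rule₂ (λ _ → ⇒E)
         (true {inst φ (setV k ∷ₑ τ) σ ⇛ F}
           (ℕ.⊔-lub (ℕ.⊔-lub (ℕ.⊔-lub ℕ.≤-refl (ℕ.m⊔n≤o⇒m≤o (max (from ∘ τ)) _ l'))
             (ℕ.m⊔n≤o⇒n≤o (max (from ∘ τ)) _ l')) l')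
           (subst (suc k ⊫_) (cong₂ _⇒_ (sym same) (sym (stable F l)))
             (⊩-hyp (inj₂ (inj₂ (_ , s , refl))))))
         (h (setV k))

  atom : ∀ {F G} → (∀ k → at F k ≡ at G k) → True F ⟺ True G
  atom e = agree e , agree (sym ∘ e)

  -- Implication exchanges the two directions, so they are proved together. For `∨` and `∃` the
  -- double negation is met by refuting both disjuncts, or all instances, inside the theory.
  truth : ∀ {n m} (φ : Formula n m) τ σ → True (inst φ τ σ) ⟺ ⟦ φ ⟧ τ σ

  sound : ∀ {n m} (φ : Formula n m) {τ σ} → True (inst φ τ σ) → ⟦ φ ⟧ τ σ
  sound φ = proj₁ (truth φ _ _)

  complete : ∀ {n m} (φ : Formula n m) {τ σ} → ⟦ φ ⟧ τ σ → True (inst φ τ σ)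
  complete φ = proj₂ (truth φ _ _)

  refute : ∀ {n m} (φ : Formula n m) {τ σ} → (⟦ φ ⟧ τ σ → Bot) → True (inst (¬ φ) τ σ)
  refute φ h = agree (λ _ → refl) (negate (h ∘ sound φ))

  truth (s ≐ t) τ σ = atom λ k → cong₂ _≐_ (sym (at-⟦⟧ᵗ s σ k)) (sym (at-⟦⟧ᵗ t σ k))
  truth (s ≺ t) τ σ = atom λ k → cong₂ _≺_ (sym (at-⟦⟧ᵗ s σ k)) (sym (at-⟦⟧ᵗ t σ k))
  truth (t ∈ X) τ σ = atom λ k → cong (_∈ _) (sym (at-⟦⟧ᵗ t σ k))
  truth ⊥ τ σ = True-falsum ∘ agree (λ _ → refl) , λ b → maximal 0 λ _ _ → b
  truth (φ ∧ ψ) τ σ =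
    (λ t → sound φ (rule₁ (λ _ → ∧E₁) t) , sound ψ (rule₁ (λ _ → ∧E₂) t)) ,
    (λ (a , b) → rule₂ (λ _ → ∧I) (complete φ a) (complete ψ b))
  truth (φ ∨ ψ) τ σ =
    (λ t h → True-falsum (rule₂ (λ _ → ⇒E)
      (rule₂ {H = inst (¬ (φ ∨ ψ)) τ σ} (λ _ → no-∨) (refute φ (h ∘ inj₁)) (refute ψ (h ∘ inj₂))) t)) ,
    (λ h → True-stable λ n → h λ where
      (inj₁ a) → n (rule₁ (λ _ → ∨I₁) (complete φ a))
      (inj₂ b) → n (rule₁ (λ _ → ∨I₂) (complete ψ b)))
  truth (φ ⇒ ψ) τ σ =
    (λ t a → sound ψ (rule₂ (λ _ → ⇒E) t (complete φ a))) ,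
    (λ f → agree (λ _ → refl) (⇛-intro (complete ψ ∘ f ∘ sound φ)))
  truth (∀¹ φ) τ σ =
    (λ t x → sound φ (rule₁
      (λ k d → subst (T ∣ _ ⊢_) (inst¹-ext¹ φ (setᶠ τ k) σ x) (∀¹E d (at x k))) t)) ,
    (λ f → ∀¹-intro φ τ σ (complete φ ∘ f))
  truth (∃¹ φ) τ σ =
    (λ t h → True-falsum (rule₂ (λ _ → no-∃¹)
      (∀¹-intro (¬ φ) τ σ λ x → refute φ λ a → h (x , a)) t)) ,
    (λ h → True-stable λ n → h λ (x , a) → n (rule₁
      (λ k d → ∃¹I (at x k) (subst (T ∣ _ ⊢_) (sym (inst¹-ext¹ φ (setᶠ τ k) σ x)) d)) (complete φ a)))
  truth (∀² φ) τ σ =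
    (λ t X → sound φ (rule₁
      (λ k d → subst (T ∣ _ ⊢_) (inst²-ext² φ τ (numᶠ σ k) X) (∀²E d (at X k))) t)) ,
    (λ f → ∀²-intro φ τ σ (complete φ ∘ f))
  truth (∃² φ) τ σ =
    (λ t h → True-falsum (rule₂ (λ _ → no-∃²)
      (∀²-intro (¬ φ) τ σ λ X → refute φ λ a → h (X , a)) t)) ,
    (λ h → True-stable λ n → h λ (X , a) → n (rule₁
      (λ k d → ∃²I (at X k) (subst (T ∣ _ ⊢_) (sym (inst²-ext² φ τ (numᶠ σ k) X)) d)) (complete φ a)))

  -- An axiom has to hold at families of terms, that is, for every substitution of terms of a stage;
  -- hence the closure of `T` under substitution.
  termᴹ : (∀ {n m n' m'} {φ : Formula n m} (τ : Fin n → Fin n') (σ : Fin m → Term m') →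
             T φ → T (sub τ σ φ)) →
          Model T
  termᴹ T-sub = record
    { structure = termˢ
    ; ≈-stable = True-stable
    ; <-stable = True-stable
    ; ∈-stable = True-stable
    ; ≈-refl = λ {x} → rule₀ λ k → ≐refl (at x k)
    ; ≈-subst = λ φ τ σ {x} {y} e a → sound φ (rule₂
        (λ k d d' → subst (T ∣ _ ⊢_) (inst¹-ext¹ φ (setᶠ τ k) σ y)
          (≐subst (sub (setᶠ τ k) (ext¹ (numᶠ σ k)) φ) d
            (subst (T ∣ _ ⊢_) (sym (inst¹-ext¹ φ (setᶠ τ k) σ x)) d')))
        e (complete φ a))
    ; axioms = λ {_} {_} {φ} a τ σ → sound φ (rule₀ λ k → axiom (T-sub (setᶠ τ k) (numᶠ σ k) a))
    }

  provable : (∀ τ σ → ⟦ φ₀ ⟧ τ σ) → T ∣ [] ⊢ φ₀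
  provable h = raa (True-falsum (rule₂ (λ _ → ⇒E)
    (true {inst (¬ φ₀) τ₀ ∅} z≤n (⊩-hyp (cong ¬_
      (trans (sub-cong (λ { zero → refl }) (λ ()) φ₀) (sub-id φ₀)))))
    (complete φ₀ (h τ₀ ∅))))
    where
    -- The set variable of `φ₀` itself, which moves up by one index with each later stage.
    root : ∀ k → Fin (suc k)
    root zero    = zero
    root (suc k) = suc (root k)
    τ₀ : Fin 1 → SetV
    τ₀ _ = record { at = root ; from = 0 ; stable = λ _ → refl }

-- Closure of the axioms of RCA₀ under substitution

sub-wk² : ∀ {n n' m m'} (τ : Fin n → Fin n') (σ : Fin m → Term m') φ →
          sub (ext² τ) σ (wk² φ) ≡ wk² (sub τ σ φ)
sub-wk² τ σ φ = trans (sub-sub _ _ _ _ φ)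
  (trans (sub-cong (λ _ → refl) (λ i → sym (subᵗ-var (σ i))) φ) (sym (sub-sub _ _ _ _ φ)))

sub-inst¹ : ∀ {n n' m m'} (τ : Fin n → Fin n') (σ : Fin m → Term m') φ t →
            sub τ σ (φ [ t ]¹) ≡ sub τ (ext¹ σ) φ [ subᵗ σ t ]¹
sub-inst¹ τ σ φ t = trans (sub-sub _ _ _ _ φ) (trans
  (sub-cong (λ _ → refl) (λ where
    zero    → refl
    (suc i) → sym (trans (subᵗ-subᵗ _ _ (σ i)) (subᵗ-var (σ i)))) φ)
  (sym (sub-sub _ _ _ _ φ)))

sub-shift : ∀ {n n' m m'} (τ : Fin n → Fin n') (σ : Fin m → Term m') φ →
            sub τ (ext¹ σ) (shift φ) ≡ shift (sub τ (ext¹ σ) φ)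
sub-shift τ σ φ = trans (sub-sub _ _ _ _ φ) (trans
  (sub-cong (λ _ → refl) (λ where
    zero    → refl
    (suc i) → sym (subᵗ-subᵗ _ _ (σ i))) φ)
  (sym (sub-sub _ _ _ _ φ)))

wkᵗ-sub : ∀ {m m'} (σ : Fin m → Term m') t → wkᵗ (subᵗ σ t) ≡ subᵗ (ext¹ σ) (wkᵗ t)
wkᵗ-sub σ t = trans (subᵗ-subᵗ _ _ t) (sym (subᵗ-subᵗ _ _ t))

Δ₀-sub : ∀ {n n' m m'} (τ : Fin n → Fin n') (σ : Fin m → Term m') {φ} → Δ₀ φ → Δ₀ (sub τ σ φ)
Δ₀-sub τ σ eq        = eq
Δ₀-sub τ σ lt        = lt
Δ₀-sub τ σ mem       = mem
Δ₀-sub τ σ bot       = bot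
Δ₀-sub τ σ (and d e) = and (Δ₀-sub τ σ d) (Δ₀-sub τ σ e)
Δ₀-sub τ σ (or d e)  = or (Δ₀-sub τ σ d) (Δ₀-sub τ σ e)
Δ₀-sub τ σ (imp d e) = imp (Δ₀-sub τ σ d) (Δ₀-sub τ σ e)
Δ₀-sub τ σ (ball t d) = subst (λ b → Δ₀ (∀¹ (var zero ≺ b ⇒ _))) (wkᵗ-sub σ t)
  (ball (subᵗ σ t) (Δ₀-sub τ (ext¹ σ) d))
Δ₀-sub τ σ (bex t d) = subst (λ b → Δ₀ (∃¹ (var zero ≺ b ∧ _))) (wkᵗ-sub σ t)
  (bex (subᵗ σ t) (Δ₀-sub τ (ext¹ σ) d))

Σ⁰₁-sub : ∀ {n n' m m'} (τ : Fin n → Fin n') (σ : Fin m → Term m') {φ} → Σ⁰₁ φ → Σ⁰₁ (sub τ σ φ)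
Σ⁰₁-sub τ σ (ex d) = ex (Δ₀-sub τ (ext¹ σ) d)

Π⁰₁-sub : ∀ {n n' m m'} (τ : Fin n → Fin n') (σ : Fin m → Term m') {φ} → Π⁰₁ φ → Π⁰₁ (sub τ σ φ)
Π⁰₁-sub τ σ (all d) = all (Δ₀-sub τ (ext¹ σ) d)

RCA₀-sub : ∀ {n n' m m'} {φ : Formula n m} (τ : Fin n → Fin n') (σ : Fin m → Term m') →
           RCA₀ φ → RCA₀ (sub τ σ φ)
RCA₀-sub τ σ (+1≢0 s)     = +1≢0 _
RCA₀-sub τ σ (+1-inj s t) = +1-inj _ _
RCA₀-sub τ σ (+-0 s)      = +-0 _
RCA₀-sub τ σ (+-+1 s t)   = +-+1 _ _
RCA₀-sub τ σ (*-0 s)      = *-0 _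
RCA₀-sub τ σ (*-+1 s t)   = *-+1 _ _
RCA₀-sub τ σ (≺-0 s)      = ≺-0 _
RCA₀-sub τ σ (≺-+1 s t)   = ≺-+1 _ _
RCA₀-sub τ σ (Σ⁰₁-ind {φ} d) = subst RCA₀
  (cong₂ _⇒_ (cong₂ _∧_ (sym (sub-inst¹ τ σ φ 𝟎)) (cong (λ ψ → ∀¹ (sub τ (ext¹ σ) φ ⇒ ψ)) (sym (sub-shift τ σ φ)))) refl)
  (Σ⁰₁-ind (Σ⁰₁-sub τ (ext¹ σ) d))
RCA₀-sub τ σ (Δ⁰₁-comp {φ} {ψ} d e) = subst RCA₀
  (cong (λ χ → ∀¹ (sub τ (ext¹ σ) (φ ⇔ ψ)) ⇒ ∃² (∀¹ (var zero ∈ zero ⇔ χ))) (sym (sub-wk² τ (ext¹ σ) φ)))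
  (Δ⁰₁-comp (Σ⁰₁-sub τ (ext¹ σ) d) (Π⁰₁-sub τ (ext¹ σ) e))

-- A closed formula offers no set variable, but every stage presupposes one; comprehension supplies
-- it.
∃²-set : ∀ {n m} → RCA₀ ∣ [] {A = Formula n m} ⊢ ∃² (∀¹ (var zero ∈ zero ⇔ ∃¹ (var zero ≐ var zero)))
∃²-set = ⇒E (axiom (Δ⁰₁-comp (ex eq) (all eq)))
  (∀¹I (∧I (⇒I (∀¹I (≐refl (var zero)))) (⇒I (∃¹I 𝟎 (≐refl 𝟎)))))

completeness : (φ : Formula 0 0) → (∀ (𝓜 : Model RCA₀) τ σ → Model.⟦_⟧ 𝓜 φ τ σ) → RCA₀⊢ φ
completeness φ h = ∃²E ∃²-set (weaken (λ ()) (provable λ τ σ →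
  Structure.⟦⟧-sub⁻ termˢ φ (λ ()) (λ ()) (h (termᴹ RCA₀-sub) (λ ()) (λ ()))))
  where open Henkin RCA₀ (wk² φ)

-- Names for de Bruijn variables

v0 : ∀ {m} → Term (1 ℕ.+ m)
v0 = var 0F
v1 : ∀ {m} → Term (2 ℕ.+ m)
v1 = var 1F
v2 : ∀ {m} → Term (3 ℕ.+ m)
v2 = var 2F
v3 : ∀ {m} → Term (4 ℕ.+ m)
v3 = var 3F
v4 : ∀ {m} → Term (5 ℕ.+ m)
v4 = var 4F
v5 : ∀ {m} → Term (6 ℕ.+ m)
v5 = var 5F
v6 : ∀ {m} → Term (7 ℕ.+ m)
v6 = var 6F
v7 : ∀ {m} → Term (8 ℕ.+ m)
v7 = var 7F
v8 : ∀ {m} → Term (9 ℕ.+ m)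
v8 = var 8F
v9 : ∀ {m} → Term (10 ℕ.+ m)
v9 = var 9F
v10 : ∀ {m} → Term (11 ℕ.+ m)
v10 = var (suc 9F)

-- Models of RCA₀

module Semantics (𝓜 : Model RCA₀) where

  open Model 𝓜 public

  ⟪_,_⟫ : N → N → N
  ⟪ a , b ⟫ = (a ⊹ b) · (a ⊹ b) ⊹ a

  infix 7 _≤_
  _≤_ : N → N → Set
  x ≤ y = ¬¬ (x < y ⊎ x ≈ y)

  -- The definitions down to Target follow those of the formulas step by step, so
  -- that the interpretation of a formula unfolds to the predicate of the same name.
  record Q : Set where
    constructor frac
    field pos neg den-1 : N
    den : N
    den = den-1 ⊹ 1#
  open Q public

  code : Q → N
  code q = ⟪ ⟪ pos q , neg q ⟫ , den-1 q ⟫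

  infixl 8 _+ℚ_
  infix 7 _≤ℚ_ _<ℚ_
  _+ℚ_ : Q → Q → Q
  q +ℚ r = frac (pos q · den r ⊹ pos r · den q) (neg q · den r ⊹ neg r · den q)
                (den-1 q · den-1 r ⊹ den-1 q ⊹ den-1 r)
  _≤ℚ_ _<ℚ_ : Q → Q → Set
  q ≤ℚ r = pos q · den r ⊹ neg r · den q ≤ pos r · den q ⊹ neg q · den r
  q <ℚ r = pos q · den r ⊹ neg r · den q < pos r · den q ⊹ neg q · den r

  0ℚ : Q
  0ℚ = frac 0# 0# 0#

  1/1+_ : N → Q
  1/1+ c = frac 1# 0# c

  ∃N : (N → Set) → Set
  ∃N P = ¬¬ (Σ N P)

  ∃S : (S → Set) → Set
  ∃S P = ¬¬ (Σ S P)

  ∀Q ∃Q : (Q → Set) → Set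
  ∀Q P = ∀ a b c → P (frac a b c)
  ∃Q P = ∃N λ a → ∃N λ b → ∃N λ c → P (frac a b c)

  ¬ˢ_ : Set → Set
  ¬ˢ A = A → Bot

  Graph : Set₁
  Graph = N → N → Set

  gr : S → Graph
  gr X i v = ⟪ i , v ⟫ ∈ˢ X

  row : S → N → Graph
  row X j i v = ⟪ ⟪ j , i ⟫ , v ⟫ ∈ˢ X

  const : N → Graph
  const t i v = v ≈ t

  SingleValued : Graph → Set
  SingleValued A = ∀ i v w → A i v × A i w → v ≈ w

  IsPow2 : S → Set
  IsPow2 E = SingleValued (gr E) × (∀ i → ∃N λ v → gr E i v) × gr E 0# 1# ×
             (∀ i v → gr E i v → gr E (i ⊹ 1#) (v ⊹ v))

  Pow2 : N → N → Set
  Pow2 k p = ∃S λ E →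
    SingleValued (gr E) × (∀ i → ∃N λ v → gr E i v) × gr E 0# 1# ×
             (∀ i v → gr E i v → gr E (i ⊹ 1#) (v ⊹ v)) × gr E k p

  IsReal : Graph → Set
  IsReal A = SingleValued A × (∀ k → ∃Q λ q → A k (code q)) ×
    (∀ i j c → ∀Q λ q → ∀Q λ r → i ≤ j × Pow2 i (c ⊹ 1#) × A i (code q) × A j (code r) →
      q ≤ℚ r +ℚ 1/1+ c × r ≤ℚ q +ℚ 1/1+ c)

  Approx : Set₁
  Approx = N → Q → Set

  [_] : Graph → Approx
  [ A ] k s = A k (code s)

  Sum Max : Graph → Graph → N → Q → Q → Q → Set
  Sum A B k s q r = A (k ⊹ 1#) (code q) × B (k ⊹ 1#) (code r) × code s ≈ code (q +ℚ r)
  Max A B k s q r = A k (code q) × B k (code r) ×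
    ¬¬ (q ≤ℚ r × code s ≈ code r ⊎ r <ℚ q × code s ≈ code q)

  infix 8 _⊕_ _⊔_
  _⊕_ _⊔_ : Graph → Graph → Approx
  (A ⊕ B) k s = ∃Q λ q → ∃Q λ r → Sum A B k s q r
  (A ⊔ B) k s = ∃Q λ q → ∃Q λ r → Max A B k s q r

  infix 7 _≤ᴿ_ _<ᴿ_ _≈ᴿ_
  _≤ᴿ_ _<ᴿ_ _≈ᴿ_ : Approx → Approx → Set
  A ≤ᴿ B = ∀ k c → ∀Q λ q → ∀Q λ r → Pow2 k (c ⊹ 1#) × A k q × B k r → q ≤ℚ r +ℚ (1/1+ c +ℚ 1/1+ c)
  A <ᴿ B = ¬ˢ (B ≤ᴿ A)
  A ≈ᴿ B = A ≤ᴿ B × B ≤ᴿ A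

  rat : Q → Graph
  rat q = const (code q)

  0ᴿ : Graph
  0ᴿ = rat 0ℚ

  module Spaces (X D : S) where

    dist : N → N → Graph
    dist a b = row D ⟪ a , b ⟫

    IsSpace : Set
    IsSpace = (∃N λ a → a ∈ˢ X) ×
      (∀ a b → a ∈ˢ X × b ∈ˢ X → IsReal (dist a b) × [ dist a a ] ≈ᴿ [ 0ᴿ ] ×
         [ dist a b ] ≈ᴿ [ dist b a ] × [ 0ᴿ ] ≤ᴿ [ dist a b ]) ×
      (∀ a b c → a ∈ˢ X × b ∈ˢ X × c ∈ˢ X → [ dist a c ] ≤ᴿ dist a b ⊕ dist b c)

    IsPoint : Graph → Set
    IsPoint x = SingleValued x × (∀ i → ∃N λ a → a ∈ˢ X × x i a) ×
      (∀ i j c a b → i ≤ j × Pow2 i (c ⊹ 1#) × x i a × x j b → [ dist a b ] ≤ᴿ [ rat (1/1+ c) ])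

    Dist : Graph → Graph → Graph → Set
    Dist x y R = IsReal R × (∀Q λ ε → 0ℚ <ℚ ε → ∃N λ n → ∀ i a b → n ≤ i × x i a × y i b →
      [ dist a b ] <ᴿ R ⊕ rat ε × [ R ] <ᴿ dist a b ⊕ rat ε)

    EqPoint : Graph → Graph → Set
    EqPoint x y = Dist x y 0ᴿ

    Dist≤ Dist< : Graph → Graph → Graph → Set
    Dist≤ x y A = ∃S λ R → Dist x y (gr R) × [ gr R ] ≤ᴿ [ A ]
    Dist< x y A = ∃S λ R → Dist x y (gr R) × [ gr R ] <ᴿ [ A ]

    IsUltrametric : Set
    IsUltrametric = ∀ x y z R S T →
      IsPoint (gr x) × IsPoint (gr y) × IsPoint (gr z) ×
      Dist (gr x) (gr y) (gr R) × Dist (gr x) (gr z) (gr S) × Dist (gr z) (gr y) (gr T) →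
      [ gr R ] ≤ᴿ gr S ⊔ gr T

    SubBall : Graph → Graph → Graph → Graph → Set
    SubBall x r y s = ∃S λ R → Dist x y (gr R) × gr R ⊔ r ≤ᴿ [ s ]

    IsSphericallyComplete : Set
    IsSphericallyComplete = ∀ x r →
      (∀ i → IsPoint (row x i) × IsReal (row r i) × [ 0ᴿ ] <ᴿ [ row r i ]) ×
      (∀ i → SubBall (row x (i ⊹ 1#)) (row r (i ⊹ 1#)) (row x i) (row r i)) →
      (∃S λ y → IsPoint (gr y) × (∀ i → Dist≤ (row x i) (gr y) (row r i)))

    quint : N → N → N → N → N → N
    quint k a r b s = ⟪ k , ⟪ a , ⟪ r , ⟪ b , s ⟫ ⟫ ⟫ ⟫

    Rel : S → N → Q → N → Q → Set
    Rel Φ a r b s = ∃N λ k → quint k a (code r) b (code s) ∈ˢ Φ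

    Inside : N → Q → N → Q → Set
    Inside a' r' a r = dist a a' ⊕ rat r' <ᴿ [ rat r ]

    IsPartialContinuous : S → Set
    IsPartialContinuous Φ =
      (∀ z → z ∈ˢ Φ → ∃N λ k → ∃N λ a → ∃Q λ r → ∃N λ b → ∃Q λ s →
        z ≈ quint k a (code r) b (code s) × a ∈ˢ X × 0ℚ <ℚ r × b ∈ˢ X × 0ℚ <ℚ s) ×
      (∀ a → ∀Q λ r → ∀ b → ∀Q λ s → ∀ b' → ∀Q λ s' → Rel Φ a r b s × Rel Φ a r b' s' →
        [ dist b b' ] ≤ᴿ rat s ⊕ rat s') ×
      (∀ a → ∀Q λ r → ∀ b → ∀Q λ s → ∀ a' → ∀Q λ r' →
        a' ∈ˢ X × 0ℚ <ℚ r' × Rel Φ a r b s × Inside a' r' a r → Rel Φ a' r' b s) ×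
      (∀ a → ∀Q λ r → ∀ b → ∀Q λ s → ∀ b' → ∀Q λ s' →
        b' ∈ˢ X × 0ℚ <ℚ s' × Rel Φ a r b s × Inside b s b' s' → Rel Φ a r b' s')

    InDomain : S → Graph → Set
    InDomain Φ x = ∀Q λ ε → 0ℚ <ℚ ε → ∃N λ a → ∃Q λ r → ∃N λ b → ∃Q λ s →
      Rel Φ a r b s × Dist< x (const a) (rat r) × s <ℚ ε

    IsContinuous : S → Set
    IsContinuous Φ = IsPartialContinuous Φ × (∀ x → IsPoint (gr x) → InDomain Φ (gr x))

    Value : S → Graph → Graph → Set
    Value Φ x y = ∀ a → ∀Q λ r → ∀ b → ∀Q λ s → Rel Φ a r b s × Dist< x (const a) (rat r) →
      Dist≤ y (const b) (rat s)

    IsStrictlyContracting : S → Set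
    IsStrictlyContracting Φ = ∀ x y u v R S →
      IsPoint (gr x) × IsPoint (gr y) × IsPoint (gr u) × IsPoint (gr v) ×
      ¬ˢ EqPoint (gr x) (gr y) × Value Φ (gr x) (gr u) × Value Φ (gr y) (gr v) ×
      Dist (gr u) (gr v) (gr R) × Dist (gr x) (gr y) (gr S) → [ gr R ] <ᴿ [ gr S ]

    HasUniqueFixedPoint : S → Set
    HasUniqueFixedPoint Φ = ∃S λ x → (IsPoint (gr x) × Value Φ (gr x) (gr x)) ×
      (∀ y → IsPoint (gr y) × Value Φ (gr y) (gr y) → EqPoint (gr x) (gr y))

  Target : Set
  Target = ∀ X D Φ → let open Spaces X D in
    IsSpace × IsUltrametric × IsSphericallyComplete × IsContinuous Φ × IsStrictlyContracting Φ →
    HasUniqueFixedPoint Φ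

  -- Stability under double negation

  record Stable (A : Set) : Set where
    constructor mk
    field stable : ¬¬ A → A
  open Stable {{...}} public

  instance
    ≈-Stable : ∀ {x y} → Stable (x ≈ y)
    ≈-Stable = mk ≈-stable

    <-Stable : ∀ {x y} → Stable (x < y)
    <-Stable = mk <-stable

    ∈-Stable : ∀ {x X} → Stable (x ∈ˢ X)
    ∈-Stable = mk ∈-stable

    Bot-Stable : Stable Bot
    Bot-Stable = mk λ h → h id

    Π-Stable : ∀ {A : Set} {B : A → Set} {{_ : ∀ {a} → Stable (B a)}} → Stable (∀ a → B a)
    Π-Stable = mk λ h a → stable λ k → h λ f → k (f a)

    ×-Stable : ∀ {A B : Set} {{_ : Stable A}} {{_ : Stable B}} → Stable (A × B)
    ×-Stable = mk λ h → stable (λ k → h (k ∘ proj₁)) , stable (λ k → h (k ∘ proj₂))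

  infixl 1 _>>=_
  -- The continuation may end in any stable type, so a `do` block can prove an atomic fact directly
  -- and not only its double negation.
  _>>=_ : ∀ {A B : Set} {{_ : Stable B}} → ¬¬ A → (A → B) → B
  m >>= f = stable λ k → m (k ∘ f)

  return : ∀ {A : Set} → A → ¬¬ A
  return a k = k a

  em : ∀ (A : Set) → ¬¬ (A ⊎ ¬ˢ A)
  em A k = k (inj₂ (k ∘ inj₁))

  absurd : ∀ {A : Set} {{_ : Stable A}} → Bot → A
  absurd b = stable λ _ → b

  ⟦⟧-stable : ∀ {n m} (φ : Formula n m) {τ σ} → Stable (⟦ φ ⟧ τ σ)
  ⟦⟧-stable (s ≐ t) = ≈-Stable
  ⟦⟧-stable (s ≺ t) = <-Stable
  ⟦⟧-stable (t ∈ X) = ∈-Stable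
  ⟦⟧-stable ⊥       = Bot-Stable
  ⟦⟧-stable (φ ∧ ψ) = ×-Stable {{⟦⟧-stable φ}} {{⟦⟧-stable ψ}}
  ⟦⟧-stable (φ ∨ ψ) = Π-Stable
  ⟦⟧-stable (φ ⇒ ψ) = Π-Stable {{⟦⟧-stable ψ}}
  ⟦⟧-stable (∀¹ φ)  = Π-Stable {{⟦⟧-stable φ}}
  ⟦⟧-stable (∃¹ φ)  = Π-Stable
  ⟦⟧-stable (∀² φ)  = Π-Stable {{⟦⟧-stable φ}}
  ⟦⟧-stable (∃² φ)  = Π-Stable

  induction : ∀ {n m} {φ : Formula n (suc m)} → Σ⁰₁ φ → ∀ τ σ → ⟦ φ ⟧ τ (0# ∷ₑ σ) →
              (∀ x → ⟦ φ ⟧ τ (x ∷ₑ σ) → ⟦ φ ⟧ τ (x ⊹ 1# ∷ₑ σ)) → ∀ x → ⟦ φ ⟧ τ (x ∷ₑ σ)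
  induction {φ = φ} d τ σ z s = axioms (Σ⁰₁-ind d) τ σ
    ( ⟦⟧-sub⁻ φ (λ _ → ≡.refl) (λ { zero → ≡.refl ; (suc i) → ≡.refl }) z
    , λ x a → ⟦⟧-sub⁻ φ (λ _ → ≡.refl) (λ { zero → ≡.refl ; (suc i) → ≡.refl }) (s x a))

  -- `Σ⁰₁-ind` expects an existential formula, so a vacuous quantifier with witness `0#` is put in
  -- front.
  induction₀ : ∀ {n m} (φ : Formula n (suc m)) → Δ₀ φ → ∀ τ σ → ⟦ φ ⟧ τ (0# ∷ₑ σ) →
               (∀ x → ⟦ φ ⟧ τ (x ∷ₑ σ) → ⟦ φ ⟧ τ (x ⊹ 1# ∷ₑ σ)) → ∀ x → ⟦ φ ⟧ τ (x ∷ₑ σ)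
  induction₀ φ d τ σ z s x = stable {{⟦⟧-stable φ}} λ k →
    induction (ex (Δ₀-sub id (var ∘ suc) d)) τ σ (pad z)
      (λ y h k' → h λ (w , a) → pad (s y (⟦⟧-sub φ (λ _ → ≡.refl) (λ _ → ≡.refl) a)) k') x
      λ (w , a) → k (⟦⟧-sub φ (λ _ → ≡.refl) (λ _ → ≡.refl) a)
    where
    pad : ∀ {y} → ⟦ φ ⟧ τ (y ∷ₑ σ) → ⟦ ∃¹ (wk¹ φ) ⟧ τ (y ∷ₑ σ)
    pad a k = k (0# , ⟦⟧-sub⁻ φ (λ _ → ≡.refl) (λ _ → ≡.refl) a)

  -- The commutative semiring of numbers

  ≈-sym : ∀ {x y} → x ≈ y → y ≈ x
  ≈-sym {x} e = ≈-subst (v0 ≐ v1) ∅ (x ∷ₑ ∅) e ≈-refl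

  ≈-trans : ∀ {x y z} → x ≈ y → y ≈ z → x ≈ z
  ≈-trans {x} e f = ≈-subst (v1 ≐ v0) ∅ (x ∷ₑ ∅) f e

  ⊹-cong : ∀ {x x' y y'} → x ≈ x' → y ≈ y' → x ⊹ y ≈ x' ⊹ y'
  ⊹-cong {x} {x'} {y} e f = ≈-trans
    (≈-subst (v1 + v2 ≐ v0 + v2) ∅ (x ∷ₑ y ∷ₑ ∅) e ≈-refl)
    (≈-subst (v1 + v2 ≐ v1 + v0) ∅ (x' ∷ₑ y ∷ₑ ∅) f ≈-refl)

  ·-cong : ∀ {x x' y y'} → x ≈ x' → y ≈ y' → x · y ≈ x' · y'
  ·-cong {x} {x'} {y} e f = ≈-trans
    (≈-subst (v1 * v2 ≐ v0 * v2) ∅ (x ∷ₑ y ∷ₑ ∅) e ≈-refl)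
    (≈-subst (v1 * v2 ≐ v1 * v0) ∅ (x' ∷ₑ y ∷ₑ ∅) f ≈-refl)

  <-resp : ∀ {x x' y y'} → x ≈ x' → y ≈ y' → x < y → x' < y'
  <-resp {x} {x'} {y} e f a = ≈-subst (v1 ≺ v0) ∅ (x' ∷ₑ ∅) f (≈-subst (v0 ≺ v1) ∅ (y ∷ₑ ∅) e a)

  ∈-resp : ∀ {x x' X} → x ≈ x' → x ∈ˢ X → x' ∈ˢ X
  ∈-resp {X = X} e a = ≈-subst (v0 ∈ zero) (X ∷ₑ ∅) ∅ e a

  setoid : Setoid _ _
  setoid = record { Carrier = N ; _≈_ = _≈_
    ; isEquivalence = record { refl = ≈-refl ; sym = ≈-sym ; trans = ≈-trans } }

  module ≈-Reasoning = Relation.Binary.Reasoning.Setoid setoid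
  open ≈-Reasoning

  ⊹-0 : ∀ x → x ⊹ 0# ≈ x
  ⊹-0 x = axioms (+-0 v0) ∅ (x ∷ₑ ∅)

  ⊹-suc : ∀ x y → x ⊹ (y ⊹ 1#) ≈ x ⊹ y ⊹ 1#
  ⊹-suc x y = axioms (+-+1 v0 v1) ∅ (x ∷ₑ y ∷ₑ ∅)

  ·-0 : ∀ x → x · 0# ≈ 0#
  ·-0 x = axioms (*-0 v0) ∅ (x ∷ₑ ∅)

  ·-suc : ∀ x y → x · (y ⊹ 1#) ≈ x · y ⊹ x
  ·-suc x y = axioms (*-+1 v0 v1) ∅ (x ∷ₑ y ∷ₑ ∅)

  suc-cong : ∀ {x y} → x ≈ y → x ⊹ 1# ≈ y ⊹ 1#
  suc-cong e = ⊹-cong e ≈-refl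

  0-⊹ : ∀ x → 0# ⊹ x ≈ x
  0-⊹ = induction₀ (𝟎 + v0 ≐ v0) eq ∅ ∅ (⊹-0 _) λ x h → ≈-trans (⊹-suc _ _) (suc-cong h)

  suc-⊹ : ∀ x y → x ⊹ 1# ⊹ y ≈ x ⊹ y ⊹ 1#
  suc-⊹ x = induction₀ (v1 + 𝟏 + v0 ≐ v1 + v0 + 𝟏) eq ∅ (x ∷ₑ ∅)
    (≈-trans (⊹-0 _) (suc-cong (≈-sym (⊹-0 _))))
    λ y h → begin
      x ⊹ 1# ⊹ (y ⊹ 1#)  ≈⟨ ⊹-suc _ _ ⟩
      x ⊹ 1# ⊹ y ⊹ 1#    ≈⟨ suc-cong h ⟩
      x ⊹ y ⊹ 1# ⊹ 1#    ≈⟨ suc-cong (⊹-suc x y) ⟨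
      x ⊹ (y ⊹ 1#) ⊹ 1#  ∎

  ⊹-comm : ∀ x y → x ⊹ y ≈ y ⊹ x
  ⊹-comm x = induction₀ (v1 + v0 ≐ v0 + v1) eq ∅ (x ∷ₑ ∅)
    (≈-trans (⊹-0 _) (≈-sym (0-⊹ _)))
    λ y h → ≈-trans (⊹-suc x y) (≈-trans (suc-cong h) (≈-sym (suc-⊹ y x)))

  ⊹-assoc : ∀ x y z → x ⊹ y ⊹ z ≈ x ⊹ (y ⊹ z)
  ⊹-assoc x y = induction₀ (v1 + v2 + v0 ≐ v1 + (v2 + v0)) eq ∅ (x ∷ₑ y ∷ₑ ∅)
    (≈-trans (⊹-0 _) (⊹-cong ≈-refl (≈-sym (⊹-0 _))))
    λ z h → begin
      x ⊹ y ⊹ (z ⊹ 1#)    ≈⟨ ⊹-suc _ _ ⟩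
      x ⊹ y ⊹ z ⊹ 1#      ≈⟨ suc-cong h ⟩
      x ⊹ (y ⊹ z) ⊹ 1#    ≈⟨ ⊹-suc _ _ ⟨
      x ⊹ (y ⊹ z ⊹ 1#)    ≈⟨ ⊹-cong ≈-refl (⊹-suc _ _) ⟨
      x ⊹ (y ⊹ (z ⊹ 1#))  ∎

  ⊹-swap : ∀ x y z → x ⊹ y ⊹ z ≈ x ⊹ z ⊹ y
  ⊹-swap x y z = ≈-trans (⊹-assoc x y z) (≈-trans (⊹-cong ≈-refl (⊹-comm y z)) (≈-sym (⊹-assoc x z y)))

  0-· : ∀ x → 0# · x ≈ 0#
  0-· = induction₀ (𝟎 * v0 ≐ 𝟎) eq ∅ ∅ (·-0 _) λ x h → ≈-trans (·-suc _ _) (≈-trans (⊹-0 _) h)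

  suc-· : ∀ x y → (x ⊹ 1#) · y ≈ x · y ⊹ y
  suc-· x = induction₀ ((v1 + 𝟏) * v0 ≐ v1 * v0 + v0) eq ∅ (x ∷ₑ ∅)
    (≈-trans (·-0 _) (≈-sym (≈-trans (⊹-0 _) (·-0 _))))
    λ y h → begin
      (x ⊹ 1#) · (y ⊹ 1#)      ≈⟨ ·-suc _ _ ⟩
      (x ⊹ 1#) · y ⊹ (x ⊹ 1#)  ≈⟨ ⊹-cong h ≈-refl ⟩
      x · y ⊹ y ⊹ (x ⊹ 1#)     ≈⟨ ⊹-suc _ _ ⟩
      x · y ⊹ y ⊹ x ⊹ 1#       ≈⟨ suc-cong (⊹-swap (x · y) y x) ⟩
      x · y ⊹ x ⊹ y ⊹ 1#       ≈⟨ ⊹-suc _ _ ⟨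
      x · y ⊹ x ⊹ (y ⊹ 1#)     ≈⟨ ⊹-cong (·-suc x y) ≈-refl ⟨
      x · (y ⊹ 1#) ⊹ (y ⊹ 1#)  ∎

  ·-comm : ∀ x y → x · y ≈ y · x
  ·-comm x = induction₀ (v1 * v0 ≐ v0 * v1) eq ∅ (x ∷ₑ ∅)
    (≈-trans (·-0 _) (≈-sym (0-· _)))
    λ y h → ≈-trans (·-suc x y) (≈-trans (⊹-cong h ≈-refl) (≈-sym (suc-· y x)))

  ·-distribˡ : ∀ x y z → x · (y ⊹ z) ≈ x · y ⊹ x · z
  ·-distribˡ x y = induction₀ (v1 * (v2 + v0) ≐ v1 * v2 + v1 * v0) eq ∅ (x ∷ₑ y ∷ₑ ∅)
    (≈-trans (·-cong ≈-refl (⊹-0 y)) (≈-sym (≈-trans (⊹-cong ≈-refl (·-0 x)) (⊹-0 _))))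
    λ z h → begin
      x · (y ⊹ (z ⊹ 1#))      ≈⟨ ·-cong ≈-refl (⊹-suc y z) ⟩
      x · (y ⊹ z ⊹ 1#)        ≈⟨ ·-suc _ _ ⟩
      x · (y ⊹ z) ⊹ x         ≈⟨ ⊹-cong h ≈-refl ⟩
      x · y ⊹ x · z ⊹ x       ≈⟨ ⊹-assoc _ _ _ ⟩
      x · y ⊹ (x · z ⊹ x)     ≈⟨ ⊹-cong ≈-refl (·-suc x z) ⟨
      x · y ⊹ x · (z ⊹ 1#)    ∎

  ·-assoc : ∀ x y z → x · y · z ≈ x · (y · z)
  ·-assoc x y = induction₀ (v1 * v2 * v0 ≐ v1 * (v2 * v0)) eq ∅ (x ∷ₑ y ∷ₑ ∅)
    (≈-trans (·-0 _) (≈-sym (≈-trans (·-cong ≈-refl (·-0 y)) (·-0 x))))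
    λ z h → begin
      x · y · (z ⊹ 1#)      ≈⟨ ·-suc _ _ ⟩
      x · y · z ⊹ x · y     ≈⟨ ⊹-cong h ≈-refl ⟩
      x · (y · z) ⊹ x · y   ≈⟨ ·-distribˡ _ _ _ ⟨
      x · (y · z ⊹ y)       ≈⟨ ·-cong ≈-refl (·-suc y z) ⟨
      x · (y · (z ⊹ 1#))    ∎

  ·-1 : ∀ x → x · 1# ≈ x
  ·-1 x = begin
    x · 1#         ≈⟨ ·-cong ≈-refl (0-⊹ 1#) ⟨
    x · (0# ⊹ 1#)  ≈⟨ ·-suc x 0# ⟩
    x · 0# ⊹ x     ≈⟨ ⊹-cong (·-0 x) ≈-refl ⟩
    0# ⊹ x         ≈⟨ 0-⊹ x ⟩
    x              ∎

  commutativeSemiring : CommutativeSemiring _ _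
  commutativeSemiring = record
    { Carrier = N ; _≈_ = _≈_ ; _+_ = _⊹_ ; _*_ = _·_ ; 0# = 0# ; 1# = 1#
    ; isCommutativeSemiring = record
      { isSemiring = record
        { isSemiringWithoutAnnihilatingZero = record
          { +-isCommutativeMonoid = record
            { isMonoid = record
              { isSemigroup = record
                { isMagma = record
                  { isEquivalence = Setoid.isEquivalence setoid ; ∙-cong = ⊹-cong }
                ; assoc = ⊹-assoc }
              ; identity = 0-⊹ , ⊹-0 }
            ; comm = ⊹-comm }
          ; *-cong = ·-cong
          ; *-assoc = ·-assoc
          ; *-identity = (λ x → ≈-trans (·-comm 1# x) (·-1 x)) , ·-1
          ; distrib = ·-distribˡ , λ x y z → ≈-trans (·-comm (y ⊹ z) x)
              (≈-trans (·-distribˡ x y z) (⊹-cong (·-comm x y) (·-comm x z))) }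
        ; zero = 0-· , ·-0 }
      ; *-comm = ·-comm } }

  open Algebra.Solver.Ring.NaturalCoefficients.Default commutativeSemiring public
    using (solve; _:+_; _:*_; _:=_; con)

  -- The order of the numbers

  ≮0 : ∀ {x} → x < 0# → Bot
  ≮0 {x} = axioms (≺-0 v0) ∅ (x ∷ₑ ∅)

  <suc⇒≤ : ∀ {x y} → x < y ⊹ 1# → x ≤ y
  <suc⇒≤ {x} {y} = proj₁ (axioms (≺-+1 v0 v1) ∅ (x ∷ₑ y ∷ₑ ∅))

  ≤⇒<suc : ∀ {x y} → x ≤ y → x < y ⊹ 1#
  ≤⇒<suc {x} {y} = proj₂ (axioms (≺-+1 v0 v1) ∅ (x ∷ₑ y ∷ₑ ∅))

  suc≉0 : ∀ {x} → x ⊹ 1# ≈ 0# → Bot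
  suc≉0 {x} = axioms (+1≢0 v0) ∅ (x ∷ₑ ∅)

  suc-injective : ∀ {x y} → x ⊹ 1# ≈ y ⊹ 1# → x ≈ y
  suc-injective {x} {y} = axioms (+1-inj v0 v1) ∅ (x ∷ₑ y ∷ₑ ∅)

  ≤-reflexive : ∀ {x y} → x ≈ y → x ≤ y
  ≤-reflexive e = return (inj₂ e)

  ≤-refl : ∀ {x} → x ≤ x
  ≤-refl = ≤-reflexive ≈-refl

  <⇒≤ : ∀ {x y} → x < y → x ≤ y
  <⇒≤ l = return (inj₁ l)

  -- For the induction formula to be Σ⁰₁, the hypothesis `x < y` stays under the existential
  -- quantifier; where it fails, the witness is an arbitrary `0#`.
  <⇒∃ : ∀ {x y} → x < y → ∃N λ z → x ⊹ (z ⊹ 1#) ≈ y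
  <⇒∃ {x} {y} l = do
    z , h ← induction {φ = ∃¹ (v2 ≺ v1 ⇒ v2 + (v0 + 𝟏) ≐ v1)} (ex (imp lt eq)) ∅ (x ∷ₑ ∅)
      (return (0# , absurd ∘ ≮0)) step y
    return (z , h l)
    where
    step : ∀ y → ∃N (λ z → x < y → x ⊹ (z ⊹ 1#) ≈ y) → ∃N (λ z → x < y ⊹ 1# → x ⊹ (z ⊹ 1#) ≈ y ⊹ 1#)
    step y h = do
      inj₁ l ← em (x < y)
        where inj₂ ¬l → return (0# , λ l → do
                inj₂ e ← <suc⇒≤ l
                  where inj₁ l → absurd (¬l l)
                ⊹-cong e (0-⊹ 1#))
      z , k ← h
      return (z ⊹ 1# , λ _ → ≈-trans (⊹-suc _ _) (suc-cong (k l)))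

  <-⊹suc : ∀ x z → x < x ⊹ (z ⊹ 1#)
  <-⊹suc x = induction₀ (v1 ≺ v1 + (v0 + 𝟏)) lt ∅ (x ∷ₑ ∅)
    (<-resp ≈-refl (⊹-cong ≈-refl (≈-sym (0-⊹ 1#))) (≤⇒<suc ≤-refl))
    λ z h → <-resp ≈-refl (≈-sym (⊹-suc _ _)) (≤⇒<suc (<⇒≤ h))

  ∃⇒< : ∀ {x y z} → x ⊹ (z ⊹ 1#) ≈ y → x < y
  ∃⇒< {x} e = <-resp ≈-refl e (<-⊹suc x _)

  0≤ : ∀ x → 0# ≤ x
  0≤ = induction₀ (𝟎 ≼ v0) (or lt eq) ∅ ∅ ≤-refl λ x h → <⇒≤ (≤⇒<suc h)

  zero-or-suc : ∀ x → ¬¬ (x ≈ 0# ⊎ Σ N λ y → x ≈ y ⊹ 1#)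
  zero-or-suc x = do
    inj₁ l ← 0≤ x
      where inj₂ e → return (inj₁ (≈-sym e))
    y , e ← <⇒∃ l
    return (inj₂ (y , ≈-trans (≈-sym e) (0-⊹ _)))

  ≤⇒∃ : ∀ {x y} → x ≤ y → ∃N λ z → x ⊹ z ≈ y
  ≤⇒∃ l = do
    inj₁ l ← l
      where inj₂ e → return (0# , ≈-trans (⊹-0 _) e)
    z , e ← <⇒∃ l
    return (z ⊹ 1# , e)

  ∃⇒≤ : ∀ {x y z} → x ⊹ z ≈ y → x ≤ y
  ∃⇒≤ {x} {y} {z} e = do
    inj₂ (w , f) ← zero-or-suc z
      where inj₁ f → ≤-reflexive (≈-trans (≈-trans (≈-sym (⊹-0 _)) (⊹-cong ≈-refl (≈-sym f))) e)
    <⇒≤ (∃⇒< (≈-trans (⊹-cong ≈-refl (≈-sym f)) e))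

  ⊹-cancelʳ : ∀ {x y} z → x ⊹ z ≈ y ⊹ z → x ≈ y
  ⊹-cancelʳ {x} {y} = induction₀ (v1 + v0 ≐ v2 + v0 ⇒ v1 ≐ v2) (imp eq eq) ∅ (x ∷ₑ y ∷ₑ ∅)
    (λ e → ≈-trans (≈-sym (⊹-0 _)) (≈-trans e (⊹-0 _)))
    λ z h e → h (suc-injective (≈-trans (≈-sym (⊹-suc _ _)) (≈-trans e (⊹-suc _ _))))

  ⊹-cancelˡ : ∀ {y z} x → x ⊹ y ≈ x ⊹ z → y ≈ z
  ⊹-cancelˡ x e = ⊹-cancelʳ x (≈-trans (⊹-comm _ _) (≈-trans e (⊹-comm _ _)))

  <-irrefl : ∀ {x y} → x ≈ y → x < y → Bot
  <-irrefl {x} e l = do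
    z , f ← <⇒∃ l
    suc≉0 (⊹-cancelˡ x (≈-trans f (≈-trans (≈-sym e) (≈-sym (⊹-0 _)))))

  ≤-trans : ∀ {x y z} → x ≤ y → y ≤ z → x ≤ z
  ≤-trans l l' = do
    a , e ← ≤⇒∃ l
    b , f ← ≤⇒∃ l'
    ∃⇒≤ (≈-trans (≈-sym (⊹-assoc _ a b)) (≈-trans (⊹-cong e ≈-refl) f))

  <-≤-trans : ∀ {x y z} → x < y → y ≤ z → x < z
  <-≤-trans l l' = do
    a , e ← <⇒∃ l
    b , f ← ≤⇒∃ l'
    ∃⇒< (≈-trans (⊹-cong ≈-refl (≈-sym (suc-⊹ a b)))
          (≈-trans (≈-sym (⊹-assoc _ (a ⊹ 1#) b)) (≈-trans (⊹-cong e ≈-refl) f)))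

  <⇒suc≤ : ∀ {x y} → x < y → x ⊹ 1# ≤ y
  <⇒suc≤ {x} l = do
    z , e ← <⇒∃ l
    ∃⇒≤ (≈-trans (≈-trans (suc-⊹ x z) (≈-sym (⊹-suc x z))) e)

  suc≤⇒< : ∀ {x y} → x ⊹ 1# ≤ y → x < y
  suc≤⇒< = <-≤-trans (≤⇒<suc ≤-refl)

  <⇒≱ : ∀ {x y} → x < y → y ≤ x → Bot
  <⇒≱ l l' = <-irrefl ≈-refl (<-≤-trans l l')

  compare : ∀ x y → ¬¬ (x ≤ y ⊎ y < x)
  compare x = induction₀ (v1 ≼ v0 ∨ v0 ≺ v1) (or (or lt eq) lt) ∅ (x ∷ₑ ∅)
    (do
      inj₁ l ← 0≤ x
        where inj₂ e → return (inj₁ (≤-reflexive (≈-sym e)))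
      return (inj₂ l))
    λ y h → do
      inj₂ l ← h
        where inj₁ l → return (inj₁ (<⇒≤ (≤⇒<suc l)))
      inj₁ l' ← <⇒suc≤ l
        where inj₂ e → return (inj₁ (≤-reflexive (≈-sym e)))
      return (inj₂ l')

  ≰⇒> : ∀ {x y} → ¬ˢ (x ≤ y) → y < x
  ≰⇒> {x} {y} n = do
    inj₂ l ← compare x y
      where inj₁ l → absurd (n l)
    l

  ≮⇒≥ : ∀ {x y} → ¬ˢ (x < y) → y ≤ x
  ≮⇒≥ {x} {y} n = do
    inj₁ l ← compare y x
      where inj₂ l → absurd (n l)
    l

  ≤-resp : ∀ {x x' y y'} → x ≈ x' → y ≈ y' → x ≤ y → x' ≤ y'
  ≤-resp e f l = ≤-trans (≤-reflexive (≈-sym e)) (≤-trans l (≤-reflexive f))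

  ≤-antisym : ∀ {x y} → x ≤ y → y ≤ x → x ≈ y
  ≤-antisym l l' = do
    inj₂ e ← l
      where inj₁ l → absurd (<⇒≱ l l')
    e

  ⊹-mono : ∀ {x x' y y'} → x ≤ x' → y ≤ y' → x ⊹ y ≤ x' ⊹ y'
  ⊹-mono {x} {_} {y} l l' = do
    a , e ← ≤⇒∃ l
    b , f ← ≤⇒∃ l'
    ∃⇒≤ (≈-trans (solve 4 (λ x y a b → x :+ y :+ (a :+ b) := x :+ a :+ (y :+ b)) ≈-refl x y a b) (⊹-cong e f))

  ·-monoˡ : ∀ {x x'} y → x ≤ x' → x · y ≤ x' · y
  ·-monoˡ {x} y l = do
    a , e ← ≤⇒∃ l
    ∃⇒≤ (≈-trans (solve 3 (λ x y a → x :* y :+ a :* y := (x :+ a) :* y) ≈-refl x y a) (·-cong e ≈-refl))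

  ·-mono : ∀ {x x' y y'} → x ≤ x' → y ≤ y' → x · y ≤ x' · y'
  ·-mono {x} {x'} {y} {y'} l l' = ≤-trans (·-monoˡ y l)
    (≤-resp (·-comm y x') (·-comm y' x') (·-monoˡ x' l'))

  ⊹-cancel-≤ : ∀ {x y} z → x ⊹ z ≤ y ⊹ z → x ≤ y
  ⊹-cancel-≤ {x} {y} z l = do
    a , e ← ≤⇒∃ l
    ∃⇒≤ (⊹-cancelʳ z (≈-trans (⊹-swap x a z) e))

  ·-cancel-≤ : ∀ {x y} c → x · (c ⊹ 1#) ≤ y · (c ⊹ 1#) → x ≤ y
  ·-cancel-≤ {x} {y} c l = do
    inj₂ l' ← compare x y
      where inj₁ l → l
    z , e ← <⇒∃ l'
    absurd (<⇒≱ (∃⇒< {z = z · c ⊹ z ⊹ c} (begin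
        y · (c ⊹ 1#) ⊹ (z · c ⊹ z ⊹ c ⊹ 1#)
          ≈⟨ solve 3 (λ y z c → y :* (c :+ con 1) :+ (z :* c :+ z :+ c :+ con 1) :=
               (y :+ (z :+ con 1)) :* (c :+ con 1)) ≈-refl y z c ⟩
        (y ⊹ (z ⊹ 1#)) · (c ⊹ 1#)  ≈⟨ ·-cong e ≈-refl ⟩
        x · (c ⊹ 1#) ∎)) l)

  ≤-⊹ʳ : ∀ x y → x ≤ x ⊹ y
  ≤-⊹ʳ x y = ∃⇒≤ ≈-refl

  ≤-⊹ˡ : ∀ x y → y ≤ x ⊹ y
  ≤-⊹ˡ x y = ∃⇒≤ (⊹-comm y x)

  -- Injectivity of pairing

  ≤-square : ∀ x → x ≤ x · x
  ≤-square x = do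
    inj₂ (y , e) ← zero-or-suc x
      where inj₁ e → ≤-resp (≈-sym e) ≈-refl (0≤ _)
    ∃⇒≤ {z = y · x} (begin
      x ⊹ y · x      ≈⟨ solve 2 (λ x y → x :+ y :* x := (y :+ con 1) :* x) ≈-refl x y ⟩
      (y ⊹ 1#) · x   ≈⟨ ·-cong e ≈-refl ⟨
      x · x          ∎)

  -- The next square exceeds `s · s` by `2 s + 1`, which is more than `a`. Hence codes of pairs with
  -- different sums lie between different consecutive squares.
  square+<square : ∀ {s t a} → a ≤ s → s < t → s · s ⊹ a < t · t
  square+<square {s} {t} {a} l l' = suc≤⇒< (≤-trans
    (⊹-mono (⊹-mono ≤-refl l) ≤-refl)
    (≤-trans (∃⇒≤ {z = s} (solve 1 (λ s → s :* s :+ s :+ con 1 :+ s := (s :+ con 1) :* (s :+ con 1)) ≈-refl s))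
             (·-mono (<⇒suc≤ l') (<⇒suc≤ l'))))

  pair-sum-≮ : ∀ {a b a' b'} → ⟪ a , b ⟫ ≈ ⟪ a' , b' ⟫ → a ⊹ b < a' ⊹ b' → Bot
  pair-sum-≮ {a} {b} {a'} e l = <-irrefl e (<-≤-trans (square+<square (≤-⊹ʳ a b) l) (≤-⊹ʳ _ a'))

  ⟪⟫-injective : ∀ {a b a' b'} → ⟪ a , b ⟫ ≈ ⟪ a' , b' ⟫ → a ≈ a' × b ≈ b'
  ⟪⟫-injective {a} {b} {a'} {b'} e = ea , ⊹-cancelˡ a (≈-trans es (⊹-cong (≈-sym ea) ≈-refl))
    where
    es : a ⊹ b ≈ a' ⊹ b'
    es = ≤-antisym (≮⇒≥ (pair-sum-≮ (≈-sym e))) (≮⇒≥ (pair-sum-≮ e))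
    ea : a ≈ a'
    ea = ⊹-cancelˡ _ (≈-trans e (⊹-cong (·-cong (≈-sym es) (≈-sym es)) ≈-refl))

  ⟪⟫-cong : ∀ {a b a' b'} → a ≈ a' → b ≈ b' → ⟪ a , b ⟫ ≈ ⟪ a' , b' ⟫
  ⟪⟫-cong e f = ⊹-cong (·-cong (⊹-cong e f) (⊹-cong e f)) e

  ≤-⟪⟫ˡ : ∀ a b → a ≤ ⟪ a , b ⟫
  ≤-⟪⟫ˡ a b = ≤-⊹ˡ _ a

  ≤-⟪⟫ʳ : ∀ a b → b ≤ ⟪ a , b ⟫
  ≤-⟪⟫ʳ a b = ≤-trans (≤-⊹ˡ a b) (≤-trans (≤-square _) (≤-⊹ʳ _ a))

  -- Rational numbers

  code-injective : ∀ {q r} → code q ≈ code r → pos q ≈ pos r × neg q ≈ neg r × den-1 q ≈ den-1 r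
  code-injective e =
    let e₁ , e₂ = ⟪⟫-injective e
        e₃ , e₄ = ⟪⟫-injective e₁
    in e₃ , e₄ , e₂

  -- Wrapping the order in a record lets q and r be inferred from q ⊑ r.
  infix 7 _⊑_ _⊏_ _≈ℚ_
  record _⊑_ (q r : Q) : Set where
    constructor ⊑-intro
    field ⊑-elim : q ≤ℚ r
  open _⊑_ public

  record _⊏_ (q r : Q) : Set where
    constructor ⊏-intro
    field ⊏-elim : q <ℚ r
  open _⊏_ public

  _≈ℚ_ : Q → Q → Set
  q ≈ℚ r = q ⊑ r × r ⊑ q

  instance
    ⊑-Stable : ∀ {q r} → Stable (q ⊑ r)
    ⊑-Stable {q} {r} = mk λ h → ⊑-intro (stable λ k → h (k ∘ ⊑-elim))

    ⊏-Stable : ∀ {q r} → Stable (q ⊏ r)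
    ⊏-Stable = mk λ h → ⊏-intro (stable λ k → h (k ∘ ⊏-elim))

  ⊏-⊒-absurd : ∀ {q r} → q ⊏ r → r ⊑ q → Bot
  ⊏-⊒-absurd (⊏-intro l) (⊑-intro l') = <⇒≱ l l'

  ⋢⇒⊐ : ∀ {q r} → ¬ˢ (q ⊑ r) → r ⊏ q
  ⋢⇒⊐ n = ⊏-intro (≰⇒> (n ∘ ⊑-intro))

  compareℚ : ∀ q r → ¬¬ (q ⊑ r ⊎ r ⊏ q)
  compareℚ q r = do
    inj₂ n ← em (q ⊑ r)
      where inj₁ l → return (inj₁ l)
    return (inj₂ (⋢⇒⊐ n))

  ⊏⇒⊑ : ∀ {q r} → q ⊏ r → q ⊑ r
  ⊏⇒⊑ (⊏-intro l) = ⊑-intro (<⇒≤ l)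

  -- `den (q +ℚ r)` is a product only up to `≈`. Exchanging it for the factored form `D` or `E`
  -- leaves an identity that the semiring solver can treat with denominators as variables.
  ≈ℚ-intro : ∀ {q r D E} → den q ≈ D → den r ≈ E →
             pos q · E ⊹ neg r · D ≈ pos r · D ⊹ neg q · E → q ≈ℚ r
  ≈ℚ-intro {q} {r} d e h =
    ⊑-intro (≤-reflexive (≈-trans (⊹-cong (·-cong ≈-refl e) (·-cong ≈-refl d))
      (≈-trans h (≈-sym (⊹-cong (·-cong ≈-refl d) (·-cong ≈-refl e)))))) ,
    ⊑-intro (≤-reflexive (≈-trans (⊹-cong (·-cong ≈-refl d) (·-cong ≈-refl e))
      (≈-trans (≈-sym h) (≈-sym (⊹-cong (·-cong ≈-refl e) (·-cong ≈-refl d))))))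

  code-≈ : ∀ {q r} → code q ≈ code r → q ≈ℚ r
  code-≈ {q} {r} e = let e₁ , e₂ , e₃ = code-injective {q} {r} e in
    ≈ℚ-intro (⊹-cong e₃ ≈-refl) ≈-refl (⊹-cong (·-cong e₁ ≈-refl) (·-cong (≈-sym e₂) ≈-refl))

  ⊑-refl : ∀ {q} → q ⊑ q
  ⊑-refl = ⊑-intro ≤-refl

  ≈ℚ-refl : ∀ {q} → q ≈ℚ q
  ≈ℚ-refl = ⊑-refl , ⊑-refl

  private
    shuffle : ∀ (p p' D q q' E r r' F : N) →
      (p · E ⊹ q' · D) · F ⊹ (q · F ⊹ r' · E) · D ≈
      (p · F ⊹ r' · D) · E ⊹ (q · F · D ⊹ q' · D · F)
    shuffle p p' D q q' E r r' F = solve 7 (λ p q' D q E r' F →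
      (p :* E :+ q' :* D) :* F :+ (q :* F :+ r' :* E) :* D :=
      (p :* F :+ r' :* D) :* E :+ (q :* F :* D :+ q' :* D :* F)) ≈-refl p q' D q E r' F

    shuffle' : ∀ (p p' D q q' E r r' F : N) →
      (q · D ⊹ p' · E) · F ⊹ (r · E ⊹ q' · F) · D ≈
      (r · D ⊹ p' · F) · E ⊹ (q · F · D ⊹ q' · D · F)
    shuffle' p p' D q q' E r r' F = solve 7 (λ p' D q q' E r F →
      (q :* D :+ p' :* E) :* F :+ (r :* E :+ q' :* F) :* D :=
      (r :* D :+ p' :* F) :* E :+ (q :* F :* D :+ q' :* D :* F)) ≈-refl p' D q q' E r F

  -- Multiplied by the outer denominators and added, the two inequalities become the desired one
  -- times the middle denominator, up to a common summand.
  ⊑-trans : ∀ {p q r} → p ⊑ q → q ⊑ r → p ⊑ r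
  ⊑-trans {frac p p' d} {frac q q' e} {frac r r' f} (⊑-intro l) (⊑-intro l') = ⊑-intro
    (·-cancel-≤ e (⊹-cancel-≤ _ (≤-resp
      (shuffle p p' (d ⊹ 1#) q q' (e ⊹ 1#) r r' (f ⊹ 1#))
      (shuffle' p p' (d ⊹ 1#) q q' (e ⊹ 1#) r r' (f ⊹ 1#))
      (⊹-mono (·-monoˡ (f ⊹ 1#) l) (·-monoˡ (d ⊹ 1#) l')))))

  den-+ : ∀ q r → den (q +ℚ r) ≈ den q · den r
  den-+ (frac _ _ d) (frac _ _ e) =
    solve 2 (λ d e → d :* e :+ d :+ e :+ con 1 := (d :+ con 1) :* (e :+ con 1)) ≈-refl d e

  +ℚ-comm : ∀ q r → q +ℚ r ≈ℚ r +ℚ q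
  +ℚ-comm q r = ≈ℚ-intro (den-+ q r) (den-+ r q)
    (solve 6 (λ a b D c d E →
      (a :* E :+ c :* D) :* (E :* D) :+ (d :* D :+ b :* E) :* (D :* E) :=
      (c :* D :+ a :* E) :* (D :* E) :+ (b :* E :+ d :* D) :* (E :* D)) ≈-refl
      (pos q) (neg q) (den q) (pos r) (neg r) (den r))

  +ℚ-assoc : ∀ p q r → p +ℚ q +ℚ r ≈ℚ p +ℚ (q +ℚ r)
  +ℚ-assoc p q r = ≈ℚ-intro
    (≈-trans (den-+ (p +ℚ q) r) (·-cong (den-+ p q) ≈-refl))
    (≈-trans (den-+ p (q +ℚ r)) (·-cong ≈-refl (den-+ q r)))
    (≈-trans (⊹-cong (·-cong (⊹-cong ≈-refl (·-cong ≈-refl (den-+ p q))) ≈-refl)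
                     (·-cong (⊹-cong (·-cong ≈-refl (den-+ q r)) ≈-refl) ≈-refl))
    (≈-trans (solve 9 (λ a b D c d E f g F →
      ((a :* E :+ c :* D) :* F :+ f :* (D :* E)) :* (D :* (E :* F)) :+
      (b :* (E :* F) :+ (d :* F :+ g :* E) :* D) :* (D :* E :* F) :=
      (a :* (E :* F) :+ (c :* F :+ f :* E) :* D) :* (D :* E :* F) :+
      ((b :* E :+ d :* D) :* F :+ g :* (D :* E)) :* (D :* (E :* F))) ≈-refl
      (pos p) (neg p) (den p) (pos q) (neg q) (den q) (pos r) (neg r) (den r))
      (≈-sym (⊹-cong (·-cong (⊹-cong (·-cong ≈-refl (den-+ q r)) ≈-refl) ≈-refl)
                     (·-cong (⊹-cong ≈-refl (·-cong ≈-refl (den-+ p q))) ≈-refl)))))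

  +ℚ-identityˡ : ∀ q → 0ℚ +ℚ q ≈ℚ q
  +ℚ-identityˡ q = ≈ℚ-intro (≈-trans (den-+ 0ℚ q) (·-cong (0-⊹ 1#) ≈-refl)) ≈-refl
    (solve 3 (λ a b D →
      (con 0 :* D :+ a :* (con 0 :+ con 1)) :* D :+ b :* (con 1 :* D) :=
      a :* (con 1 :* D) :+ (con 0 :* D :+ b :* (con 0 :+ con 1)) :* D) ≈-refl (pos q) (neg q) (den q))

  -ℚ_ : Q → Q
  -ℚ (frac a b c) = frac b a c

  -ℚ-inverse : ∀ q → q +ℚ (-ℚ q) ≈ℚ 0ℚ
  -ℚ-inverse q = ≈ℚ-intro (den-+ q (-ℚ q)) ≈-refl
    (solve 3 (λ a b D →
      (a :* D :+ b :* D) :* (con 0 :+ con 1) :+ con 0 :* (D :* D) :=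
      con 0 :* (D :* D) :+ (b :* D :+ a :* D) :* (con 0 :+ con 1)) ≈-refl (pos q) (neg q) (den q))

  private
    cross : ∀ q r s → pos (q +ℚ s) · den (r +ℚ s) ⊹ neg (r +ℚ s) · den (q +ℚ s) ≈
            (pos q · den r ⊹ neg r · den q) · (den s · den s) ⊹ (pos s ⊹ neg s) · (den s · (den q · den r))
    cross q r s = ≈-trans (⊹-cong (·-cong ≈-refl (den-+ r s)) (·-cong ≈-refl (den-+ q s)))
      (solve 7 (λ a D d E f g F →
        (a :* F :+ f :* D) :* (E :* F) :+ (d :* F :+ g :* E) :* (D :* F) :=
        (a :* E :+ d :* D) :* (F :* F) :+ (f :+ g) :* (F :* (D :* E))) ≈-refl
        (pos q) (den q) (neg r) (den r) (pos s) (neg s) (den s))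

    cross' : ∀ q r s → pos (r +ℚ s) · den (q +ℚ s) ⊹ neg (q +ℚ s) · den (r +ℚ s) ≈
             (pos r · den q ⊹ neg q · den r) · (den s · den s) ⊹ (pos s ⊹ neg s) · (den s · (den q · den r))
    cross' q r s = ≈-trans (cross r q s) (⊹-cong ≈-refl (·-cong ≈-refl (·-cong ≈-refl (·-comm _ _))))

  +ℚ-monoˡ : ∀ {q r} s → q ⊑ r → q +ℚ s ⊑ r +ℚ s
  +ℚ-monoˡ {q} {r} s (⊑-intro l) = ⊑-intro (≤-resp (≈-sym (cross q r s)) (≈-sym (cross' q r s))
    (⊹-mono (·-monoˡ _ l) ≤-refl))

  +ℚ-cancelʳ : ∀ {q r} s → q +ℚ s ⊑ r +ℚ s → q ⊑ r
  +ℚ-cancelʳ {q} {r} s (⊑-intro l) = ⊑-intro (·-cancel-≤ (den-1 s) (·-cancel-≤ (den-1 s)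
    (≤-resp (≈-sym (·-assoc _ _ _)) (≈-sym (·-assoc _ _ _))
      (⊹-cancel-≤ _ (≤-resp (cross q r s) (cross' q r s) l)))))

  infixr 5 _⊞_
  _⊞_ : ∀ {q q' r r'} → q ⊑ q' → r ⊑ r' → q +ℚ r ⊑ q' +ℚ r'
  _⊞_ {q} {q'} {r} {r'} l l' = ⊑-trans (+ℚ-monoˡ r l)
    (⊑-trans (proj₁ (+ℚ-comm q' r)) (⊑-trans (+ℚ-monoˡ q' l') (proj₁ (+ℚ-comm r' q'))))

  +ℚ-commutativeMonoid : CommutativeMonoid _ _
  +ℚ-commutativeMonoid = record
    { Carrier = Q ; _≈_ = _≈ℚ_ ; _∙_ = _+ℚ_ ; ε = 0ℚ
    ; isCommutativeMonoid = record
      { isMonoid = record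
        { isSemigroup = record
          { isMagma = record
            { isEquivalence = record
              { refl = ≈ℚ-refl
              ; sym = λ (l , l') → l' , l
              ; trans = λ (a , b) (c , d) → ⊑-trans a c , ⊑-trans d b }
            ; ∙-cong = λ (a , b) (c , d) → a ⊞ c , b ⊞ d }
          ; assoc = +ℚ-assoc }
        ; identity = +ℚ-identityˡ , λ q →
            let a , b = +ℚ-comm q 0ℚ ; c , d = +ℚ-identityˡ q in ⊑-trans a c , ⊑-trans d b }
      ; comm = +ℚ-comm } }

  open Algebra.Solver.CommutativeMonoid +ℚ-commutativeMonoid public
    using () renaming (solve to solveℚ; _⊕_ to _:⊕_; _⊜_ to _:⊜_; id to :0)

  -- A linear inequality is proved by exhibiting a sum L ⊑ R of known ones.
  linear : ∀ {q r L R} → L ⊑ R → q +ℚ R ≈ℚ r +ℚ L → q ⊑ r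
  linear {q} {r} {L} {R} l (e , _) = +ℚ-cancelʳ R (⊑-trans e (⊑-refl ⊞ l))

  0⊏1/1+ : ∀ c → 0ℚ ⊏ 1/1+ c
  0⊏1/1+ c = ⊏-intro (<-resp
    (solve 1 (λ c → con 0 := con 0 :* (c :+ con 1) :+ con 0 :* (con 0 :+ con 1)) ≈-refl c)
    (solve 1 (λ c → con 0 :+ con 1 := con 1 :* (con 0 :+ con 1) :+ con 0 :* (c :+ con 1)) ≈-refl c)
    (≤⇒<suc ≤-refl))

  -- Comprehension and choice

  gr-resp : ∀ {X i i' v v'} → i ≈ i' → v ≈ v' → gr X i v → gr X i' v'
  gr-resp e f = ∈-resp (⟪⟫-cong e f)

  ⟦⟧ᵗ-resp : ∀ {m} (t : Term m) {σ σ'} → (∀ i → σ i ≈ σ' i) → ⟦ t ⟧ᵗ σ ≈ ⟦ t ⟧ᵗ σ'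
  ⟦⟧ᵗ-resp (var i)   e = e i
  ⟦⟧ᵗ-resp 𝟎         e = ≈-refl
  ⟦⟧ᵗ-resp 𝟏         e = ≈-refl
  ⟦⟧ᵗ-resp (s + t) e = ⊹-cong (⟦⟧ᵗ-resp s e) (⟦⟧ᵗ-resp t e)
  ⟦⟧ᵗ-resp (s * t) e = ·-cong (⟦⟧ᵗ-resp s e) (⟦⟧ᵗ-resp t e)

  private
    ∷-resp : ∀ {m} {σ σ' : Fin m → N} {x y} → x ≈ y → (∀ i → σ i ≈ σ' i) → ∀ i → (x ∷ₑ σ) i ≈ (y ∷ₑ σ') i
    ∷-resp f e zero    = f
    ∷-resp f e (suc i) = e i

  ⟦⟧-resp : ∀ {n m} (φ : Formula n m) {τ σ σ'} → (∀ i → σ i ≈ σ' i) → ⟦ φ ⟧ τ σ → ⟦ φ ⟧ τ σ'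
  ⟦⟧-resp (s ≐ t) e a = ≈-trans (≈-sym (⟦⟧ᵗ-resp s e)) (≈-trans a (⟦⟧ᵗ-resp t e))
  ⟦⟧-resp (s ≺ t) e a = <-resp (⟦⟧ᵗ-resp s e) (⟦⟧ᵗ-resp t e) a
  ⟦⟧-resp (t ∈ X) e a = ∈-resp (⟦⟧ᵗ-resp t e) a
  ⟦⟧-resp ⊥       e a = a
  ⟦⟧-resp (φ ∧ ψ) e (a , b) = ⟦⟧-resp φ e a , ⟦⟧-resp ψ e b
  ⟦⟧-resp (φ ∨ ψ) e a = do
    inj₁ b ← a
      where inj₂ b → return (inj₂ (⟦⟧-resp ψ e b))
    return (inj₁ (⟦⟧-resp φ e b))
  ⟦⟧-resp (φ ⇒ ψ) e a b = ⟦⟧-resp ψ e (a (⟦⟧-resp φ (≈-sym ∘ e) b))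
  ⟦⟧-resp (∀¹ φ)  e a x = ⟦⟧-resp φ (∷-resp ≈-refl e) (a x)
  ⟦⟧-resp (∃¹ φ)  e a = do
    x , b ← a
    return (x , ⟦⟧-resp φ (∷-resp ≈-refl e) b)
  ⟦⟧-resp (∀² φ)  e a X = ⟦⟧-resp φ e (a X)
  ⟦⟧-resp (∃² φ)  e a = do
    X , b ← a
    return (X , ⟦⟧-resp φ e b)

  Δ⁰₁-comprehension : ∀ {n m} {φ ψ : Formula n (suc m)} → Σ⁰₁ φ → Π⁰₁ ψ → ∀ τ σ →
    (∀ x → ⟦ φ ⟧ τ (x ∷ₑ σ) ⟺ ⟦ ψ ⟧ τ (x ∷ₑ σ)) →
    ∃S λ X → ∀ x → (x ∈ˢ X) ⟺ ⟦ φ ⟧ τ (x ∷ₑ σ)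
  Δ⁰₁-comprehension {φ = φ} d e τ σ h = do
    X , k ← axioms (Δ⁰₁-comp d e) τ σ h
    return (X , λ x → (λ a → ⟦⟧-sub φ (λ _ → ≡.refl) (λ _ → ≡.refl) (proj₁ (k x) a)) ,
                      (λ a → proj₂ (k x) (⟦⟧-sub⁻ φ (λ _ → ≡.refl) (λ _ → ≡.refl) a)))

  Δ₀-comprehension : ∀ {n m} (θ : Formula n (suc m)) → Δ₀ θ → ∀ τ σ →
    ∃S λ X → ∀ x → (x ∈ˢ X) ⟺ ⟦ θ ⟧ τ (x ∷ₑ σ)
  Δ₀-comprehension θ d τ σ = do
    X , h ← Δ⁰₁-comprehension (ex (Δ₀-sub id (var ∘ suc) d)) (all (Δ₀-sub id (var ∘ suc) d)) τ σ
      λ x → (λ a w → pad (drop a)) , λ a → return (0# , a 0#)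
    return (X , λ x → drop ∘ proj₁ (h x) , λ a → proj₂ (h x) (return (0# , pad a)))
    where
    pad : ∀ {w x} → ⟦ θ ⟧ τ (x ∷ₑ σ) → ⟦ wk¹ θ ⟧ τ (w ∷ₑ x ∷ₑ σ)
    pad = ⟦⟧-sub⁻ θ (λ _ → ≡.refl) (λ _ → ≡.refl)
    drop : ∀ {x} → ⟦ ∃¹ (wk¹ θ) ⟧ τ (x ∷ₑ σ) → ⟦ θ ⟧ τ (x ∷ₑ σ)
    drop h = stable {{⟦⟧-stable θ}} λ k → h λ (w , a) → k (⟦⟧-sub θ (λ _ → ≡.refl) (λ _ → ≡.refl) a)

  IsFunction : S → Set
  IsFunction F = SingleValued (gr F) × (∀ u → ∃N λ v → gr F u v)

  -- If `k` refutes every least element, Δ₀-induction on the bound shows that no element lies below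
  -- any bound.
  least : ∀ H u → ∃N (λ p → gr H u p) → ∃N λ p → gr H u p × (∀ p' → p' < p → gr H u p' → Bot)
  least H u h k = h λ (p , a) →
    induction₀ (∀¹ (v0 ≺ v1 ⇒ ⟨ v2 , v0 ⟩ ∈ zero ⇒ ⊥)) (ball v0 (imp mem bot)) (H ∷ₑ ∅) (u ∷ₑ ∅)
      (λ p' l → absurd (≮0 l))
      (λ p none p' l a → do
        inj₂ e ← <suc⇒≤ l
          where inj₁ l → none p' l a
        k (p' , a , λ p'' l' → none p'' (<-resp ≈-refl e l')))
      (p ⊹ 1#) p (≤⇒<suc ≤-refl) a

  -- Being the least value is a Δ₀ condition on the code of a pair, since the code bounds both
  -- components.
  uniformize : ∀ H → (∀ u → ∃N λ p → gr H u p) →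
               ∃S λ F → IsFunction F × (∀ u p → gr F u p → gr H u p)
  uniformize H h = do
    F , k ← Δ₀-comprehension
      (∃¹ (v0 ≺ v1 + 𝟏 ∧ ∃¹ (v0 ≺ v2 + 𝟏 ∧ (v2 ≐ ⟨ v1 , v0 ⟩ ∧ ⟨ v1 , v0 ⟩ ∈ zero ∧
        ∀¹ (v0 ≺ v1 ⇒ (⟨ v2 , v0 ⟩ ∈ zero ⇒ ⊥))))))
      (bex (v0 + 𝟏) (bex (v1 + 𝟏) (and eq (and mem (ball v0 (imp mem bot)))))) (H ∷ₑ ∅) ∅
    let elim : ∀ u p → gr F u p → gr H u p × (∀ p' → p' < p → gr H u p' → Bot)
        elim u p a = do
          u' , _ , b ← proj₁ (k ⟪ u , p ⟫) a
          p' , _ , e , c , n ← b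
          let eu , ep = ⟪⟫-injective e
          gr-resp (≈-sym eu) (≈-sym ep) c , λ q l d → n q (<-resp ≈-refl ep l) (gr-resp eu ≈-refl d)
    return (F ,
      ( (λ u p p' (a , b) →
          let a₁ , a₂ = elim u p a ; b₁ , b₂ = elim u p' b
          in ≤-antisym (≮⇒≥ (λ l → a₂ p' l b₁)) (≮⇒≥ (λ l → b₂ p l a₁)))
      , (λ u → do
          p , a , n ← least H u (h u)
          return (p , proj₂ (k ⟪ u , p ⟫) (return (u , ≤⇒<suc (≤-⟪⟫ˡ u p) ,
            return (p , ≤⇒<suc (≤-⟪⟫ʳ u p) , ≈-refl , a , n)))))
      ) , λ u p a → proj₁ (elim u p a))

  -- That `F` has a value at u with first component v is Σ⁰₁. As `F` is a function, it is equivalent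
  -- to the Π⁰₁ condition that every value at u has this component, and Δ⁰₁-comprehension applies.
  projection : ∀ F → IsFunction F → (∀ u p → gr F u p → ¬¬ (Σ N λ v → Σ N λ w → p ≈ ⟪ v , w ⟫)) →
    ∃S λ G → IsFunction G × (∀ u v → gr G u v → ∃N λ w → gr F u ⟪ v , w ⟫)
  projection F (F-sv , F-total) shape = do
    G , k ← Δ⁰₁-comprehension
      {φ = ∃¹ (∃¹ (v0 ≺ v2 + 𝟏 ∧ ∃¹ (v0 ≺ v3 + 𝟏 ∧
        (v3 ≐ ⟨ v1 , v0 ⟩ ∧ ⟨ v1 , ⟨ v0 , v2 ⟩ ⟩ ∈ zero))))}
      {ψ = ∀¹ (∃¹ (v0 ≺ v2 + 𝟏 ∧ ∃¹ (v0 ≺ v3 + 𝟏 ∧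
        (v3 ≐ ⟨ v1 , v0 ⟩ ∧ (⟨ v1 , v2 ⟩ ∈ zero ⇒
          ∃¹ (v0 ≺ v3 + 𝟏 ∧ v3 ≐ ⟨ v1 , v0 ⟩))))))}
      (ex (bex (v1 + 𝟏) (bex (v2 + 𝟏) (and eq mem))))
      (all (bex (v1 + 𝟏) (bex (v2 + 𝟏) (and eq (imp mem (bex (v2 + 𝟏) eq))))))
      (F ∷ₑ ∅) ∅ λ z →
        (λ a p → do
          w , b ← a
          u , lu , b ← b
          v , lv , e , c ← b
          return (u , lu , return (v , lv , e , λ d →
            let f = F-sv _ _ _ (d , c) in return (w , <-resp ≈-refl (suc-cong (≈-sym f)) (≤⇒<suc (≤-⟪⟫ʳ v w)) , f)))) ,
        λ a → do
          u , _ , b ← a 0#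
          v , _ , e , _ ← b
          p , d ← F-total u
          u' , lu , b ← a p
          v' , lv , e' , c ← b
          w , _ , f ← c (gr-resp (proj₁ (⟪⟫-injective (≈-trans (≈-sym e) e'))) ≈-refl d)
          return (w , return (u' , lu , return (v' , lv , e' ,
            gr-resp (proj₁ (⟪⟫-injective (≈-trans (≈-sym e) e'))) f d)))
    let elim : ∀ u v → gr G u v → ∃N λ w → gr F u ⟪ v , w ⟫
        elim u v a = do
          w , b ← proj₁ (k ⟪ u , v ⟫) a
          u' , _ , b ← b
          v' , _ , e , c ← b
          let eu , ev = ⟪⟫-injective e
          return (w , gr-resp (≈-sym eu) (⟪⟫-cong (≈-sym ev) ≈-refl) c)
    let proj : ∀ {u p v w} → p ≈ ⟪ v , w ⟫ → gr F u p → gr G u v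
        proj {u} {p} {v} {w} e a = proj₂ (k ⟪ u , v ⟫) (return (w , return (u , ≤⇒<suc (≤-⟪⟫ˡ u v) ,
          return (v , ≤⇒<suc (≤-⟪⟫ʳ u v) , ≈-refl , gr-resp ≈-refl e a))))
    return (G , ((λ u v v' (a , b) → do
      w , a' ← elim u v a
      w' , b' ← elim u v' b
      proj₁ (⟪⟫-injective (F-sv _ _ _ (a' , b')))) ,
      λ u → do
        p , a ← F-total u
        v , w , e ← shape u p a
        return (v , proj e a)) , elim)

  private
    -- Makes room for the comprehension variable, which lies between the three unpacked variables
    -- and the parameters.
    skip : ∀ {m} → Fin (suc (suc (suc m))) → Term (suc (suc (suc (suc m))))
    skip zero                = v0
    skip (suc zero)          = v1
    skip (suc (suc zero))    = v2
    skip (suc (suc (suc i))) = var (suc (suc (suc (suc i))))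

  -- The second witness w turns a Σ⁰₁ condition on u and v into a Δ₀ one. The least code of a pair
  -- of witnesses is chosen for each u, and only its first component is kept.
  choice : ∀ {n m} (θ : Formula n (suc (suc (suc m)))) → Δ₀ θ → ∀ τ σ →
    (∀ u → ∃N λ v → ∃N λ w → ⟦ θ ⟧ τ (w ∷ₑ v ∷ₑ u ∷ₑ σ)) →
    ∃S λ G → IsFunction G × (∀ u v → gr G u v → ∃N λ w → ⟦ θ ⟧ τ (w ∷ₑ v ∷ₑ u ∷ₑ σ))
  choice θ d τ σ h = do
    H , k ← Δ₀-comprehension
      (∃¹ (v0 ≺ v1 + 𝟏 ∧ ∃¹ (v0 ≺ v2 + 𝟏 ∧ ∃¹ (v0 ≺ v3 + 𝟏 ∧
        (v3 ≐ ⟨ v2 , ⟨ v1 , v0 ⟩ ⟩ ∧ sub id skip θ)))))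
      (bex (v0 + 𝟏) (bex (v1 + 𝟏) (bex (v2 + 𝟏) (and eq (Δ₀-sub id skip d))))) τ σ
    F , F-fun , F⊆H ← uniformize H λ u → do
      v , b ← h u
      w , a ← b
      return (⟪ v , w ⟫ , proj₂ (k ⟪ u , ⟪ v , w ⟫ ⟫)
        (return (u , ≤⇒<suc (≤-⟪⟫ˡ u _) ,
         return (v , ≤⇒<suc (≤-trans (≤-⟪⟫ˡ v w) (≤-⟪⟫ʳ u _)) ,
         return (w , ≤⇒<suc (≤-trans (≤-⟪⟫ʳ v w) (≤-⟪⟫ʳ u _)) , ≈-refl ,
           ⟦⟧-sub⁻ θ (λ _ → ≡.refl) skipped a)))))
    G , G-fun , G-F ← projection F F-fun λ u p a → do
      _ , _ , c ← proj₁ (k ⟪ u , p ⟫) (F⊆H u p a)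
      v , _ , c ← c
      w , _ , e , _ ← c
      return (v , w , proj₂ (⟪⟫-injective e))
    return (G , G-fun , λ u v a → do
      w , b ← G-F u v a
      u' , _ , c ← proj₁ (k ⟪ u , ⟪ v , w ⟫ ⟫) (F⊆H _ _ b)
      v' , _ , c ← c
      w' , _ , e , c ← c
      let eu , e' = ⟪⟫-injective e
          ev , ew = ⟪⟫-injective e'
      return (w , ⟦⟧-resp θ (λ where
        zero                → ≈-sym ew
        (suc zero)          → ≈-sym ev
        (suc (suc zero))    → ≈-sym eu
        (suc (suc (suc _))) → ≈-refl) (⟦⟧-sub θ (λ _ → ≡.refl) skipped c)))
    where
    skipped : ∀ {w v u z} i → ⟦ skip i ⟧ᵗ (w ∷ₑ v ∷ₑ u ∷ₑ z ∷ₑ σ) ≡ (w ∷ₑ v ∷ₑ u ∷ₑ σ) i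
    skipped zero                = ≡.refl
    skipped (suc zero)          = ≡.refl
    skipped (suc (suc zero))    = ≡.refl
    skipped (suc (suc (suc _))) = ≡.refl

  -- Hypotheses about points quantify over sets, so constants and rows have to be
  -- replaced by sets with the same graph.
  Represents : S → Graph → Set
  Represents A x = ∀ i v → gr A i v ⟺ x i v

  represent-const : ∀ a → ∃S λ A → Represents A (const a)
  represent-const a = do
    A , (_ , t) , h ← choice (v1 ≐ v3) eq ∅ (a ∷ₑ ∅) (λ u → return (a , return (0# , ≈-refl)))
    let f : ∀ i v → gr A i v → v ≈ a
        f i v p = h i v p >>= proj₂
    return (A , λ i v → f i v , λ e → do
      w , p ← t i
      gr-resp ≈-refl (≈-trans (f i w p) (≈-sym e)) p)

  represent-row : ∀ C j → SingleValued (row C j) → (∀ i → ¬¬ (Σ N λ v → row C j i v)) → ∃S λ A → Represents A (row C j)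
  represent-row C j sv t = do
    A , (_ , t') , h ← choice (⟨ ⟨ v3 , v2 ⟩ , v1 ⟩ ∈ zero) mem (C ∷ₑ ∅) (j ∷ₑ ∅) λ u → do
      v , p ← t u
      return (v , return (0# , p))
    let f : ∀ i v → gr A i v → row C j i v
        f i v p = h i v p >>= proj₂
    return (A , λ i v → f i v , λ q → do
      w , p ← t' i
      gr-resp ≈-refl (sv _ _ _ (f i w p , q)) p)

-- Real numbers

module Reals (𝓜 : Model RCA₀) (E : Model.S 𝓜) (E-pow : Semantics.IsPow2 𝓜 E) where

  open Semantics 𝓜 public

  open ≈-Reasoning

  -- 1/1+ c is 2⁻ᵏ.
  Pow : N → N → Set
  Pow k c = gr E k (c ⊹ 1#)

  E-sv = proj₁ E-pow
  E-zero = proj₁ (proj₂ (proj₂ E-pow))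
  E-step = proj₂ (proj₂ (proj₂ E-pow))

  Pow-unique : ∀ {k c c'} → Pow k c → Pow k c' → c ≈ c'
  Pow-unique p p' = suc-injective (E-sv _ _ _ (p , p'))

  Pow-zero : Pow 0# 0#
  Pow-zero = gr-resp ≈-refl (≈-sym (0-⊹ 1#)) E-zero

  Pow-suc : ∀ {k c} → Pow k c → Pow (k ⊹ 1#) (c ⊹ c ⊹ 1#)
  Pow-suc {k} {c} p = gr-resp ≈-refl
    (solve 1 (λ c → (c :+ con 1) :+ (c :+ con 1) := (c :+ c :+ con 1) :+ con 1) ≈-refl c) (E-step _ _ p)

  pow-large : ∀ k → ∃N λ c → Pow k c × k ≤ c
  pow-large = induction {φ = ∃¹ (⟨ v1 , v0 + 𝟏 ⟩ ∈ zero ∧ v1 ≼ v0)} (ex (and mem (or lt eq))) (E ∷ₑ ∅) ∅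
    (return (0# , Pow-zero , ≤-refl))
    λ k h → do
      c , p , l ← h
      return (c ⊹ c ⊹ 1# , Pow-suc p , ⊹-mono (≤-trans l (≤-⊹ʳ c c)) ≤-refl)

  pow : ∀ k → ∃N λ c → Pow k c
  pow k = do
    c , p , _ ← pow-large k
    return (c , p)

  Pow⇒Pow2 : ∀ {k c} → Pow k c → Pow2 k (c ⊹ 1#)
  Pow⇒Pow2 p = return (E , E-sv , proj₁ (proj₂ E-pow) , E-zero , E-step , p)

  -- By Σ⁰₁-induction, `E` and any other such function `F` share a value at each argument, and `F`
  -- is single-valued.
  Pow2⇒Pow : ∀ {k c} → Pow2 k (c ⊹ 1#) → Pow k c
  Pow2⇒Pow {k} {c} h = do
    F , F-sv , _ , F-zero , F-step , p ← h
    v , q , r ← induction {φ = ∃¹ (⟨ v1 , v0 ⟩ ∈ zero ∧ ⟨ v1 , v0 ⟩ ∈ suc zero)} (ex (and mem mem))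
      (E ∷ₑ F ∷ₑ ∅) ∅ (return (1# , E-zero , F-zero))
      (λ k h → do
        v , q , r ← h
        return (v ⊹ v , E-step _ _ q , F-step _ _ r)) k
    gr-resp ≈-refl (F-sv _ _ _ (r , p)) q

  pow-mono : ∀ {i j c d} → i ≤ j → Pow i c → Pow j d → c ≤ d
  pow-mono {i} {j} {c} {d} l p q = do
    z , e ← ≤⇒∃ l
    c' , r , l' ← induction {φ = ∃¹ (⟨ v2 + v1 , v0 + 𝟏 ⟩ ∈ zero ∧ v3 ≼ v0)} (ex (and mem (or lt eq)))
      (E ∷ₑ ∅) (i ∷ₑ c ∷ₑ ∅) (return (c , gr-resp (≈-sym (⊹-0 i)) ≈-refl p , ≤-refl))
      (λ k h → do
        c' , r , l' ← h
        return (c' ⊹ c' ⊹ 1# , gr-resp (⊹-assoc i k 1#) ≈-refl (Pow-suc r) ,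
          ≤-trans l' (≤-trans (≤-⊹ʳ c' c') (≤-⊹ʳ _ 1#)))) z
    ≤-trans l' (≤-reflexive (Pow-unique r (gr-resp (≈-sym e) ≈-refl q)))

  1/1+-mono : ∀ {c d} → c ≤ d → 1/1+ d ⊑ 1/1+ c
  1/1+-mono {c} {d} l = ⊑-intro (≤-resp
    (solve 2 (λ c d → c :+ con 1 := con 1 :* (c :+ con 1) :+ con 0 :* (d :+ con 1)) ≈-refl c d)
    (solve 2 (λ c d → d :+ con 1 := con 1 :* (d :+ con 1) :+ con 0 :* (c :+ con 1)) ≈-refl c d)
    (⊹-mono l ≤-refl))

  antitone : ∀ {i j c d} → i ≤ j → Pow i c → Pow j d → 1/1+ d ⊑ 1/1+ c
  antitone l p q = 1/1+-mono (pow-mono l p q)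

  half : ∀ {k c d} → Pow k c → Pow (k ⊹ 1#) d → 1/1+ d +ℚ 1/1+ d ≈ℚ 1/1+ c
  half {k} {c} {d} p q = ≈ℚ-intro (den-+ (1/1+ d) (1/1+ d)) ≈-refl (begin
    (1# · (d ⊹ 1#) ⊹ 1# · (d ⊹ 1#)) · (c ⊹ 1#) ⊹ 0# · ((d ⊹ 1#) · (d ⊹ 1#))
      ≈⟨ solve 2 (λ C D → (con 1 :* D :+ con 1 :* D) :* C :+ con 0 :* (D :* D) := D :* (C :+ C)) ≈-refl (c ⊹ 1#) (d ⊹ 1#) ⟩
    (d ⊹ 1#) · (c ⊹ 1# ⊹ (c ⊹ 1#))
      ≈⟨ ·-cong ≈-refl (E-sv _ _ _ (E-step _ _ p , q)) ⟩
    (d ⊹ 1#) · (d ⊹ 1#)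
      ≈⟨ solve 2 (λ C D → D :* D := con 1 :* (D :* D) :+ (con 0 :* D :+ con 0 :* D) :* C) ≈-refl (c ⊹ 1#) (d ⊹ 1#) ⟩
    1# · ((d ⊹ 1#) · (d ⊹ 1#)) ⊹ (0# · (d ⊹ 1#) ⊹ 0# · (d ⊹ 1#)) · (c ⊹ 1#) ∎)

  -- The cross-multiplied numerators are natural numbers, so r exceeds q by at least
  -- 1/(`den q · den r`), which is greater than 1/(c + 1).
  ⊏-gap : ∀ {q r c} → q ⊏ r → den q · den r ≤ c → q +ℚ 1/1+ c ⊏ r
  ⊏-gap {q} {r} {c} (⊏-intro l) l' = ⊏-intro (<-resp
    (≈-trans (solve 6 (λ a b D e F C → C :* (a :* F :+ e :* D) :+ D :* F := (a :* C :+ con 1 :* D) :* F :+ e :* (D :* C)) ≈-refl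
        (pos q) (neg q) (den q) (neg r) (den r) (c ⊹ 1#))
      (⊹-cong ≈-refl (·-cong ≈-refl (≈-sym (den-+ q (1/1+ c))))))
    (≈-trans (solve 6 (λ f b D e F C → C :* (f :* D :+ b :* F) := f :* (D :* C) :+ (b :* C :+ con 0 :* D) :* F) ≈-refl
        (pos r) (neg q) (den q) (neg r) (den r) (c ⊹ 1#))
      (⊹-cong (·-cong ≈-refl (≈-sym (den-+ q (1/1+ c)))) ≈-refl))
    (<-≤-trans (≤⇒<suc (≤-trans (⊹-mono ≤-refl l') (≤-reflexive ≈-refl))) (≤-trans
      (≤-reflexive (solve 2 (λ X c → (c :+ con 1) :* X :+ c :+ con 1 := (c :+ con 1) :* (X :+ con 1)) ≈-refl
        (pos q · den r ⊹ neg r · den q) c))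
      (·-mono ≤-refl (<⇒suc≤ l)))))

  small : ∀ {q r} n → q ⊏ r → ¬¬ (Σ N λ k → Σ N λ c → n ≤ k × Pow k c × q +ℚ 1/1+ c ⊏ r)
  small {q} {r} n l = do
    let k = n ⊹ den q · den r
    c , p , l' ← pow-large k
    return (k , c , ≤-⊹ʳ n _ , p , ⊏-gap l (≤-trans (≤-⊹ˡ n _) l'))

  -- Four errors of size 2⁻ᵏ are allowed because the limit arguments below produce at most that
  -- many; if there are fewer, `0⊑1/1+` makes up the number. At stage k + 2 they amount to 2⁻ᵏ.
  closed : ∀ {q r} n → (∀ k c → n ≤ k → Pow k c → q ⊑ r +ℚ ((1/1+ c +ℚ 1/1+ c) +ℚ (1/1+ c +ℚ 1/1+ c))) → q ⊑ r
  closed {q} {r} n h = do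
    inj₂ l ← compareℚ q r
      where inj₁ l → l
    k , c , l₀ , p , l₁ ← small n l
    c₁ , p₁ ← pow (k ⊹ 1#)
    c₂ , p₂ ← pow (k ⊹ 1# ⊹ 1#)
    absurd (⊏-⊒-absurd l₁ (⊑-trans
      (h (k ⊹ 1# ⊹ 1#) c₂ (≤-trans l₀ (≤-trans (≤-⊹ʳ k 1#) (≤-⊹ʳ _ 1#))) p₂)
      (⊑-refl ⊞ ⊑-trans (proj₁ (half p₁ p₂) ⊞ proj₁ (half p₁ p₂)) (proj₁ (half p p₁)))))

  ∃Q-elim : ∀ {P : Q → Set} → ∃Q P → ¬¬ (Σ Q P)
  ∃Q-elim h = do
    a , h₁ ← h
    b , h₂ ← h₁
    c , p ← h₂
    return (frac a b c , p)

  ∃Q-intro : ∀ {P : Q → Set} q → P q → ∃Q P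
  ∃Q-intro q p = return (pos q , return (neg q , return (den-1 q , p)))

  ∃Q²-elim : ∀ {P : Q → Q → Set} → (∃Q λ q → ∃Q λ r → P q r) → ¬¬ (Σ Q λ q → Σ Q λ r → P q r)
  ∃Q²-elim {P} h = do
    q , h ← ∃Q-elim {λ q → ∃Q (P q)} h
    r , p ← ∃Q-elim {P q} h
    return (q , r , p)

  ∃Q²-intro : ∀ {P : Q → Q → Set} q r → P q r → ∃Q λ q → ∃Q λ r → P q r
  ∃Q²-intro {P} q r p = ∃Q-intro {λ q → ∃Q (P q)} q (∃Q-intro {P q} r p)

  -- Reals through their rational upper bounds

  Total : Approx → Set
  Total A = ∀ k → ¬¬ (Σ Q λ q → A k q)

  record Regular (A : Approx) : Set where
    constructor regular-intro
    field
      total   : Total A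
      regular : ∀ {i j c q r} → i ≤ j → Pow i c → A i q → A j r →
                q ⊑ r +ℚ 1/1+ c × r ⊑ q +ℚ 1/1+ c
  open Regular public

  -- A real is determined by its rational upper bounds.
  record U (A : Approx) (s : Q) : Set where
    constructor U-intro
    field below : ∀ {k c q} → Pow k c → A k q → q ⊑ s +ℚ 1/1+ c
  open U public

  instance
    U-Stable : ∀ {A s} → Stable (U A s)
    U-Stable = mk λ h → U-intro λ p a → stable λ k → h λ u → k (below u p a)

  ⊑-+ʳ : ∀ {q r} → 0ℚ ⊑ r → q ⊑ q +ℚ r
  ⊑-+ʳ {q} {r} l = linear l (solveℚ 2 (λ q r → q :⊕ r :⊜ (q :⊕ r) :⊕ :0) ≈ℚ-refl q r)

  0⊑1/1+ : ∀ c → 0ℚ ⊑ 1/1+ c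
  0⊑1/1+ c = ⊏⇒⊑ (0⊏1/1+ c)

  ⊑-+e : ∀ {q} c → q ⊑ q +ℚ 1/1+ c
  ⊑-+e c = ⊑-+ʳ (0⊑1/1+ c)

  U-mono : ∀ {A s t} → s ⊑ t → U A s → U A t
  U-mono l h = U-intro λ p a → ⊑-trans (below h p a) (l ⊞ ⊑-refl)

  U-lower : ∀ {A s t} → U A s → ¬ˢ U A t → t ⊏ s
  U-lower {A} {s} {t} u n = do
    inj₂ l ← compareℚ s t
      where inj₁ l → absurd (n (U-mono l u))
    l

  U-closed : ∀ {A s} → (∀ {ε} → 0ℚ ⊏ ε → U A (s +ℚ ε)) → U A s
  U-closed {A} {s} h = U-intro λ {_} {c} {q} p a → closed 0# λ k d _ _ →
    linear (below (h (0⊏1/1+ d)) p a ⊞ 0⊑1/1+ d ⊞ 0⊑1/1+ d ⊞ 0⊑1/1+ d)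
      (solveℚ 4 (λ q s e d → q :⊕ (((s :⊕ d) :⊕ e) :⊕ (d :⊕ (d :⊕ d))) :⊜
        ((s :⊕ e) :⊕ ((d :⊕ d) :⊕ (d :⊕ d))) :⊕ (q :⊕ (:0 :⊕ (:0 :⊕ :0)))) ≈ℚ-refl q s (1/1+ c) (1/1+ d))

  U-at : ∀ {A k c q} → Regular A → Pow k c → A k q → U A (q +ℚ 1/1+ c)
  U-at {A} {k} {c} {q} R p a = U-intro λ {j} {d} {r} p' a' → do
    inj₂ l ← compare k j
      where inj₁ l → ⊑-trans (proj₂ (regular R l p a a')) (⊑-+e d)
    linear (proj₁ (regular R (<⇒≤ l) p' a' a) ⊞ 0⊑1/1+ c)
      (solveℚ 4 (λ q r c d → r :⊕ ((q :⊕ d) :⊕ c) :⊜ ((q :⊕ c) :⊕ d) :⊕ (r :⊕ :0)) ≈ℚ-refl q r (1/1+ c) (1/1+ d))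

  U-inhabited : ∀ {A} → Regular A → ¬¬ (Σ Q (U A))
  U-inhabited {A} R = do
    q , a ← total R 0#
    return (q +ℚ 1/1+ 0# , U-at R Pow-zero a)

  -- With `≤ᴿ-intro`, this turns the comparison of reals into inclusion of their upper bounds. The
  -- given term of `A` is compared with a late one, and the errors made there are removed by
  -- `closed`.
  ≤ᴿ-elim : ∀ {A B s} → Regular A → Total B → A ≤ᴿ B → U B s → U A s
  ≤ᴿ-elim {A} {B} {s} R T h u = U-intro λ {k} {c} {q} p a → closed k λ j d l p' → do
    q' , a' ← total R j
    r , b ← T j
    linear (proj₁ (regular R l p a a') ⊞
            ⊑-intro (h j d (pos q') (neg q') (den-1 q') (pos r) (neg r) (den-1 r) (Pow⇒Pow2 p' , a' , b)) ⊞
            below u p' b ⊞ 0⊑1/1+ d)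
      (solveℚ 6 (λ q q' r s c d → q :⊕ ((q' :⊕ c) :⊕ ((r :⊕ (d :⊕ d)) :⊕ ((s :⊕ d) :⊕ d))) :⊜
         ((s :⊕ c) :⊕ ((d :⊕ d) :⊕ (d :⊕ d))) :⊕ (q :⊕ (q' :⊕ (r :⊕ :0)))) ≈ℚ-refl
         q q' r s (1/1+ c) (1/1+ d))

  ≤ᴿ-intro : ∀ {A B} → Regular B → (∀ {s} → U B s → U A s) → A ≤ᴿ B
  ≤ᴿ-intro {A} {B} R h k c qa qb qc ra rb rc (p , a , b) =
    let q = frac qa qb qc ; r = frac ra rb rc ; p' = Pow2⇒Pow p in
    ⊑-elim (linear (below (h (U-at R p' b)) p' a)
      (solveℚ 3 (λ q r c → q :⊕ ((r :⊕ c) :⊕ c) :⊜ (r :⊕ (c :⊕ c)) :⊕ q) ≈ℚ-refl q r (1/1+ c)))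

  -- The contrapositive of `≤ᴿ-intro`: where inclusion of the upper bounds fails, it fails at a
  -- separating rational.
  <ᴿ-elim : ∀ {A B} → Regular A → A <ᴿ B → ¬¬ (Σ Q λ s → U A s × ¬ˢ U B s)
  <ᴿ-elim {A} {B} R h k = h (≤ᴿ-intro R λ {s} u → stable λ n → k (s , u , n))

  <ᴿ-intro : ∀ {A B s} → Total A → Regular B → U A s → ¬ˢ U B s → A <ᴿ B
  <ᴿ-intro {A} {B} {s} T R u n h = n (≤ᴿ-elim R T h u)

  IsReal⇒Regular : ∀ {A} → IsReal A → Regular [ A ]
  IsReal⇒Regular (_ , t , r) = regular-intro (λ k → ∃Q-elim (t k))
    λ {i} {j} {c} {q} {q'} l p a b →
      let x , y = r i j c (pos q) (neg q) (den-1 q) (pos q') (neg q') (den-1 q') (l , Pow⇒Pow2 p , a , b)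
      in ⊑-intro x , ⊑-intro y

  rat-regular : ∀ {p} → Regular [ rat p ]
  rat-regular {p} = regular-intro (λ _ → return (p , ≈-refl)) λ {_} {_} {c} {q} {r} _ _ a b →
    ⊑-trans (proj₁ (code-≈ {q} {r} (≈-trans a (≈-sym b)))) (⊑-+e c) ,
    ⊑-trans (proj₁ (code-≈ {r} {q} (≈-trans b (≈-sym a)))) (⊑-+e c)

  U-rat-intro : ∀ {p s} → p ⊑ s → U [ rat p ] s
  U-rat-intro {p} l = U-intro λ {_} {c} {q} _ a → ⊑-trans (proj₁ (code-≈ {q} {p} a)) (⊑-trans l (⊑-+e c))

  U-rat-elim : ∀ {p s} → U [ rat p ] s → p ⊑ s
  U-rat-elim {p} {s} u = closed 0# λ k d _ pw →
    linear (below u pw (≈-refl {code p}) ⊞ 0⊑1/1+ d ⊞ 0⊑1/1+ d ⊞ 0⊑1/1+ d)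
      (solveℚ 3 (λ p s d → p :⊕ ((s :⊕ d) :⊕ (d :⊕ (d :⊕ d))) :⊜
        (s :⊕ ((d :⊕ d) :⊕ (d :⊕ d))) :⊕ (p :⊕ (:0 :⊕ (:0 :⊕ :0)))) ≈ℚ-refl p s (1/1+ d))

  ⊕-elim : ∀ {A : Graph} {ε : Q} {k s} → (A ⊕ rat ε) k s → ¬¬ (Σ Q λ q → A (k ⊹ 1#) (code q) × s ≈ℚ q +ℚ ε)
  ⊕-elim {A} {ε} {k} {s} h = do
    q , r , a , e , f ← ∃Q²-elim {Sum A (rat ε) k s} h
    let e₁ , e₂ = code-≈ {r} {ε} e ; f₁ , f₂ = code-≈ {s} {q +ℚ r} f
    return (q , a , ⊑-trans f₁ (⊑-refl ⊞ e₁) , ⊑-trans (⊑-refl ⊞ e₂) f₂)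

  ⊕-intro : ∀ {A : Graph} {ε : Q} {k} q → A (k ⊹ 1#) (code q) → (A ⊕ rat ε) k (q +ℚ ε)
  ⊕-intro {A} {ε} {k} q a = ∃Q²-intro {Sum A (rat ε) k (q +ℚ ε)} q ε (a , ≈-refl , ≈-refl)

  ⊕-total : ∀ {A : Graph} {ε : Q} → Total [ A ] → Total (A ⊕ rat ε)
  ⊕-total {A} {ε} T k = do
    q , a ← T (k ⊹ 1#)
    return (q +ℚ ε , ⊕-intro {A} q a)

  ⊕-regular : ∀ {A : Graph} {ε : Q} → Regular [ A ] → Regular (A ⊕ rat ε)
  ⊕-regular {A} {ε} R = regular-intro (⊕-total {A} (total R)) λ {i} {j} {c} {s} {t} l p a b → do
    q , a' , e₁ , e₂ ← ⊕-elim {A} {ε} {i} {s} a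
    r , b' , f₁ , f₂ ← ⊕-elim {A} {ε} {j} {t} b
    d , p' ← pow (i ⊹ 1#)
    let x , y = regular R (⊹-mono l ≤-refl) p' a' b'
        m = antitone (≤-⊹ʳ i 1#) p p'
    linear (e₁ ⊞ x ⊞ m ⊞ f₂) (solveℚ 7 (λ s q ε r d c t →
        s :⊕ ((q :⊕ ε) :⊕ ((r :⊕ d) :⊕ (c :⊕ t))) :⊜ (t :⊕ c) :⊕ (s :⊕ (q :⊕ (d :⊕ (r :⊕ ε))))) ≈ℚ-refl
        s q ε r (1/1+ d) (1/1+ c) t) ,
      linear (f₁ ⊞ y ⊞ m ⊞ e₂) (solveℚ 7 (λ s q ε r d c t →
        t :⊕ ((r :⊕ ε) :⊕ ((q :⊕ d) :⊕ (c :⊕ s))) :⊜ (s :⊕ c) :⊕ (t :⊕ (r :⊕ (d :⊕ (q :⊕ ε))))) ≈ℚ-refl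
        s q ε r (1/1+ d) (1/1+ c) t)

  U-⊕-intro : ∀ {A : Graph} {ε s : Q} → U [ A ] s → U (A ⊕ rat ε) (s +ℚ ε)
  U-⊕-intro {A} {ε} {s} u = U-intro λ {k} {c} {t} p a → do
    q , a' , e , _ ← ⊕-elim {A} {ε} {k} {t} a
    d , p' ← pow (k ⊹ 1#)
    linear (e ⊞ below u p' a' ⊞ antitone (≤-⊹ʳ k 1#) p p') (solveℚ 6 (λ t q ε s d c →
      t :⊕ ((q :⊕ ε) :⊕ ((s :⊕ d) :⊕ c)) :⊜ ((s :⊕ ε) :⊕ c) :⊕ (t :⊕ (q :⊕ d))) ≈ℚ-refl
      t q ε s (1/1+ d) (1/1+ c))

  U-⊕-elim : ∀ {A : Graph} {ε s t : Q} → Regular [ A ] → U (A ⊕ rat ε) s → s ⊑ t +ℚ ε → U [ A ] t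
  U-⊕-elim {A} {ε} {s} {t} R u l = U-intro λ {j} {c} {q} p a → closed j λ k d l' p' → do
    r , b ← total R (k ⊹ 1#)
    linear (proj₁ (regular R (≤-trans l' (≤-⊹ʳ k 1#)) p a b) ⊞ below u p' (⊕-intro {A} r b) ⊞ l ⊞
            0⊑1/1+ d ⊞ 0⊑1/1+ d ⊞ 0⊑1/1+ d)
      (solveℚ 7 (λ q r ε s t c d →
        q :⊕ ((r :⊕ c) :⊕ ((s :⊕ d) :⊕ ((t :⊕ ε) :⊕ (d :⊕ (d :⊕ d))))) :⊜
        ((t :⊕ c) :⊕ ((d :⊕ d) :⊕ (d :⊕ d))) :⊕ (q :⊕ ((r :⊕ ε) :⊕ (s :⊕ (:0 :⊕ (:0 :⊕ :0)))))) ≈ℚ-refl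
        q r ε s t (1/1+ c) (1/1+ d))

  ⊔-elim : ∀ {A B : Graph} {k s} → (A ⊔ B) k s →
           ¬¬ (Σ Q λ q → Σ Q λ r → A k (code q) × B k (code r) ×
             (q ⊑ r × s ≈ℚ r ⊎ r ⊑ q × s ≈ℚ q))
  ⊔-elim {A} {B} {k} {s} h = do
    q , r , a , b , d ← ∃Q²-elim {Max A B k s} h
    inj₁ (l , e) ← d
      where inj₂ (l , e) → return (q , r , a , b , inj₂ (⊏⇒⊑ (⊏-intro l) , code-≈ {s} {q} e))
    return (q , r , a , b , inj₁ (⊑-intro l , code-≈ {s} {r} e))

  ⊔-total : ∀ {A B : Graph} → Total [ A ] → Total [ B ] → Total (A ⊔ B)
  ⊔-total {A} {B} T T' k = do
    q , a ← T k
    r , b ← T' k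
    inj₁ (⊑-intro l) ← compareℚ q r
      where inj₂ (⊏-intro l) → return (q , ∃Q²-intro {Max A B k q} q r (a , b , return (inj₂ (l , ≈-refl))))
    return (r , ∃Q²-intro {Max A B k r} q r (a , b , return (inj₁ (l , ≈-refl))))

  U-⊔ : ∀ {A B : Graph} {s : Q} → U [ A ] s → U [ B ] s → U (A ⊔ B) s
  U-⊔ {A} {B} u v = U-intro λ {k} {c} {t} p a → do
    q , r , a' , b' , d ← ⊔-elim {A} {B} {k} {t} a
    inj₁ (_ , e) ← return d
      where inj₂ (_ , e) → ⊑-trans (proj₁ e) (below u p a')
    ⊑-trans (proj₁ e) (below v p b')

  ⊔-≤ᴿ : ∀ {A B C : Graph} → [ A ] ≤ᴿ [ C ] → [ B ] ≤ᴿ [ C ] → A ⊔ B ≤ᴿ [ C ]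
  ⊔-≤ᴿ {A} {B} {C} h h' k c ta tb tc ra rb rc (p , a , b) =
    let t = frac ta tb tc in ⊑-elim do
    q , r , a' , b' , d ← ⊔-elim {A} {B} {k} {t} a
    inj₁ (_ , e) ← return d
      where inj₂ (_ , e) → ⊑-trans (proj₁ e) (⊑-intro (h k c (pos q) (neg q) (den-1 q) ra rb rc (p , a' , b)))
    ⊑-trans (proj₁ e) (⊑-intro (h' k c (pos r) (neg r) (den-1 r) ra rb rc (p , b' , b)))

-- Points of an ultrametric space

module Metric (𝓜 : Model RCA₀) (E : Model.S 𝓜) (E-pow : Semantics.IsPow2 𝓜 E) (X D : Model.S 𝓜)
  (space : Semantics.Spaces.IsSpace 𝓜 X D) (ultra : Semantics.Spaces.IsUltrametric 𝓜 X D) where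

  open Reals 𝓜 E E-pow public
  open Spaces X D public

  split : ∀ {ε} n → 0ℚ ⊏ ε → ¬¬ (Σ N λ k → Σ N λ c → n ≤ k × Pow k c ×
            (1/1+ c +ℚ 1/1+ c) +ℚ (1/1+ c +ℚ 1/1+ c) ⊏ ε)
  split {ε} n l = do
    k , c , n≤k , p , l' ← small n l
    c₁ , p₁ ← pow (k ⊹ 1#)
    c₂ , p₂ ← pow (k ⊹ 1# ⊹ 1#)
    return (k ⊹ 1# ⊹ 1# , c₂ , ≤-trans n≤k (≤-trans (≤-⊹ʳ k 1#) (≤-⊹ʳ _ 1#)) , p₂ ,
      ⋢⇒⊐ λ m → ⊏-⊒-absurd l' (linear
        (m ⊞ (proj₁ (half p₁ p₂) ⊞ proj₁ (half p₁ p₂)) ⊞ proj₁ (half p p₁))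
        (solveℚ 4 (λ ε c c₁ c₂ → ε :⊕ (((c₂ :⊕ c₂) :⊕ (c₂ :⊕ c₂)) :⊕ ((c₁ :⊕ c₁) :⊕ c)) :⊜
          (:0 :⊕ c) :⊕ (ε :⊕ (((c₂ :⊕ c₂) :⊕ (c₂ :⊕ c₂)) :⊕ (c₁ :⊕ c₁)))) ≈ℚ-refl
          ε (1/1+ c) (1/1+ c₁) (1/1+ c₂))))

  -- Distances between elements of X

  dist-regular : ∀ {a b} → a ∈ˢ X → b ∈ˢ X → Regular [ dist a b ]
  dist-regular a∈ b∈ = IsReal⇒Regular (proj₁ (proj₁ (proj₂ space) _ _ (a∈ , b∈)))

  d-refl : ∀ {a s} → a ∈ˢ X → 0ℚ ⊑ s → U [ dist a a ] s
  d-refl a∈ l = ≤ᴿ-elim (dist-regular a∈ a∈) (total (rat-regular {0ℚ}))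
    (proj₁ (proj₁ (proj₂ (proj₁ (proj₂ space) _ _ (a∈ , a∈))))) (U-rat-intro l)

  d-sym : ∀ {a b s} → a ∈ˢ X → b ∈ˢ X → U [ dist a b ] s → U [ dist b a ] s
  d-sym a∈ b∈ = ≤ᴿ-elim (dist-regular b∈ a∈) (total (dist-regular a∈ b∈))
    (proj₁ (proj₁ (proj₂ (proj₂ (proj₁ (proj₂ space) _ _ (b∈ , a∈))))))

  d-nonneg : ∀ {a b s} → a ∈ˢ X → b ∈ˢ X → U [ dist a b ] s → 0ℚ ⊑ s
  d-nonneg a∈ b∈ u = U-rat-elim (≤ᴿ-elim (rat-regular {0ℚ}) (total (dist-regular a∈ b∈))
    (proj₂ (proj₂ (proj₂ (proj₁ (proj₂ space) _ _ (a∈ , b∈))))) u)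

  dist-resp : ∀ {a a' b b' k v} → a ≈ a' → b ≈ b' → dist a b k v → dist a' b' k v
  dist-resp e f = ∈-resp (⟪⟫-cong (⟪⟫-cong (⟪⟫-cong e f) ≈-refl) ≈-refl)

  d-resp : ∀ {a a' b b' s} → a ≈ a' → b ≈ b' → U [ dist a b ] s → U [ dist a' b' ] s
  d-resp e f u = U-intro λ p a → below u p (dist-resp (≈-sym e) (≈-sym f) a)

  -- Points and their distances

  record Point (x : Graph) : Set where
    constructor point-intro
    field
      values : ∀ i → ¬¬ (Σ N λ a → x i a)
      inside : ∀ {i a} → x i a → a ∈ˢ X
      cauchy : ∀ {i j c a b} → i ≤ j → Pow i c → x i a → x j b → U [ dist a b ] (1/1+ c)
  open Point public

  IsPoint⇒Point : ∀ {x} → (∀ {i v v'} → v ≈ v' → x i v → x i v') → IsPoint x → Point x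
  IsPoint⇒Point {x} resp (sv , t , c) = record
    { values = λ i → do
        a , _ , p ← t i
        return (a , p)
    ; inside = inside'
    ; cauchy = λ {i} {j} {k} l p xa xb → ≤ᴿ-elim (dist-regular (inside' xa) (inside' xb)) (total (rat-regular {1/1+ k}))
        (c _ _ _ _ _ (l , Pow⇒Pow2 p , xa , xb)) (U-rat-intro ⊑-refl) }
    where
    inside' : ∀ {i a} → x i a → a ∈ˢ X
    inside' {i} p = do
      a , a∈ , q ← t i
      ∈-resp (sv _ _ _ (q , p)) a∈

  point : ∀ {x : S} → IsPoint (gr x) → Point (gr x)
  point = IsPoint⇒Point (gr-resp ≈-refl)

  Point⇒IsPoint : ∀ {x} → SingleValued x → Point x → IsPoint x
  Point⇒IsPoint sv P = sv , (λ i → do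
      a , p ← values P i
      return (a , inside P p , p)) ,
    λ i j c a b (l , p , xa , xb) → ≤ᴿ-intro (rat-regular {1/1+ c}) λ u →
      U-mono (U-rat-elim u) (cauchy P l (Pow2⇒Pow p) xa xb)

  const-point : ∀ {x : Graph} {a} → a ∈ˢ X → (∀ i → ¬¬ (Σ N λ a → x i a)) → (∀ {i v} → x i v → v ≈ a) → Point x
  const-point a∈ t h = point-intro t (λ p → ∈-resp (≈-sym (h p)) a∈)
    λ {_} {_} {c} _ _ p q → d-resp (≈-sym (h p)) (≈-sym (h q)) (d-refl a∈ (0⊑1/1+ c))

  constant : ∀ {a} → a ∈ˢ X → Point (const a)
  constant {a} a∈ = const-point a∈ (λ _ → return (a , ≈-refl)) id

  -- d(x , y) ≤ s, also when the distance is not given by a set.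
  record Near (x y : Graph) (s : Q) : Set where
    constructor near-intro
    field eventually : ∀ {ε} → 0ℚ ⊏ ε → ∃N λ n → ∀ i a b → n ≤ i → x i a → y i b → U [ dist a b ] (s +ℚ ε)
  open Near public

  Near-mono : ∀ {x y s t} → s ⊑ t → Near x y s → Near x y t
  Near-mono l h = near-intro λ pos → do
    n , k ← eventually h pos
    return (n , λ i a b n≤i p q → U-mono (l ⊞ ⊑-refl) (k i a b n≤i p q))

  Dist-elim₁ : ∀ {x y R s} → Point x → Point y → Dist x y R → U [ R ] s → Near x y s
  Dist-elim₁ {x} {y} {R} {s} P P' (real , conv) u = near-intro λ {ε} ε>0 → do
    n , k ← conv (pos ε) (neg ε) (den-1 ε) (⊏-elim ε>0)
    return (n , λ i a b l p q → do
      t , u' , v ← <ᴿ-elim {[ dist a b ]} {R ⊕ rat ε} (dist-regular (inside P p) (inside P' q)) (proj₁ (k i a b (l , p , q)))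
      U-mono (⊏⇒⊑ (U-lower (U-⊕-intro {R} {ε} u) v)) u')

  Dist-elim₂ : ∀ {x y R s} → Point x → Point y → Dist x y R → Near x y s → U [ R ] s
  Dist-elim₂ {x} {y} {R} {s} P P' (real , conv) h = U-closed λ {δ} δ>0 → do
    k , c , _ , pw , l ← split 0# δ>0
    let ε = 1/1+ c
    n , f ← conv (pos ε) (neg ε) (den-1 ε) (⊏-elim (0⊏1/1+ c))
    m , g ← eventually h (0⊏1/1+ c)
    a , p ← values P (n ⊹ m)
    b , q ← values P' (n ⊹ m)
    t , u' , v ← <ᴿ-elim {[ R ]} {dist a b ⊕ rat ε} (IsReal⇒Regular real) (proj₂ (f _ a b (≤-⊹ʳ n m , p , q)))
    U-mono (linear (⊏⇒⊑ (U-lower (U-⊕-intro {dist a b} {ε} (g _ a b (≤-⊹ˡ n m) p q)) v) ⊞ ⊏⇒⊑ l ⊞ 0⊑1/1+ c ⊞ 0⊑1/1+ c)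
      (solveℚ 4 (λ t s δ c → t :⊕ (((s :⊕ c) :⊕ c) :⊕ (δ :⊕ (c :⊕ c))) :⊜
        (s :⊕ δ) :⊕ (t :⊕ (((c :⊕ c) :⊕ (c :⊕ c)) :⊕ (:0 :⊕ :0)))) ≈ℚ-refl t s δ ε)) u'

  -- The last hypothesis leads from the terms at one stage to the limit. For arbitrary points it
  -- rests on the ultrametric inequality on X, whose derivation uses this lemma for constant points;
  -- hence it is a parameter here.
  Dist-intro : ∀ {x y : Graph} {R} → Point x → Point y → IsReal R →
    (∀ {s} → U [ R ] s → Near x y s) → (∀ {s} → Near x y s → U [ R ] s) →
    (∀ {i c a b s} → Pow i c → x i a → y i b → U [ dist a b ] s → Near x y (s +ℚ 1/1+ c)) → Dist x y R
  Dist-intro {x} {y} {R} P P' real to from persist = real , λ e₁ e₂ e₃ ε>0 → do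
    let ε = frac e₁ e₂ e₃ ; reg = IsReal⇒Regular real
    k , c , _ , p , l ← split 0# (⊏-intro ε>0)
    q , r ← total reg k
    n , h ← eventually (to (U-at reg p r)) (0⊏1/1+ c)
    return (n ⊹ k , λ i a b (n≤i , xa , yb) →
      let P-reg = dist-regular (inside P xa) (inside P' yb) in
      <ᴿ-intro {[ dist a b ]} {R ⊕ rat ε} (total P-reg) (⊕-regular {R} reg) (h i a b (≤-trans (≤-⊹ʳ n k) n≤i) xa yb)
        -- Otherwise R is at most q + 2·2⁻ᵏ - ε, so its k-th term q is at most q + 3·2⁻ᵏ - ε,
        -- although 4·2⁻ᵏ < ε.
        (λ u → ⊏-⊒-absurd l (linear (below (U-⊕-elim {R} {ε} {t = (q +ℚ 1/1+ c) +ℚ (1/1+ c +ℚ (-ℚ ε))} reg u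
            (linear (proj₂ (-ℚ-inverse ε)) (solveℚ 4 (λ q c ε ε' →
              ((q :⊕ c) :⊕ c) :⊕ (ε :⊕ ε') :⊜ (((q :⊕ c) :⊕ (c :⊕ ε')) :⊕ ε) :⊕ :0)
                ≈ℚ-refl q (1/1+ c) ε (-ℚ ε)))) p r ⊞ 0⊑1/1+ c ⊞ proj₁ (-ℚ-inverse ε))
          (solveℚ 4 (λ q c ε ε' → ε :⊕ ((((q :⊕ c) :⊕ (c :⊕ ε')) :⊕ c) :⊕ (c :⊕ :0)) :⊜
            ((c :⊕ c) :⊕ (c :⊕ c)) :⊕ (q :⊕ (:0 :⊕ (ε :⊕ ε')))) ≈ℚ-refl q (1/1+ c) ε (-ℚ ε)))) ,
      <ᴿ-intro {[ R ]} {dist a b ⊕ rat ε} (total reg) (⊕-regular {dist a b} P-reg) (U-at reg p r)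
        (λ u → do
          d , p' ← pow i
          let u' = U-⊕-elim {dist a b} {ε} {t = q +ℚ (1/1+ c +ℚ (-ℚ ε))} P-reg u
                (linear (proj₂ (-ℚ-inverse ε)) (solveℚ 4 (λ q c ε ε' →
                  (q :⊕ c) :⊕ (ε :⊕ ε') :⊜ ((q :⊕ (c :⊕ ε')) :⊕ ε) :⊕ :0) ≈ℚ-refl q (1/1+ c) ε (-ℚ ε)))
          ⊏-⊒-absurd l (linear (below (from (persist p' xa yb u')) p r ⊞ antitone (≤-trans (≤-⊹ˡ n k) n≤i) p p' ⊞
              0⊑1/1+ c ⊞ proj₁ (-ℚ-inverse ε))
            (solveℚ 5 (λ q c d ε ε' → ε :⊕ ((((q :⊕ (c :⊕ ε')) :⊕ d) :⊕ c) :⊕ (c :⊕ (c :⊕ :0))) :⊜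
              ((c :⊕ c) :⊕ (c :⊕ c)) :⊕ (q :⊕ (d :⊕ (:0 :⊕ (ε :⊕ ε'))))) ≈ℚ-refl q (1/1+ c) (1/1+ d) ε (-ℚ ε)))))

  Point-resp : ∀ {A x} → Represents A x → Point x → Point (gr A)
  Point-resp r P = point-intro
    (λ i → do
      a , p ← values P i
      return (a , proj₂ (r i a) p))
    (λ p → inside P (proj₁ (r _ _) p))
    (λ l p q q' → cauchy P l p (proj₁ (r _ _) q) (proj₁ (r _ _) q'))

  ⊑-+e' : ∀ {q} c → 0ℚ ⊑ q → 1/1+ c ⊑ q +ℚ 1/1+ c
  ⊑-+e' {q} c l = linear l (solveℚ 2 (λ q c → c :⊕ q :⊜ (q :⊕ c) :⊕ :0) ≈ℚ-refl q (1/1+ c))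

  -- IsUltrametric is applied to constant points to get the inequality on X.

  private
    module Bootstrap {a b A B} (a∈ : a ∈ˢ X) (b∈ : b ∈ˢ X) (rA : Represents A (const a)) (rB : Represents B (const b)) where

      PA : Point (gr A)
      PA = Point-resp rA (constant a∈)

      PB : Point (gr B)
      PB = Point-resp rB (constant b∈)

      near : ∀ {s} → U [ dist a b ] s → Near (gr A) (gr B) s
      near u = near-intro λ ε>0 → return (0# , λ i a' b' _ p q →
        U-mono (⊑-+ʳ (⊏⇒⊑ ε>0)) (d-resp (≈-sym (proj₁ (rA _ _) p)) (≈-sym (proj₁ (rB _ _) q)) u))

      far : ∀ {s} → Near (gr A) (gr B) s → U [ dist a b ] s
      far h = U-closed λ ε>0 → do
        n , k ← eventually h ε>0
        k n a b ≤-refl (proj₂ (rA _ _) ≈-refl) (proj₂ (rB _ _) ≈-refl)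

      distance : ∃S λ R → Dist (gr A) (gr B) (gr R) × Represents R (dist a b)
      distance = do
        R , r ← represent-row D ⟪ a , b ⟫ (proj₁ real) (λ i → do
          q , p ← total (dist-regular a∈ b∈) i
          return (code q , p))
        return (R , Dist-intro PA PB
          ( (λ i v w (p , q) → proj₁ real i v w (proj₁ (r _ _) p , proj₁ (r _ _) q))
          , (λ k → do
              q , p ← total (dist-regular a∈ b∈) k
              ∃Q-intro {λ q → gr R k (code q)} q (proj₂ (r _ _) p))
          , λ i j c q₁ q₂ q₃ r₁ r₂ r₃ (l , p , q , q') →
              proj₂ (proj₂ real) i j c q₁ q₂ q₃ r₁ r₂ r₃ (l , p , proj₁ (r _ _) q , proj₁ (r _ _) q'))
          (λ u → near (U-intro λ p q → below u p (proj₂ (r _ _) q)))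
          (λ h → U-intro λ p q → below (far h) p (proj₁ (r _ _) q))
          (λ {_} {c} _ p q u → near (U-mono (⊑-+e c) (d-resp (proj₁ (rA _ _) p) (proj₁ (rB _ _) q) u))) , r)
        where real = proj₁ (proj₁ (proj₂ space) _ _ (a∈ , b∈))

  d-ultra : ∀ {a b c s} → a ∈ˢ X → b ∈ˢ X → c ∈ˢ X → U [ dist a c ] s → U [ dist c b ] s → U [ dist a b ] s
  d-ultra {a} {b} {c} a∈ b∈ c∈ u v = do
    A , rA ← represent-const a
    B , rB ← represent-const b
    C , rC ← represent-const c
    let module AB = Bootstrap {A = A} {B = B} a∈ b∈ rA rB
        module AC = Bootstrap {A = A} {B = C} a∈ c∈ rA rC
        module CB = Bootstrap {A = C} {B = B} c∈ b∈ rC rB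
        sv : ∀ {A a} → Represents A (const a) → SingleValued (gr A)
        sv = λ r i v w (p , q) → ≈-trans (proj₁ (r i v) p) (≈-sym (proj₁ (r i w) q))
    R , dR , rR ← AB.distance
    S , dS , rS ← AC.distance
    T , dT , rT ← CB.distance
    let w = ≤ᴿ-elim {[ gr R ]} {gr S ⊔ gr T} (IsReal⇒Regular (proj₁ dR))
          (⊔-total {gr S} {gr T} (total (IsReal⇒Regular (proj₁ dS))) (total (IsReal⇒Regular (proj₁ dT))))
          (ultra A B C R S T (Point⇒IsPoint (sv rA) AB.PA , Point⇒IsPoint (sv rB) AB.PB , Point⇒IsPoint (sv rC) AC.PB ,
            dR , dS , dT))
          (U-⊔ {gr S} {gr T} (U-intro λ p q → below u p (proj₁ (rS _ _) q)) (U-intro λ p q → below v p (proj₁ (rT _ _) q)))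
    U-intro λ p q → below w p (proj₂ (rR _ _) q)

  -- The ultrametric inequality calls for the maximum of `s` and the Cauchy error 2⁻ⁱ. Their sum
  -- bounds it without a comparison, as both are nonnegative.
  forwards : ∀ {x y i j c a a' b b' s} → Point x → Point y → i ≤ j → Pow i c → x i a → x j a' → y i b → y j b' →
             U [ dist a b ] s → U [ dist a' b' ] (s +ℚ 1/1+ c)
  forwards {c = c} P P' l p xa xa' yb yb' u =
    let a∈ = inside P xa ; a'∈ = inside P xa' ; b∈ = inside P' yb ; b'∈ = inside P' yb'
        e = ⊑-+e' c (d-nonneg a∈ b∈ u)
    in d-ultra a'∈ b'∈ a∈ (U-mono e (d-sym a∈ a'∈ (cauchy P l p xa xa')))
         (d-ultra a∈ b'∈ b∈ (U-mono (⊑-+e c) u) (U-mono e (cauchy P' l p yb yb')))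

  backwards : ∀ {x y i j c a a' b b' s} → Point x → Point y → i ≤ j → Pow i c → x i a → x j a' → y i b → y j b' →
              U [ dist a' b' ] s → U [ dist a b ] (s +ℚ 1/1+ c)
  backwards {c = c} P P' l p xa xa' yb yb' u =
    let a∈ = inside P xa ; a'∈ = inside P xa' ; b∈ = inside P' yb ; b'∈ = inside P' yb'
        e = ⊑-+e' c (d-nonneg a'∈ b'∈ u)
    in d-ultra a∈ b∈ a'∈ (U-mono e (cauchy P l p xa xa'))
         (d-ultra a'∈ b∈ b'∈ (U-mono (⊑-+e c) u) (U-mono e (d-sym b∈ b'∈ (cauchy P' l p yb yb'))))

  persist : ∀ {x y i c a b s} → Point x → Point y → Pow i c → x i a → y i b → U [ dist a b ] s → Near x y (s +ℚ 1/1+ c)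
  persist {i = i} P P' p xa yb u = near-intro λ ε>0 → return (i , λ j a' b' l xa' yb' →
    U-mono (⊑-+ʳ (⊏⇒⊑ ε>0)) (forwards P P' l p xa xa' yb yb' u))

  -- The k-th approximation of d(x , y) is taken from stage k + 2, so that the
  -- three errors made there add up to less than 2⁻ᵏ.
  distance : ∀ {A B x y} → Point x → Point y → Represents A x → Represents B y → ∃S λ R → Dist x y (gr R)
  distance {A} {B} {x} {y} P P' rA rB = do
    -- The auxiliary witness is a bound for the terms of x and y involved, so that the quantifiers
    -- over them are bounded.
    R , (R-sv , R-total) , h ← choice
      (∃¹ (v0 ≺ v1 ∧ ∃¹ (v0 ≺ v2 ∧ (⟨ v4 + 𝟏 + 𝟏 , v1 ⟩ ∈ zero ∧ ⟨ v4 + 𝟏 + 𝟏 , v0 ⟩ ∈ suc zero ∧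
        ⟨ ⟨ ⟨ v1 , v0 ⟩ , v4 + 𝟏 + 𝟏 ⟩ , v3 ⟩ ∈ suc (suc zero)))))
      (bex v0 (bex v1 (and mem (and mem mem)))) (A ∷ₑ B ∷ₑ D ∷ₑ ∅) ∅ λ u → do
        a , p ← values P (u ⊹ 1# ⊹ 1#)
        b , q ← values P' (u ⊹ 1# ⊹ 1#)
        t , r ← total (dist-regular (inside P p) (inside P' q)) (u ⊹ 1# ⊹ 1#)
        return (code t , return (a ⊹ b ⊹ 1# , return (a , ≤⇒<suc (≤-⊹ʳ a b) , return (b , ≤⇒<suc (≤-⊹ˡ a b) ,
          proj₂ (rA _ _) p , proj₂ (rB _ _) q , r))))
    let elim : ∀ {u v} → gr R u v → ¬¬ (Σ N λ a → Σ N λ b → x (u ⊹ 1# ⊹ 1#) a × y (u ⊹ 1# ⊹ 1#) b × dist a b (u ⊹ 1# ⊹ 1#) v)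
        elim {u} {v} k = do
          _ , k ← h u v k
          a , _ , k ← k
          b , _ , p , q , r ← k
          return (a , b , proj₁ (rA _ _) p , proj₁ (rB _ _) q , r)
        R-regular : ∀ {i j c q r} → i ≤ j → Pow i c → gr R i (code q) → gr R j (code r) →
                    q ⊑ r +ℚ 1/1+ c × r ⊑ q +ℚ 1/1+ c
        R-regular {i} {j} {c} {q} {r} l p m m' = do
          a , b , xa , yb , k ← elim {i} {code q} m
          a' , b' , xa' , yb' , k' ← elim {j} {code r} m'
          c₁ , p₁ ← pow (i ⊹ 1#)
          c₂ , p₂ ← pow (i ⊹ 1# ⊹ 1#)
          e , pe ← pow (j ⊹ 1# ⊹ 1#)
          let l₂ = ⊹-mono (⊹-mono l (≤-refl {1#})) (≤-refl {1#})
              reg = dist-regular (inside P xa) (inside P' yb)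
              reg' = dist-regular (inside P xa') (inside P' yb')
              small' = antitone l₂ p₂ pe
              bound = (proj₁ (half p₁ p₂) ⊞ proj₁ (half p₁ p₂)) ⊞ proj₁ (half p p₁) ⊞ 0⊑1/1+ c₂
          linear (below (backwards P P' l₂ p₂ xa xa' yb yb' (U-at reg' pe k')) p₂ k ⊞ small' ⊞ bound)
              (solveℚ 6 (λ q r c c₁ c₂ e → q :⊕ ((((r :⊕ e) :⊕ c₂) :⊕ c₂) :⊕ (c₂ :⊕ ((c₁ :⊕ c₁) :⊕ (c :⊕ c₂)))) :⊜
                (r :⊕ c) :⊕ (q :⊕ (e :⊕ (((c₂ :⊕ c₂) :⊕ (c₂ :⊕ c₂)) :⊕ ((c₁ :⊕ c₁) :⊕ :0))))) ≈ℚ-refl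
                q r (1/1+ c) (1/1+ c₁) (1/1+ c₂) (1/1+ e)) ,
            linear (below (forwards P P' l₂ p₂ xa xa' yb yb' (U-at reg p₂ k)) pe k' ⊞ small' ⊞ bound)
              (solveℚ 6 (λ q r c c₁ c₂ e → r :⊕ ((((q :⊕ c₂) :⊕ c₂) :⊕ e) :⊕ (c₂ :⊕ ((c₁ :⊕ c₁) :⊕ (c :⊕ c₂)))) :⊜
                (q :⊕ c) :⊕ (r :⊕ (e :⊕ (((c₂ :⊕ c₂) :⊕ (c₂ :⊕ c₂)) :⊕ ((c₁ :⊕ c₁) :⊕ :0))))) ≈ℚ-refl
                q r (1/1+ c) (1/1+ c₁) (1/1+ c₂) (1/1+ e))
    return (R , Dist-intro P P'
      ( R-sv
      , (λ k → do
          v , m ← R-total k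
          a , b , xa , yb , d ← elim {k} {v} m
          let sv = proj₁ (proj₁ (proj₁ (proj₂ space) _ _ (inside P xa , inside P' yb)))
          q , d' ← total (dist-regular (inside P xa) (inside P' yb)) (k ⊹ 1# ⊹ 1#)
          ∃Q-intro {λ q → gr R k (code q)} q (gr-resp ≈-refl (sv _ _ _ (d , d')) m))
      , λ i j c q₁ q₂ q₃ r₁ r₂ r₃ (l , p , m , m') →
          let g , g' = R-regular {q = frac q₁ q₂ q₃} {frac r₁ r₂ r₃} l (Pow2⇒Pow p) m m' in ⊑-elim g , ⊑-elim g')
      (λ {s} u → near-intro λ {ε} ε>0 → do
        k , c , _ , p , l ← split 0# ε>0
        v , m ← R-total k
        a , b , xa , yb , d ← elim {k} {v} m
        let sv = proj₁ (proj₁ (proj₁ (proj₂ space) _ _ (inside P xa , inside P' yb)))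
        q , d' ← total (dist-regular (inside P xa) (inside P' yb)) (k ⊹ 1# ⊹ 1#)
        let m' = gr-resp ≈-refl (sv _ _ _ (d , d')) m
        c' , p' ← pow (k ⊹ 1# ⊹ 1#)
        return (k ⊹ 1# ⊹ 1# , λ j a' b' l' xa' yb' →
          let small' = antitone (≤-trans (≤-⊹ʳ k 1#) (≤-⊹ʳ _ 1#)) p p' in
          U-mono (linear (below u {q = q} p m' ⊞ small' ⊞ small' ⊞ ⊏⇒⊑ l ⊞ 0⊑1/1+ c)
            (solveℚ 5 (λ q s c c' ε → ((q :⊕ c') :⊕ c') :⊕ ((s :⊕ c) :⊕ (c :⊕ (c :⊕ (ε :⊕ c)))) :⊜
              (s :⊕ ε) :⊕ (q :⊕ (c' :⊕ (c' :⊕ (((c :⊕ c) :⊕ (c :⊕ c)) :⊕ :0))))) ≈ℚ-refl q s (1/1+ c) (1/1+ c') ε))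
            (forwards P P' l' p' xa xa' yb yb' (U-at (dist-regular (inside P xa) (inside P' yb)) p' d'))))
      (λ {s} near → U-intro λ {k} {c} {q} p m → do
        a , b , xa , yb , d ← elim {k} {code q} m
        c₁ , p₁ ← pow (k ⊹ 1#)
        c₂ , p₂ ← pow (k ⊹ 1# ⊹ 1#)
        closed 0# λ _ e _ _ → do
          n , f ← eventually near (0⊏1/1+ e)
          a' , xa' ← values P (n ⊹ (k ⊹ 1# ⊹ 1#))
          b' , yb' ← values P' (n ⊹ (k ⊹ 1# ⊹ 1#))
          linear (below (backwards P P' (≤-⊹ˡ n _) p₂ xa xa' yb yb' (f _ a' b' (≤-⊹ʳ n _) xa' yb')) p₂ d ⊞
              proj₁ (half p₁ p₂) ⊞ antitone (≤-⊹ʳ k 1#) p p₁ ⊞ 0⊑1/1+ e ⊞ 0⊑1/1+ e ⊞ 0⊑1/1+ e)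
            (solveℚ 6 (λ q s c c₁ c₂ e → q :⊕ ((((s :⊕ e) :⊕ c₂) :⊕ c₂) :⊕ (c₁ :⊕ (c :⊕ (e :⊕ (e :⊕ e))))) :⊜
              ((s :⊕ c) :⊕ ((e :⊕ e) :⊕ (e :⊕ e))) :⊕ (q :⊕ ((c₂ :⊕ c₂) :⊕ (c₁ :⊕ (:0 :⊕ (:0 :⊕ :0)))))) ≈ℚ-refl
              q s (1/1+ c) (1/1+ c₁) (1/1+ c₂) (1/1+ e)))
      (persist P P'))

-- Coded continuous functions

module Continuity (𝓜 : Model RCA₀) (E : Model.S 𝓜) (E-pow : Semantics.IsPow2 𝓜 E) (X D : Model.S 𝓜)
  (space : Semantics.Spaces.IsSpace 𝓜 X D) (ultra : Semantics.Spaces.IsUltrametric 𝓜 X D)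
  (Φ : Model.S 𝓜) (continuous : Semantics.Spaces.IsContinuous 𝓜 X D Φ) where

  open Metric 𝓜 E E-pow X D space ultra public

  -- Upper bounds for distances of points

  instance
    Near-Stable : ∀ {x y s} → Stable (Near x y s)
    Near-Stable = mk λ h → near-intro λ l → stable λ k → h λ n → k (eventually n l)

  Near-sym : ∀ {x y s} → Point x → Point y → Near x y s → Near y x s
  Near-sym P P' h = near-intro λ l → do
    n , f ← eventually h l
    return (n , λ i a b n≤i p q → d-sym (inside P q) (inside P' p) (f i b a n≤i q p))

  Near-trans : ∀ {x y z s} → Point x → Point y → Point z → Near x y s → Near y z s → Near x z s
  Near-trans P P' P'' h h' = near-intro λ l → do
    n , f ← eventually h l
    m , g ← eventually h' l
    return (n ⊹ m , λ i a b n≤i p q → do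
      c , r ← values P' i
      d-ultra (inside P p) (inside P'' q) (inside P' r)
        (f i a c (≤-trans (≤-⊹ʳ n m) n≤i) p r) (g i c b (≤-trans (≤-⊹ˡ n m) n≤i) r q))

  Near-closed : ∀ {x y s} → (∀ {ε} → 0ℚ ⊏ ε → Near x y (s +ℚ ε)) → Near x y s
  Near-closed {s = s} h = near-intro λ {ε} l → do
    k , c , _ , p , l' ← split 0# l
    n , f ← eventually (h (0⊏1/1+ c)) (0⊏1/1+ c)
    return (n , λ i a b n≤i p q → U-mono (linear (⊏⇒⊑ l' ⊞ 0⊑1/1+ c ⊞ 0⊑1/1+ c)
      (solveℚ 3 (λ s c ε → ((s :⊕ c) :⊕ c) :⊕ (ε :⊕ (c :⊕ c)) :⊜
        (s :⊕ ε) :⊕ (((c :⊕ c) :⊕ (c :⊕ c)) :⊕ (:0 :⊕ :0))) ≈ℚ-refl s (1/1+ c) ε)) (f i a b n≤i p q))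

  Near-nonneg : ∀ {x y s} → Point x → Point y → Near x y s → 0ℚ ⊑ s
  Near-nonneg {s = s} P P' h = closed 0# λ _ e _ _ → do
    n , f ← eventually h (0⊏1/1+ e)
    a , p ← values P n
    b , q ← values P' n
    linear (d-nonneg (inside P p) (inside P' q) (f n a b ≤-refl p q) ⊞ 0⊑1/1+ e ⊞ 0⊑1/1+ e ⊞ 0⊑1/1+ e)
      (solveℚ 2 (λ s e → :0 :⊕ ((s :⊕ e) :⊕ (e :⊕ (e :⊕ e))) :⊜
        (s :⊕ ((e :⊕ e) :⊕ (e :⊕ e))) :⊕ (:0 :⊕ (:0 :⊕ (:0 :⊕ :0)))) ≈ℚ-refl s (1/1+ e))

  Near-refl : ∀ {x s} → Point x → 0ℚ ⊑ s → Near x x s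
  Near-refl P l = near-intro λ {ε} ε>0 → do
    k , c , _ , p , l' ← split 0# ε>0
    return (k , λ i a b k≤i xa xb → do
      d , p' ← pow i
      U-mono (linear (l ⊞ ⊏⇒⊑ l' ⊞ antitone k≤i p p' ⊞ 0⊑1/1+ c ⊞ 0⊑1/1+ c ⊞ 0⊑1/1+ c)
        (solveℚ 4 (λ s c d ε → d :⊕ (s :⊕ (ε :⊕ (c :⊕ (c :⊕ (c :⊕ c))))) :⊜
          (s :⊕ ε) :⊕ (:0 :⊕ (((c :⊕ c) :⊕ (c :⊕ c)) :⊕ (d :⊕ (:0 :⊕ (:0 :⊕ :0)))))) ≈ℚ-refl _ (1/1+ c) (1/1+ d) ε))
        (cauchy P ≤-refl p' xa xb))

  Near-approx : ∀ {x j c a} → Point x → Pow j c → x j a → Near x (const a) (1/1+ c)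
  Near-approx {j = j} P p xa = near-intro λ ε>0 → return (j , λ i b a' j≤i xb e →
    d-resp ≈-refl (≈-sym e) (U-mono (⊑-+ʳ (⊏⇒⊑ ε>0)) (d-sym (inside P xa) (inside P xb) (cauchy P j≤i p xa xb))))

  Near-const : ∀ {a b s} → U [ dist a b ] s → Near (const a) (const b) s
  Near-const u = near-intro λ ε>0 → return (0# , λ _ _ _ _ e f →
    d-resp (≈-sym e) (≈-sym f) (U-mono (⊑-+ʳ (⊏⇒⊑ ε>0)) u))

  Near-const⁻ : ∀ {a b s} → Near (const a) (const b) s → U [ dist a b ] s
  Near-const⁻ {a} {b} h = U-closed λ ε>0 → do
    n , f ← eventually h ε>0
    f n a b ≤-refl ≈-refl ≈-refl

  Near-equal : ∀ {x y s} → Point y → (∀ i a → x i a → y i a) → 0ℚ ⊑ s → Near x y s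
  Near-equal P ι l = near-intro λ ε>0 → do
    n , f ← eventually (Near-refl P l) ε>0
    return (n , λ i a b n≤i p q → f i a b n≤i (ι i a p) q)

  -- `Dist≤` asks for a set that codes the distance, and `distance` builds it by comprehension from
  -- sets coding the two points.
  Dist≤-intro : ∀ {A B x y C} → Point x → Point y → Represents A x → Represents B y → Regular [ C ] →
                (∀ {s} → U [ C ] s → Near x y s) → Dist≤ x y C
  Dist≤-intro P P' rA rB C-reg h = do
    R , d ← distance P P' rA rB
    return (R , d , ≤ᴿ-intro C-reg (Dist-elim₂ P P' d ∘ h))

  Dist≤-elim : ∀ {x y C s} → Point x → Point y → Regular [ C ] → Dist≤ x y C → U [ C ] s → Near x y s
  Dist≤-elim P P' C-reg h u = do
    R , d , l ← h
    Dist-elim₁ P P' d (≤ᴿ-elim (IsReal⇒Regular (proj₁ d)) (total C-reg) l u)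

  Dist<-intro : ∀ {A B x y t r} → Point x → Point y → Represents A x → Represents B y →
                Near x y t → t ⊏ r → Dist< x y (rat r)
  Dist<-intro {r = r} P P' rA rB h l = do
    R , d ← distance P P' rA rB
    return (R , d , <ᴿ-intro (total (IsReal⇒Regular (proj₁ d))) (rat-regular {r}) (Dist-elim₂ P P' d h)
      (⊏-⊒-absurd l ∘ U-rat-elim))

  Dist<-elim : ∀ {x y r} → Point x → Point y → Dist< x y (rat r) → ¬¬ (Σ Q λ t → Near x y t × t ⊏ r)
  Dist<-elim {r = r} P P' h = do
    R , d , l ← h
    t , u , n ← <ᴿ-elim (IsReal⇒Regular (proj₁ d)) l
    return (t , Dist-elim₁ P P' d u , ⋢⇒⊐ (n ∘ U-rat-intro))

  represents : ∀ {A} → Represents A (gr A)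
  represents i v = id , id

  gap : ∀ {q r} n → q ⊏ r → ¬¬ (Σ N λ k → Σ N λ c → n ≤ k × Pow k c ×
          q +ℚ ((1/1+ c +ℚ 1/1+ c) +ℚ (1/1+ c +ℚ 1/1+ c)) ⊏ r)
  gap {q} {r} n l = do
    k , c , n≤k , p , l' ← split {r +ℚ (-ℚ q)} n (⋢⇒⊐ λ m → ⊏-⊒-absurd l
      (linear (m ⊞ proj₂ (-ℚ-inverse q))
        (solveℚ 3 (λ q q' r → r :⊕ (:0 :⊕ (q :⊕ q')) :⊜ q :⊕ ((r :⊕ q') :⊕ :0)) ≈ℚ-refl q (-ℚ q) r)))
    return (k , c , n≤k , p , ⋢⇒⊐ λ m → ⊏-⊒-absurd l' (linear (m ⊞ proj₁ (-ℚ-inverse q))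
      (solveℚ 4 (λ q q' r c → (r :⊕ q') :⊕ ((q :⊕ c) :⊕ :0) :⊜ c :⊕ (r :⊕ (q :⊕ q'))) ≈ℚ-refl q (-ℚ q) r _)))

  -- Neighbourhoods and values of a coded function

  private
    partial = proj₁ continuous

  quint-injective : ∀ {k a r b s k' a' r' b' s'} → quint k a r b s ≈ quint k' a' r' b' s' →
                    k ≈ k' × a ≈ a' × r ≈ r' × b ≈ b' × s ≈ s'
  quint-injective e =
    let e₁ , e = ⟪⟫-injective e
        e₂ , e = ⟪⟫-injective e
        e₃ , e = ⟪⟫-injective e
        e₄ , e₅ = ⟪⟫-injective e
    in e₁ , e₂ , e₃ , e₄ , e₅

  quint-cong : ∀ {k a r b s k' a' r' b' s'} → k ≈ k' → a ≈ a' → r ≈ r' → b ≈ b' → s ≈ s' →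
               quint k a r b s ≈ quint k' a' r' b' s'
  quint-cong e₁ e₂ e₃ e₄ e₅ = ⟪⟫-cong e₁ (⟪⟫-cong e₂ (⟪⟫-cong e₃ (⟪⟫-cong e₄ e₅)))

  ⊏-resp : ∀ {q r} → code q ≈ code r → 0ℚ ⊏ q → 0ℚ ⊏ r
  ⊏-resp {q} {r} e l = ⋢⇒⊐ λ m → ⊏-⊒-absurd l (⊑-trans (proj₁ (code-≈ {q} {r} e)) m)

  record Related (a : N) (r : Q) (b : N) (s : Q) : Set where
    constructor related
    field
      rel    : Rel Φ a r b s
      a∈X    : a ∈ˢ X
      b∈X    : b ∈ˢ X
      radius : 0ℚ ⊏ r
      target : 0ℚ ⊏ s
  open Related public

  instance
    Related-Stable : ∀ {a r b s} → Stable (Related a r b s)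
    Related-Stable = mk λ h → related (h >>= rel) (h >>= a∈X) (h >>= b∈X) (h >>= radius) (h >>= target)

  Φ-shape : ∀ {z} → z ∈ˢ Φ → ¬¬ (Σ N λ k → Σ N λ a → Σ Q λ r → Σ N λ b → Σ Q λ s →
              z ≈ quint k a (code r) b (code s) × a ∈ˢ X × 0ℚ ⊏ r × b ∈ˢ X × 0ℚ ⊏ s)
  Φ-shape {z} m = do
    k , h ← proj₁ partial z m
    a , h ← h
    r₁ , h ← h
    r₂ , h ← h
    r₃ , h ← h
    b , h ← h
    s₁ , h ← h
    s₂ , h ← h
    s₃ , e , a∈ , r>0 , b∈ , s>0 ← h
    return (k , a , frac r₁ r₂ r₃ , b , frac s₁ s₂ s₃ , e , a∈ , ⊏-intro r>0 , b∈ , ⊏-intro s>0)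

  Rel⇒Related : ∀ {a r b s} → Rel Φ a r b s → Related a r b s
  Rel⇒Related {a} {r} {b} {s} h = do
    k , m ← h
    _ , a' , r' , b' , s' , e , a∈ , r>0 , b∈ , s>0 ← Φ-shape m
    let _ , e₁ , e₂ , e₃ , e₄ = quint-injective e
    related h (∈-resp (≈-sym e₁) a∈) (∈-resp (≈-sym e₃) b∈)
      (⊏-resp {r'} {r} (≈-sym e₂) r>0) (⊏-resp {s'} {s} (≈-sym e₄) s>0)

  consistent : ∀ {a r b s b' s'} → Related a r b s → Related a r b' s' → U [ dist b b' ] (s +ℚ s')
  consistent {a} {r} {b} {s} {b'} {s'} h h' = ≤ᴿ-elim {[ dist b b' ]} {rat s ⊕ rat s'}
    (dist-regular (b∈X h) (b∈X h')) (⊕-total {rat s} {s'} (total (rat-regular {s})))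
    (proj₁ (proj₂ partial) a (pos r) (neg r) (den-1 r) b (pos s) (neg s) (den-1 s) b' (pos s') (neg s') (den-1 s') (rel h , rel h'))
    (U-⊕-intro {rat s} {s'} (U-rat-intro ⊑-refl))

  Inside-intro : ∀ {a r a' r' t} → a ∈ˢ X → a' ∈ˢ X → U [ dist a a' ] t → t +ℚ r' ⊏ r → Inside a' r' a r
  Inside-intro {a} {r} {a'} {r'} a∈ a'∈ u l = <ᴿ-intro {dist a a' ⊕ rat r'} {[ rat r ]}
    (⊕-total {dist a a'} {r'} (total (dist-regular a∈ a'∈))) (rat-regular {r})
    (U-⊕-intro {dist a a'} {r'} u) (⊏-⊒-absurd l ∘ U-rat-elim)

  shrink : ∀ {a r b s a' r' t} → Related a r b s → a' ∈ˢ X → 0ℚ ⊏ r' → U [ dist a a' ] t → t +ℚ r' ⊏ r → Related a' r' b s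
  shrink {a} {r} {b} {s} {a'} {r'} h a'∈ l u l' = Rel⇒Related
    (proj₁ (proj₂ (proj₂ partial)) a (pos r) (neg r) (den-1 r) b (pos s) (neg s) (den-1 s) a' (pos r') (neg r') (den-1 r')
      (a'∈ , ⊏-elim l , rel h , Inside-intro {r' = r'} (a∈X h) a'∈ u l'))

  enlarge : ∀ {a r b s b' s' t} → Related a r b s → b' ∈ˢ X → 0ℚ ⊏ s' → U [ dist b' b ] t → t +ℚ s ⊏ s' → Related a r b' s'
  enlarge {a} {r} {b} {s} {b'} {s'} h b'∈ l u l' = Rel⇒Related
    (proj₂ (proj₂ (proj₂ partial)) a (pos r) (neg r) (den-1 r) b (pos s) (neg s) (den-1 s) b' (pos s') (neg s') (den-1 s')
      (b'∈ , ⊏-elim l , rel h , Inside-intro {r' = s} b'∈ (b∈X h) u l'))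

  record InBall (z : Graph) (a : N) (r : Q) : Set where
    constructor in-ball
    field
      {bound} : Q
      near    : Near z (const a) bound
      bound<r : bound ⊏ r
  open InBall public

  -- The term of index j + 1 is within 2⁻⁽ʲ⁺¹⁾ of z. So the ball of radius 2⁻ʲ about it still has z
  -- strictly inside, and for large j it fits strictly into the ball of radius r.
  recentre : ∀ {z a r b s} → Point z → InBall z a r → Related a r b s →
             ¬¬ (Σ N λ k → ∀ {j c d} → k ≤ j → Pow j d → z (j ⊹ 1#) c → Related c (1/1+ d) b s)
  recentre {z} {a} {r} P (in-ball {t} h l) R = do
    k , e , _ , p , l' ← gap 0# l
    return (k , λ {j} {c} {d} k≤j pj zc → do
      d' , pj' ← pow (j ⊹ 1#)
      let c∈ = inside P zc
          0≤t = Near-nonneg P (constant (a∈X R)) h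
          m = antitone k≤j p pj
          m' = antitone (≤-⊹ʳ j 1#) pj pj'
      shrink R c∈ (0⊏1/1+ d)
        (Near-const⁻ (Near-trans (constant (a∈X R)) P (constant c∈)
          (Near-mono (⊑-+e d') (Near-sym P (constant (a∈X R)) h))
          (Near-mono (⊑-+e' d' 0≤t) (Near-approx P pj' zc))))
        (⋢⇒⊐ λ n → ⊏-⊒-absurd l' (linear (n ⊞ m' ⊞ m ⊞ m ⊞ 0⊑1/1+ e ⊞ 0⊑1/1+ e)
          (solveℚ 5 (λ r t d d' e → r :⊕ (((t :⊕ d') :⊕ d) :⊕ (d :⊕ (e :⊕ (e :⊕ (e :⊕ e))))) :⊜
            (t :⊕ ((e :⊕ e) :⊕ (e :⊕ e))) :⊕ (r :⊕ (d' :⊕ (d :⊕ (d :⊕ (:0 :⊕ :0)))))) ≈ℚ-refl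
            r t (1/1+ d) (1/1+ d') (1/1+ e)))))

  -- The consistency condition on Φ compares targets of one source ball, so both sources are first
  -- replaced by a common small ball about a term of z.
  joint : ∀ {z a r b s a' r' b' s'} → Point z → InBall z a r → Related a r b s →
          InBall z a' r' → Related a' r' b' s' → U [ dist b b' ] (s +ℚ s')
  joint P B R B' R' = do
    k , f ← recentre P B R
    k' , f' ← recentre P B' R'
    c , p ← values P (k ⊹ k' ⊹ 1#)
    d , q ← pow (k ⊹ k')
    consistent (f (≤-⊹ʳ k k') q p) (f' (≤-⊹ˡ k k') q p)

  domain : ∀ {Z} → SingleValued (gr Z) → Point (gr Z) → ∀ {ε} → 0ℚ ⊏ ε →
           ¬¬ (Σ N λ a → Σ Q λ r → Σ N λ b → Σ Q λ s → Related a r b s × InBall (gr Z) a r × s ⊏ ε)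
  domain {Z} sv P {ε} l = do
    a , h ← proj₂ continuous Z (Point⇒IsPoint sv P) (pos ε) (neg ε) (den-1 ε) (⊏-elim l)
    r₁ , h ← h
    r₂ , h ← h
    r₃ , h ← h
    b , h ← h
    s₁ , h ← h
    s₂ , h ← h
    s₃ , m , d , l' ← h
    let r = frac r₁ r₂ r₃ ; s = frac s₁ s₂ s₃
        R = Rel⇒Related {a} {r} {b} {s} m
    t , h , l'' ← Dist<-elim {r = r} P (constant (a∈X R)) d
    return (a , r , b , s , R , in-ball h l'' , ⊏-intro l')

  record SetPoint : Set where
    constructor set-point
    field
      set          : S
      singleValued : SingleValued (gr set)
      isPoint      : Point (gr set)
  open SetPoint public

  IsPoint⇒SetPoint : ∀ {A} → IsPoint (gr A) → SetPoint
  IsPoint⇒SetPoint {A} h = set-point A (proj₁ h) (point h)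

  -- f(z) is approximated up to 2⁻ⁿ by the b in any (a , 2⁻ʲ) Φ (b , 2⁻⁽ⁿ⁺¹⁾)
  -- with a = z_{j + 1}.
  value : ∀ (z : SetPoint) → ¬¬ (Σ SetPoint λ y → Value Φ (gr (set z)) (gr (set y)))
  value (set-point Z sv P) = do
    Y , (Y-sv , Y-total) , h ← choice
      (∃¹ (v0 ≺ v1 ∧ ∃¹ (v0 ≺ v2 ∧ ∃¹ (v0 ≺ v3 ∧ ∃¹ (v0 ≺ v4 ∧ ∃¹ (v0 ≺ v5 ∧
        -- A pair of the form `⟨ ⟨ 𝟏 , 𝟎 ⟩ , d ⟩` is the code of `1/1+ d`.
        (D.quint v4 v3 ⟨ ⟨ 𝟏 , 𝟎 ⟩ , v2 ⟩ v6 ⟨ ⟨ 𝟏 , 𝟎 ⟩ , v1 ⟩ ∈ zero ∧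
          ⟨ v0 + 𝟏 , v3 ⟩ ∈ suc zero ∧
          ⟨ v0 , v2 + 𝟏 ⟩ ∈ suc (suc zero) ∧
          ⟨ v7 + 𝟏 , v1 + 𝟏 ⟩ ∈ suc (suc zero))))))))
      (bex v0 (bex v1 (bex v2 (bex v3 (bex v4 (and mem (and mem (and mem mem)))))))) (Φ ∷ₑ Z ∷ₑ E ∷ₑ ∅) ∅ λ u → do
        c' , p' ← pow (u ⊹ 1#)
        a , r , b , s , R , B , l ← domain sv P (0⊏1/1+ c')
        j , f ← recentre P B R
        d , p ← pow j
        c , q ← values P (j ⊹ 1#)
        -- The target radius is enlarged to exactly 2⁻⁽ᵘ⁺¹⁾, which the formula can name by means of
        -- E.
        let R' = enlarge (f ≤-refl p q) (b∈X R) (0⊏1/1+ c') (d-refl (b∈X R) ⊑-refl)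
              (⋢⇒⊐ λ m → ⊏-⊒-absurd l (⊑-trans m (proj₁ (+ℚ-identityˡ s))))
        k , m ← rel R'
        let w = k ⊹ c ⊹ d ⊹ c' ⊹ j
        return (b , return (w ⊹ 1# ,
          return (k , ≤⇒<suc (≤-trans (≤-⊹ʳ k c) (≤-trans (≤-⊹ʳ _ d) (≤-trans (≤-⊹ʳ _ c') (≤-⊹ʳ _ j)))) ,
          return (c , ≤⇒<suc (≤-trans (≤-⊹ˡ k c) (≤-trans (≤-⊹ʳ _ d) (≤-trans (≤-⊹ʳ _ c') (≤-⊹ʳ _ j)))) ,
          return (d , ≤⇒<suc (≤-trans (≤-⊹ˡ _ d) (≤-trans (≤-⊹ʳ _ c') (≤-⊹ʳ _ j))) ,
          return (c' , ≤⇒<suc (≤-trans (≤-⊹ˡ _ c') (≤-⊹ʳ _ j)) ,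
          return (j , ≤⇒<suc (≤-⊹ˡ _ j) , m , q , p , p')))))))
    let elim : ∀ {n b} → gr Y n b → ¬¬ (Σ N λ a → Σ Q λ r → Σ N λ c → Related a r b (1/1+ c) × InBall (gr Z) a r × Pow (n ⊹ 1#) c)
        elim {n} {b} y = do
          _ , h ← h n b y
          k , _ , h ← h
          c , _ , h ← h
          d , _ , h ← h
          c' , _ , h ← h
          j , _ , m , q , p , p' ← h
          e , pe ← pow (j ⊹ 1#)
          return (c , 1/1+ d , c' , Rel⇒Related {c} {1/1+ d} {b} {1/1+ c'} (return (k , m)) ,
            in-ball (Near-approx P pe q) (⋢⇒⊐ λ l → ⊏-⊒-absurd (0⊏1/1+ e) (linear (l ⊞ proj₁ (half p pe))
              (solveℚ 2 (λ e d → e :⊕ (e :⊕ d) :⊜ :0 :⊕ (d :⊕ (e :⊕ e))) ≈ℚ-refl (1/1+ e) (1/1+ d)))) , p')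
        Y-point : Point (gr Y)
        Y-point = point-intro Y-total
          (λ y → do
            _ , _ , _ , R , _ ← elim y
            b∈X R)
          λ {i} {j} {e} l p y y' → do
            _ , _ , c , R , B , q ← elim y
            _ , _ , c' , R' , B' , q' ← elim y'
            -- The target radii 2⁻⁽ⁱ⁺¹⁾ and 2⁻⁽ʲ⁺¹⁾ add up to at most 2⁻ⁱ; this is why the radius
            -- for index n has exponent n + 1.
            U-mono (linear (antitone (⊹-mono l (≤-refl {1#})) q q' ⊞ proj₁ (half p q))
              (solveℚ 3 (λ c c' e → (c :⊕ c') :⊕ (c :⊕ e) :⊜ e :⊕ (c' :⊕ (c :⊕ c))) ≈ℚ-refl (1/1+ c) (1/1+ c') (1/1+ e)))
              (joint P B R B' R')
    return (set-point Y Y-sv Y-point , λ a r₁ r₂ r₃ b s₁ s₂ s₃ (m , d) → do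
      let r = frac r₁ r₂ r₃ ; s = frac s₁ s₂ s₃
          R = Rel⇒Related {a} {r} {b} {s} m
      t , near-a , l ← Dist<-elim {r = r} P (constant (a∈X R)) d
      B , rB ← represent-const b
      Dist≤-intro {A = Y} {B = B} {C = rat s} Y-point (constant (b∈X R)) (represents {Y}) rB (rat-regular {s}) λ {t} u →
        near-intro λ {ε} ε>0 → do
          k , e , _ , p , l' ← split 0# ε>0
          return (k , λ i b' b'' k≤i y f → do
            _ , _ , c , R' , B' , q ← elim y
            U-mono (linear (U-rat-elim u ⊞ antitone (≤-trans k≤i (≤-⊹ʳ i 1#)) p q ⊞ ⊏⇒⊑ l' ⊞ 0⊑1/1+ e ⊞ 0⊑1/1+ e ⊞ 0⊑1/1+ e)
              (solveℚ 5 (λ s t c e ε → (c :⊕ s) :⊕ (t :⊕ (e :⊕ (ε :⊕ (e :⊕ (e :⊕ e))))) :⊜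
                (t :⊕ ε) :⊕ (s :⊕ (c :⊕ (((e :⊕ e) :⊕ (e :⊕ e)) :⊕ (:0 :⊕ (:0 :⊕ :0)))))) ≈ℚ-refl
                s t (1/1+ c) (1/1+ e) ε))
              (d-resp ≈-refl (≈-sym f) (joint P B' R' (in-ball near-a l) R))))

  Maps : SetPoint → SetPoint → Set
  Maps x u = Value Φ (gr (set x)) (gr (set u))

  Value-elim : ∀ {x u a r b s} → Maps x u → Related a r b s → InBall (gr (set x)) a r → Near (gr (set u)) (const b) s
  Value-elim {x} {u} {a} {r} {b} {s} v R (in-ball h l) = do
    A , rA ← represent-const a
    Dist≤-elim {C = rat s} (isPoint u) (constant (b∈X R)) (rat-regular {s})
      (v a (pos r) (neg r) (den-1 r) b (pos s) (neg s) (den-1 s)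
        (rel R , Dist<-intro {A = set x} {B = A} {r = r} (isPoint x) (constant (a∈X R)) (represents {set x}) rA h l))
      (U-rat-intro ⊑-refl)

  d≤ : SetPoint → SetPoint → Q → Set
  d≤ x y s = Near (gr (set x)) (gr (set y)) s

  d≤-sym : ∀ x y {s} → d≤ x y s → d≤ y x s
  d≤-sym x y = Near-sym (isPoint x) (isPoint y)

  d≤-trans : ∀ x y z {s} → d≤ x y s → d≤ y z s → d≤ x z s
  d≤-trans x y z = Near-trans (isPoint x) (isPoint y) (isPoint z)

  d≤-nonneg : ∀ x y {s} → d≤ x y s → 0ℚ ⊑ s
  d≤-nonneg x y = Near-nonneg (isPoint x) (isPoint y)

  -- A source ball around x contains y as well, so for each ε one and the same target centre b lies
  -- within ε of both values.
  Maps-cong : ∀ {x y u v} → Maps x u → Maps y v → d≤ x y 0ℚ → d≤ u v 0ℚ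
  Maps-cong {x} {y} {u} {v} m m' e = Near-closed λ {ε} l → do
    a , r , b , s , R , in-ball h l' , l'' ← domain (singleValued x) (isPoint x) l
    let pa = constant (a∈X R) ; pb = constant (b∈X R)
        near-u = Value-elim {x} {u} m R (in-ball h l')
        near-v = Value-elim {y} {v} m' R (in-ball (Near-trans (isPoint y) (isPoint x) pa
          (Near-mono (Near-nonneg (isPoint x) pa h) (d≤-sym x y e)) h) l')
    Near-mono (⊑-trans (⊏⇒⊑ l'') (proj₂ (+ℚ-identityˡ ε)))
      (Near-trans (isPoint u) pb (isPoint v) near-u (Near-sym (isPoint v) pb near-v))

-- The fixed point

module FixedPoint (𝓜 : Model RCA₀) (E : Model.S 𝓜) (E-pow : Semantics.IsPow2 𝓜 E) (X D : Model.S 𝓜)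
  (space : Semantics.Spaces.IsSpace 𝓜 X D) (ultra : Semantics.Spaces.IsUltrametric 𝓜 X D)
  (Φ : Model.S 𝓜) (continuous : Semantics.Spaces.IsContinuous 𝓜 X D Φ)
  (spherical : Semantics.Spaces.IsSphericallyComplete 𝓜 X D)
  (contracting : Semantics.Spaces.IsStrictlyContracting 𝓜 X D Φ) where

  open Continuity 𝓜 E E-pow X D space ultra Φ continuous public

  U-0ᴿ : U [ 0ᴿ ] 0ℚ
  U-0ᴿ = U-rat-intro {0ℚ} ⊑-refl

  contract : ∀ {x y u v} → Maps x u → Maps y v → ¬ˢ d≤ x y 0ℚ → ¬¬ (Σ Q λ q → d≤ u v q × ¬ˢ d≤ x y q)
  contract {x} {y} {u} {v} m m' n = do
    R , dR ← distance (isPoint u) (isPoint v) (represents {set u}) (represents {set v})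
    S , dS ← distance (isPoint x) (isPoint y) (represents {set x}) (represents {set y})
    let is-point : ∀ z → IsPoint (gr (set z))
        is-point = λ z → Point⇒IsPoint (singleValued z) (isPoint z)
    q , a , b ← <ᴿ-elim (IsReal⇒Regular (proj₁ dR)) (contracting (set x) (set y) (set u) (set v) R S
      (is-point x , is-point y , is-point u , is-point v ,
       (λ e → n (Dist-elim₁ (isPoint x) (isPoint y) e U-0ᴿ)) , m , m' , dR , dS))
    return (q , Dist-elim₁ (isPoint u) (isPoint v) dR a , b ∘ Dist-elim₂ (isPoint x) (isPoint y) dS)

  -- Strict contraction says nothing about equal points; these are covered by `Maps-cong`. For the
  -- others, a bound s of d(x , y) lies above the separating rational.
  nonexpansive : ∀ {x y u v s} → Maps x u → Maps y v → d≤ x y s → d≤ u v s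
  nonexpansive {x} {y} {u} {v} {s} m m' h = do
    inj₂ n ← em (d≤ x y 0ℚ)
      where inj₁ e → Near-mono (d≤-nonneg x y h) (Maps-cong {x} {y} {u} {v} m m' e)
    q , a , b ← contract {x} {y} {u} {v} m m' n
    inj₂ l ← compareℚ s q
      where inj₁ l → absurd (b (Near-mono l h))
    Near-mono (⊏⇒⊑ l) a

  displacement : ∀ {x y u v s} → Maps x u → Maps y v → d≤ x u s → d≤ y v s → d≤ x y s
  displacement {x} {y} {u} {v} {s} m m' h h' = stable λ n →
    contract {x} {y} {u} {v} m m' (n ∘ Near-mono (d≤-nonneg x u h)) λ (q , a , b) → do
      -- Along x, u, v, y the distance of x and y is at most the maximum of s and q, yet neither of
      -- these bounds it.
      inj₁ l ← compareℚ q s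
        where inj₂ l → b (chain (Near-mono (⊏⇒⊑ l) h) a (Near-mono (⊏⇒⊑ l) h'))
      n (chain h (Near-mono l a) h')
    where
    chain : ∀ {t} → d≤ x u t → d≤ u v t → d≤ y v t → d≤ x y t
    chain a b c = d≤-trans x u y a (d≤-trans u v y b (d≤-sym y v c))

  rat-real : ∀ {C : Graph} q → (∀ {k v} → C k v ⟺ v ≈ code q) → IsReal C
  rat-real q h = (λ i v w (p , p') → ≈-trans (proj₁ h p) (≈-sym (proj₁ h p'))) ,
    (λ k → return (pos q , return (neg q , return (den-1 q , proj₂ h ≈-refl)))) ,
    λ i j c r₁ r₂ r₃ t₁ t₂ t₃ (_ , _ , p , p') →
      let r = frac r₁ r₂ r₃ ; t = frac t₁ t₂ t₃
          l , l' = code-≈ {r} {t} (≈-trans (proj₁ h p) (≈-sym (proj₁ h p')))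
      in ⊑-elim (⊑-trans l (⊑-+e c)) , ⊑-elim (⊑-trans l' (⊑-+e c))

  EqPoint-intro : ∀ {x y} → d≤ x y 0ℚ → EqPoint (gr (set x)) (gr (set y))
  EqPoint-intro {x} {y} h = Dist-intro (isPoint x) (isPoint y) (rat-real 0ℚ (id , id))
    (λ u → Near-mono (U-rat-elim {0ℚ} u) h) (λ h' → U-rat-intro {0ℚ} (d≤-nonneg x y h'))
    (persist (isPoint x) (isPoint y))

  -- Admissible radii

  constant-point : ∀ {a A} → a ∈ˢ X → Represents A (const a) → SetPoint
  constant-point {a} {A} a∈ r = set-point A (λ i v w (p , q) → ≈-trans (proj₁ (r i v) p) (≈-sym (proj₁ (r i w) q)))
    (Point-resp r (constant a∈))

  -- (a , r) Φ (a , q) says in particular that d(a , f(a)) ≤ q.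
  record Good (a : N) (q : Q) : Set where
    constructor good
    field
      {ball-radius} : Q
      fact : Related a ball-radius a q
  open Good public

  Good-moves : ∀ {a q} (x u : SetPoint) → Good a q → (∀ {i v} → gr (set x) i v ⟺ v ≈ a) → Maps x u → d≤ x u q
  Good-moves {a} {q} x u (good R) r m =
    Near-sym (isPoint u) (isPoint x) (Near-trans (isPoint u) (constant (a∈X R)) (isPoint x)
      (Value-elim {x} {u} m R (in-ball near-a (radius R)))
      (Near-mono (⊏⇒⊑ (target R)) (Near-sym (isPoint x) (constant (a∈X R)) near-a)))
    where
    near-a : Near (gr (set x)) (const a) 0ℚ
    near-a = Near-equal (constant (a∈X R)) (λ i v → proj₁ r) ⊑-refl

  -- A converse of `Good-moves` with loss ε: a small target ball `(b , s)` for the value at x is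
  -- enlarged to one centred at `a`, which is possible because d(a , b) ≤ p + 2⁻ᵏ and 4·2⁻ᵏ < ε.
  Good-intro : ∀ {a p q ε} (x u : SetPoint) → a ∈ˢ X → (∀ {i v} → gr (set x) i v ⟺ v ≈ a) → Maps x u →
               d≤ x u p → 0ℚ ⊏ ε → p +ℚ ε ⊑ q → ¬¬ (Good a q)
  Good-intro {a} {p} {q} {ε} x u a∈ r m h l l' = do
    k , c , _ , pk , l₁ ← split 0# l
    b₀ , r₀ , b , s , R , B , l₂ ← domain (singleValued x) (isPoint x) (0⊏1/1+ c)
    j , f ← recentre (isPoint x) B R
    d , pj ← pow j
    let pa = constant a∈ ; pb = constant (b∈X R)
        e = d≤-nonneg x u h
        R' = f ≤-refl pj (proj₂ r ≈-refl)
        near-b = Near-trans pa (isPoint x) pb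
          (Near-equal (isPoint x) (λ i v → proj₂ r) (⊑-trans e (⊑-+e c)))
          (Near-trans (isPoint x) (isPoint u) pb (Near-mono (⊑-+e c) h)
            (Near-mono (⊑-trans (⊏⇒⊑ l₂) (⊑-+e' c e)) (Value-elim {x} {u} m R B)))
    return (good (enlarge R' a∈
      (⋢⇒⊐ λ n → ⊏-⊒-absurd l (linear (n ⊞ l' ⊞ e) (solveℚ 3 (λ p q ε →
        ε :⊕ (:0 :⊕ (q :⊕ p)) :⊜ :0 :⊕ (q :⊕ ((p :⊕ ε) :⊕ :0))) ≈ℚ-refl p q ε)))
      (Near-const⁻ near-b)
      (⋢⇒⊐ λ n → ⊏-⊒-absurd l₁ (linear (n ⊞ l' ⊞ ⊏⇒⊑ l₂ ⊞ 0⊑1/1+ c ⊞ 0⊑1/1+ c)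
        (solveℚ 5 (λ p q ε s c → ε :⊕ (((p :⊕ c) :⊕ s) :⊕ (q :⊕ (c :⊕ (c :⊕ c)))) :⊜
          ((c :⊕ c) :⊕ (c :⊕ c)) :⊕ (q :⊕ ((p :⊕ ε) :⊕ (s :⊕ (:0 :⊕ :0))))) ≈ℚ-refl p q ε s (1/1+ c))))))

  -- The element e of Φ has the form (a , r) Φ (a , q) for some r.
  goodᶠ : ∀ {m} → Term m → Term m → D.Rat m → Formula 1 m
  goodᶠ e a (D.frac p p' d) = e ∈ zero ∧ ∃¹ (v0 ≺ wkᵗ (e + 𝟏) ∧ ∃¹ (v0 ≺ wkᵗ (wkᵗ (e + 𝟏)) ∧
    wk2 e ≐ D.quint v1 (wk2 a) v0 (wk2 a) ⟨ ⟨ wk2 p , wk2 p' ⟩ , wk2 d ⟩))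
    where
    wk2 : ∀ {m} → Term m → Term (suc (suc m))
    wk2 t = wkᵗ (wkᵗ t)

  goodᶠ-Δ₀ : ∀ {m} (e a : Term m) q → Δ₀ (goodᶠ e a q)
  goodᶠ-Δ₀ e a q = and mem (bex (e + 𝟏) (bex (wkᵗ (e + 𝟏)) eq))

  -- The radius q is least among q₀ and those of the first n elements of Φ.
  minimalᶠ : ∀ {m} → Term m → Term m → D.Rat m → Term m → D.Rat m → Formula 1 m
  minimalᶠ n a q@(D.frac p p' d) a₀ q₀@(D.frac p₀ p₀' d₀) =
    ((a ≐ a₀ ∧ p ≐ p₀ ∧ p' ≐ p₀' ∧ d ≐ d₀) ∨
      ∃¹ (v0 ≺ wkᵗ n ∧ goodᶠ v0 (wkᵗ a) (D.frac (wkᵗ p) (wkᵗ p') (wkᵗ d)))) ∧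
    q D.≤ℚ q₀ ∧
    ∀¹ (v0 ≺ wkᵗ n ⇒ ∀¹ (v0 ≺ v1 + 𝟏 ⇒ ∀¹ (v0 ≺ v2 + 𝟏 ⇒ ∀¹ (v0 ≺ v3 + 𝟏 ⇒
      ∀¹ (v0 ≺ v4 + 𝟏 ⇒ (goodᶠ v4 v3 (D.frac v2 v1 v0) ⇒
        D.frac (wk5 p) (wk5 p') (wk5 d) D.≤ℚ D.frac v2 v1 v0))))))
    where
    wk5 : ∀ {m} → Term m → Term (suc (suc (suc (suc (suc m)))))
    wk5 t = wkᵗ (wkᵗ (wkᵗ (wkᵗ (wkᵗ t))))

  minimalᶠ-Δ₀ : ∀ {m} (n a : Term m) q a₀ q₀ → Δ₀ (minimalᶠ n a q a₀ q₀)
  minimalᶠ-Δ₀ n a (D.frac p p' d) a₀ q₀ =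
    and (or (and eq (and eq (and eq eq))) (bex n (goodᶠ-Δ₀ v0 (wkᵗ a) (D.frac (wkᵗ p) (wkᵗ p') (wkᵗ d)))))
    (and (or lt eq) (ball n (ball (v0 + 𝟏) (ball (v1 + 𝟏) (ball (v2 + 𝟏) (ball (v3 + 𝟏)
      (imp (goodᶠ-Δ₀ v4 v3 (D.frac v2 v1 v0)) (or lt eq))))))))

  -- Minimising the radius over an initial segment of Φ

  GoodAt : N → N → Q → Set
  GoodAt e a q = e ∈ˢ Φ × ∃N λ l → l < e ⊹ 1# × ∃N λ c → c < e ⊹ 1# × e ≈ quint l a c a (code q)

  Same : N → Q → N → Q → Set
  Same a q a₀ q₀ = a ≈ a₀ × pos q ≈ pos q₀ × neg q ≈ neg q₀ × den-1 q ≈ den-1 q₀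

  Minimal : N → N → Q → N → Q → Set
  Minimal n a q a₀ q₀ =
    ¬¬ (Same a q a₀ q₀ ⊎ ∃N λ e → e < n × GoodAt e a q) ×
    q ≤ℚ q₀ ×
    (∀ e → e < n → ∀ a' → a' < e ⊹ 1# → ∀ p → p < e ⊹ 1# → ∀ p' → p' < e ⊹ 1# → ∀ d → d < e ⊹ 1# →
      GoodAt e a' (frac p p' d) → q ≤ℚ frac p p' d)

  Same⇒code : ∀ {a q a₀ q₀} → Same a q a₀ q₀ → code q ≈ code q₀
  Same⇒code (_ , e , f , g) = ⟪⟫-cong (⟪⟫-cong e f) g

  GoodAt⇒Good : ∀ {e a q} → GoodAt e a q → ¬¬ (Good a q)
  GoodAt⇒Good {e} {a} {q} (m , h) = do
    l , _ , h ← h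
    c , _ , f ← h
    _ , a' , r , _ , _ , g , _ ← Φ-shape m
    let _ , _ , h , _ = quint-injective (≈-trans (≈-sym f) g)
    return (good (Rel⇒Related {a} {r} {a} {q} (return (l ,
      ∈-resp (≈-trans f (quint-cong ≈-refl ≈-refl h ≈-refl (≈-refl {code q}))) m))))

  Good⇒GoodAt : ∀ {a q} → Good a q → ∃N λ e → GoodAt e a q
  Good⇒GoodAt {a} {q} (good {r} R) = do
    l , m ← rel R
    return (quint l a (code r) a (code q) , m , return (l , ≤⇒<suc (≤-⟪⟫ˡ l _) ,
      return (code r , ≤⇒<suc (≤-trans (≤-⟪⟫ˡ (code r) _) (≤-trans (≤-⟪⟫ʳ a _) (≤-⟪⟫ʳ l _))) , ≈-refl)))

  GoodAt-functional : ∀ {e a q e' a' q'} → GoodAt e a q → GoodAt e' a' q' → e ≈ e' → q ≈ℚ q'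
  GoodAt-functional {q = q} {q' = q'} (_ , h) (_ , h') g = do
    _ , _ , h ← h
    _ , _ , f ← h
    _ , _ , h' ← h'
    _ , _ , f' ← h'
    let _ , _ , _ , _ , e = quint-injective (≈-trans (≈-sym f) (≈-trans g f'))
    code-≈ {q} {q'} e

  -- The quantifiers in `Minimal` are bounded to keep its formula Δ₀; as a code bounds its
  -- components, they still reach every element below n of the required form.
  GoodAt-bounds : ∀ {e a q} → GoodAt e a q → a ≤ e × pos q ≤ e × neg q ≤ e × den-1 q ≤ e
  GoodAt-bounds {e} {a} {q} (_ , h) = do
    l , _ , h ← h
    c , _ , f ← h
    let to-e : ∀ {x} → x ≤ quint l a c a (code q) → x ≤ e
        to-e = λ m → ≤-trans m (≤-reflexive (≈-sym f))
        l₁ : code q ≤ quint l a c a (code q)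
        l₁ = ≤-trans (≤-⟪⟫ʳ a _) (≤-trans (≤-⟪⟫ʳ c _) (≤-trans (≤-⟪⟫ʳ a _) (≤-⟪⟫ʳ l _)))
        l₂ = ≤-trans (≤-⟪⟫ˡ ⟪ pos q , neg q ⟫ (den-1 q)) l₁
    to-e (≤-trans (≤-⟪⟫ˡ a _) (≤-⟪⟫ʳ l _)) ,
      to-e (≤-trans (≤-⟪⟫ˡ (pos q) (neg q)) l₂) , to-e (≤-trans (≤-⟪⟫ʳ (pos q) (neg q)) l₂) ,
      to-e (≤-trans (≤-⟪⟫ʳ ⟪ pos q , neg q ⟫ (den-1 q)) l₁)

  Minimal-below : ∀ {n a q a₀ q₀ e a' q'} → Minimal n a q a₀ q₀ → e < n → GoodAt e a' q' → q ⊑ q'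
  Minimal-below {q' = q'} (_ , _ , h) l g =
    let b₁ , b₂ , b₃ , b₄ = GoodAt-bounds {q = q'} g in
    ⊑-intro (h _ l _ (≤⇒<suc b₁) (pos q') (≤⇒<suc b₂) (neg q') (≤⇒<suc b₃) (den-1 q') (≤⇒<suc b₄) g)

  Minimal-good : ∀ {n a q a₀ q₀} → Good a₀ q₀ → Minimal n a q a₀ q₀ → ¬¬ (Good a q)
  Minimal-good {a = a} {q} {a₀} {q₀} (good {r} R) (h , _) = do
    inj₁ s ← h
      where inj₂ h → do
              _ , _ , g ← h
              GoodAt⇒Good {q = q} g
    k , m ← rel R
    return (good (Rel⇒Related {a} {r} {a} {q} (return (k ,
      ∈-resp (quint-cong ≈-refl (≈-sym (proj₁ s)) (≈-refl {code r}) (≈-sym (proj₁ s)) (≈-sym (Same⇒code {a} {q} {a₀} {q₀} s))) m))))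

  -- The radius chosen for n is the starting one or belongs to an element below n, so it takes part
  -- in the next minimisation.
  Minimal-antitone : ∀ {n a q a' q' a₀ q₀} → Minimal n a q a₀ q₀ → Minimal (n ⊹ 1#) a' q' a₀ q₀ → q' ⊑ q
  Minimal-antitone {q = q} {q' = q'} {q₀ = q₀} (h , _) m' = do
    inj₁ s ← h
      where inj₂ h → do
              e , l , g ← h
              Minimal-below {q = q'} {q₀ = q₀} {q' = q} m' (≤⇒<suc (<⇒≤ l)) g
    ⊑-trans (⊑-intro (proj₁ (proj₂ m'))) (proj₁ (code-≈ {q₀} {q} (≈-sym (Same⇒code {q = q} {q₀ = q₀} s))))

  -- A Σ⁰₁ formula has one unbounded quantifier. The number w takes that place and bounds the centre
  -- and the three components of the radius.
  bounded : ∀ {P : N → N → N → N → Set} a q → P a (pos q) (neg q) (den-1 q) →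
            ∃N λ w → ∃N λ a → a < w × ∃N λ p → p < w × ∃N λ p' → p' < w × ∃N λ d → d < w × P a p p' d
  bounded a (frac p p' d) h = return (a ⊹ p ⊹ p' ⊹ d ⊹ 1# ,
    return (a , ≤⇒<suc (≤-trans (≤-⊹ʳ a p) (≤-trans (≤-⊹ʳ _ p') (≤-⊹ʳ _ d))) ,
    return (p , ≤⇒<suc (≤-trans (≤-⊹ˡ a p) (≤-trans (≤-⊹ʳ _ p') (≤-⊹ʳ _ d))) ,
    return (p' , ≤⇒<suc (≤-trans (≤-⊹ˡ _ p') (≤-⊹ʳ _ d)) ,
    return (d , ≤⇒<suc (≤-⊹ˡ _ d) , h)))))

  minimal-exists : ∀ a₀ q₀ n → ¬¬ (Σ N λ a → Σ Q λ q → Minimal n a q a₀ q₀)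
  minimal-exists a₀ q₀ n = do
    _ , h ← induction {φ = ∃¹ (∃¹ (v0 ≺ v1 ∧ ∃¹ (v0 ≺ v2 ∧ ∃¹ (v0 ≺ v3 ∧ ∃¹ (v0 ≺ v4 ∧
        minimalᶠ v5 v3 (D.frac v2 v1 v0) v6 (D.frac v7 v8 v9))))))}
      (ex (bex v0 (bex v1 (bex v2 (bex v3 (minimalᶠ-Δ₀ v5 v3 (D.frac v2 v1 v0) v6 (D.frac v7 v8 v9)))))))
      (Φ ∷ₑ ∅) (a₀ ∷ₑ pos q₀ ∷ₑ neg q₀ ∷ₑ den-1 q₀ ∷ₑ ∅)
      (pack (a₀ , q₀ , return (inj₁ (≈-refl , ≈-refl , ≈-refl , ≈-refl)) , ⊑-elim (⊑-refl {q₀}) , λ e l → absurd (≮0 l)))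
      (λ n h → do
        _ , h ← h
        s ← unpack h
        t ← step s
        pack t) n
    unpack h
    where
    P : N → Set
    P n = Σ N λ a → Σ Q λ q → Minimal n a q a₀ q₀

    Bounded : N → N → Set
    Bounded n w = ∃N λ a → a < w × ∃N λ p → p < w × ∃N λ p' → p' < w × ∃N λ d → d < w × Minimal n a (frac p p' d) a₀ q₀

    pack : ∀ {n} → P n → ∃N (Bounded n)
    pack (a , q , m) = bounded {λ a p p' d → Minimal _ a (frac p p' d) a₀ q₀} a q m

    unpack : ∀ {n w} → Bounded n w → ¬¬ (P n)
    unpack h = do
      a , _ , h ← h
      p , _ , h ← h
      p' , _ , h ← h
      d , _ , m ← h
      return (a , frac p p' d , m)

    step : ∀ {n} → P n → ¬¬ (P (n ⊹ 1#))
    step {n} (a , q , m@(c , l , h)) = do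
      -- The choice changes only if the element n offers a strictly smaller radius.
      inj₁ (a' , q' , g , l') ← em (Σ N λ a' → Σ Q λ q' → GoodAt n a' q' × q' ⊏ q)
        where
        inj₂ none → return (a , q , later c , l , λ e l₁ a' l₂ p l₃ p' l₄ d l₅ g → do
          inj₂ f ← <suc⇒≤ l₁
            where inj₁ l₁ → h e l₁ a' l₂ p l₃ p' l₄ d l₅ g
          ⊑-elim {q} {frac p p' d} do
            inj₁ l ← compareℚ q (frac p p' d)
              where inj₂ l → absurd (none (a' , frac p p' d , GoodAt-resp {q = frac p p' d} f g , l))
            l)
      return (a' , q' , return (inj₂ (return (n , ≤⇒<suc ≤-refl , g))) ,
        ⊑-elim (⊑-trans (⊏⇒⊑ l') (⊑-intro l)) , λ e l₁ a'' l₂ p l₃ p' l₄ d l₅ g' → do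
          inj₂ f ← <suc⇒≤ l₁
            where inj₁ l₁ → ⊑-elim (⊑-trans (⊏⇒⊑ l') (⊑-intro {q} {frac p p' d} (h e l₁ a'' l₂ p l₃ p' l₄ d l₅ g')))
          ⊑-elim (proj₁ (GoodAt-functional {q = q'} {q' = frac p p' d} g g' (≈-sym f))))
      where
      GoodAt-resp : ∀ {e e' a q} → e ≈ e' → GoodAt e a q → GoodAt e' a q
      GoodAt-resp f (m , h) = ∈-resp f m , do
        l , b , h ← h
        c , b' , g ← h
        return (l , <-resp ≈-refl (suc-cong f) b , return (c , <-resp ≈-refl (suc-cong f) b' , ≈-trans (≈-sym f) g))

      later : ¬¬ (Same a q a₀ q₀ ⊎ ∃N λ e → e < n × GoodAt e a q) → ¬¬ (Same a q a₀ q₀ ⊎ ∃N λ e → e < n ⊹ 1# × GoodAt e a q)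
      later c = do
        inj₂ c ← c
          where inj₁ s → return (inj₁ s)
        return (inj₂ (do
          e , l , g ← c
          return (e , ≤⇒<suc (<⇒≤ l) , g)))

  minimal-sequence : ∀ a₀ q₀ → ∃S λ G → IsFunction G ×
    (∀ n v → gr G n v → ¬¬ (Σ N λ a → Σ Q λ q → v ≈ ⟪ a , code q ⟫ × Minimal n a q a₀ q₀))
  minimal-sequence a₀ q₀ = do
    G , G-fun , h ← choice
      (∃¹ (v0 ≺ v1 ∧ ∃¹ (v0 ≺ v2 ∧ ∃¹ (v0 ≺ v3 ∧ ∃¹ (v0 ≺ v4 ∧
        (v5 ≐ ⟨ v3 , ⟨ ⟨ v2 , v1 ⟩ , v0 ⟩ ⟩ ∧ minimalᶠ v6 v3 (D.frac v2 v1 v0) v7 (D.frac v8 v9 v10)))))))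
      (bex v0 (bex v1 (bex v2 (bex v3 (and eq (minimalᶠ-Δ₀ v6 v3 (D.frac v2 v1 v0) v7 (D.frac v8 v9 v10)))))))
      (Φ ∷ₑ ∅) (a₀ ∷ₑ pos q₀ ∷ₑ neg q₀ ∷ₑ den-1 q₀ ∷ₑ ∅) (λ n → do
        a , q , m ← minimal-exists a₀ q₀ n
        return (⟪ a , code q ⟫ , bounded
          {λ a' p p' d → ⟪ a , code q ⟫ ≈ ⟪ a' , code (frac p p' d) ⟫ × Minimal n a' (frac p p' d) a₀ q₀}
          a q (≈-refl , m)))
    return (G , G-fun , λ n v g → do
      _ , h ← h n v g
      a , _ , h ← h
      p , _ , h ← h
      p' , _ , h ← h
      d , _ , e , m ← h
      return (a , frac p p' d , e , m))

  -- Every element of X has an admissible radius: d(a , f(a)) ≤ t + s if f(a) is within s of some b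
  -- and d(a , b) ≤ t. The added 1 is the room that `Good-intro` requires.
  seed : ¬¬ (Σ N λ a → Σ Q λ q → Good a q)
  seed = do
    a , a∈ ← proj₁ space
    A , r ← represent-const a
    let x = constant-point a∈ r
    u , m ← value x
    b₀ , r₀ , b , s , R , B , _ ← domain (singleValued x) (isPoint x) (0⊏1/1+ 0#)
    t , h ← U-inhabited (dist-regular a∈ (b∈X R))
    let p = t +ℚ s
        near-b = Value-elim {x} {u} m R B
        0≤t = d-nonneg a∈ (b∈X R) h
        l : s ⊑ p
        l = linear 0≤t (solveℚ 2 (λ s t → s :⊕ t :⊜ (t :⊕ s) :⊕ :0) ≈ℚ-refl s t)
        l' : t ⊑ p
        l' = ⊑-+ʳ (⊏⇒⊑ (target R))
    g ← Good-intro x u a∈ (r _ _) m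
      (Near-trans (isPoint x) (constant a∈) (isPoint u)
        (Near-equal (constant a∈) (λ i v → proj₁ (r i v)) (⊑-trans 0≤t l'))
        (Near-trans (constant a∈) (constant (b∈X R)) (isPoint u) (Near-const (U-mono l' h))
          (Near-mono l (Near-sym (isPoint u) (constant (b∈X R)) near-b))))
      (0⊏1/1+ 0#) ⊑-refl
    return (a , p +ℚ 1/1+ 0# , g)

  -- The nested balls and their common point

  Near-graphs : ∀ {x y x' y' s} → (∀ i a → x' i a → x i a) → (∀ i a → y' i a → y i a) → Near x y s → Near x' y' s
  Near-graphs f g h = near-intro λ l → do
    n , k ← eventually h l
    return (n , λ i a b n≤i p q → k i a b n≤i (f i a p) (g i b q))

  module _ {a₀ q₀} (good₀ : Good a₀ q₀) {G} (G-fun : IsFunction G)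
    (G-minimal : ∀ n v → gr G n v → ¬¬ (Σ N λ a → Σ Q λ q → v ≈ ⟪ a , code q ⟫ × Minimal n a q a₀ q₀)) where

    record At (i a : N) (q : Q) : Set where
      field
        value-at : gr G i ⟪ a , code q ⟫
        minimal  : Minimal i a q a₀ q₀
        good-at  : Good a q
    open At

    at : ∀ i → ¬¬ (Σ N λ a → Σ Q λ q → At i a q)
    at i = do
      v , g ← proj₂ G-fun i
      a , q , e , m ← G-minimal i v g
      g' ← Minimal-good {q = q} {q₀ = q₀} good₀ m
      return (a , q , record { value-at = gr-resp ≈-refl e g ; minimal = m ; good-at = g' })

    record Rows (x : S) (f : N → Q → N) : Set where
      field row-value : ∀ {i a q} → At i a q → ∀ {n v} → row x i n v ⟺ v ≈ f a q
    open Rows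

    -- The argument u of `choice` encodes position n in row i. Rows are constant in n, and the
    -- condition is vacuous if u is not a pair, so that `choice` gets a total relation.
    IsRow : N → N → N → Set
    IsRow w v u = ∀ i → i < u ⊹ 1# → ∀ n → n < u ⊹ 1# → u ≈ ⟪ i , n ⟫ → gr G i ⟪ v , w ⟫

    some-row : ∀ u → ∃N λ v → ∃N λ w → IsRow w v u
    some-row u = do
      inj₁ (i , n , e) ← em (Σ N λ i → Σ N λ n → u ≈ ⟪ i , n ⟫)
        where inj₂ none → return (0# , return (0# , λ i _ n _ e → absurd (none (i , n , e))))
      a , q , s ← at i
      return (a , return (code q , λ i' _ n' _ e' →
        gr-resp (proj₁ (⟪⟫-injective (≈-trans (≈-sym e) e'))) ≈-refl (value-at s)))

    at-row : ∀ {i n w v} → IsRow w v ⟪ i , n ⟫ → gr G i ⟪ v , w ⟫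
    at-row {i} {n} h = h i (≤⇒<suc (≤-⟪⟫ˡ i n)) n (≤⇒<suc (≤-⟪⟫ʳ i n)) ≈-refl

    centres : ∃S λ x → Rows x λ a q → a
    centres = do
      x , (_ , t) , h ← choice
        (∀¹ (v0 ≺ v3 + 𝟏 ⇒ ∀¹ (v0 ≺ v4 + 𝟏 ⇒ (v4 ≐ ⟨ v1 , v0 ⟩ ⇒ ⟨ v1 , ⟨ v3 , v2 ⟩ ⟩ ∈ zero))))
        (ball (v2 + 𝟏) (ball (v3 + 𝟏) (imp eq mem))) (G ∷ₑ ∅) ∅ some-row
      let f : ∀ {i a q} → At i a q → ∀ {n v} → row x i n v → v ≈ a
          f {i} {a} {q} s {n} {v} k = do
            w , r ← h ⟪ i , n ⟫ v k
            proj₁ (⟪⟫-injective (proj₁ G-fun _ _ _ (at-row r , value-at s)))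
      return (x , record { row-value = λ {i} s {n} → f s , λ e → do
        v , k ← t ⟪ i , n ⟫
        gr-resp ≈-refl (≈-trans (f s k) (≈-sym e)) k })

    -- The same relation as for `centres` with its two witnesses exchanged, as `choice` keeps only
    -- the first one.
    radii : ∃S λ r → Rows r λ a q → code q
    radii = do
      x , (_ , t) , h ← choice
        (∀¹ (v0 ≺ v3 + 𝟏 ⇒ ∀¹ (v0 ≺ v4 + 𝟏 ⇒ (v4 ≐ ⟨ v1 , v0 ⟩ ⇒ ⟨ v1 , ⟨ v2 , v3 ⟩ ⟩ ∈ zero))))
        (ball (v2 + 𝟏) (ball (v3 + 𝟏) (imp eq mem))) (G ∷ₑ ∅) ∅ (λ u → do
          v , h ← some-row u
          w , k ← h
          return (w , return (v , k)))
      let f : ∀ {i a q} → At i a q → ∀ {n v} → row x i n v → v ≈ code q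
          f {i} {a} {q} s {n} {v} k = do
            w , r ← h ⟪ i , n ⟫ v k
            proj₂ (⟪⟫-injective (proj₁ G-fun _ _ _ (at-row r , value-at s)))
      return (x , record { row-value = λ {i} s {n} → f s , λ e → do
        v , k ← t ⟪ i , n ⟫
        gr-resp ≈-refl (≈-trans (f s k) (≈-sym e)) k })

    module _ {x r : S} (centre-rows : Rows x λ a q → a) (radius-rows : Rows r λ a q → code q) where

      centre : ∀ {i a q} → At i a q → ∀ {n v} → row x i n v ⟺ v ≈ a
      centre = row-value centre-rows

      radius-row : ∀ {i a q} → At i a q → ∀ {n v} → row r i n v ⟺ v ≈ code q
      radius-row = row-value radius-rows

      a∈ : ∀ {i a q} → At i a q → a ∈ˢ X
      a∈ s = a∈X (fact (good-at s))

      row-point : ∀ {i a q} → At i a q → Point (row x i)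
      row-point {a = a} s = const-point (a∈ s) (λ _ → return (a , proj₂ (centre s) ≈-refl)) (proj₁ (centre s))

      row-real : ∀ {i a q} → At i a q → IsReal (row r i)
      row-real {q = q} s = rat-real q (radius-row s)

      U-radius : ∀ {i a q} → At i a q → U [ row r i ] q
      U-radius {q = q} s = U-intro λ {_} {c} {t} p m →
        ⊑-trans (proj₁ (code-≈ {t} {q} (proj₁ (radius-row s) m))) (⊑-+e c)

      U-radius⁻ : ∀ {i a q t} → At i a q → U [ row r i ] t → q ⊑ t
      U-radius⁻ {q = q} s u = U-rat-elim (U-intro λ {_} {_} {t} p e → below u p (proj₂ (radius-row s) e))

      record Centre (i a : N) (q : Q) : Set where
        field
          pt rep    : SetPoint
          is-centre : Represents (set pt) (row x i)
          maps      : Maps pt rep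
          moves     : d≤ pt rep q
      open Centre

      centre-point : ∀ {i a q} → At i a q → ¬¬ (Centre i a q)
      centre-point {i} {a} {q} s = do
        A , rA ← represent-const a
        let p = constant-point (a∈ s) rA
        u , m ← value p
        return (record
          { pt = p ; rep = u ; maps = m
          ; is-centre = λ n v → (λ k → proj₂ (centre s) (proj₁ (rA n v) k)) , (λ k → proj₂ (rA n v) (proj₁ (centre s) k))
          ; moves = Good-moves p u (good-at s) (λ {n} {v} → rA n v) m })

      nested : ∀ i → SubBall (row x (i ⊹ 1#)) (row r (i ⊹ 1#)) (row x i) (row r i)
      nested i = do
        a , q , s ← at i
        a' , q' , s' ← at (i ⊹ 1#)
        c ← centre-point s
        c' ← centre-point s'
        R , d ← distance (row-point s') (row-point s) (is-centre c') (is-centre c)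
        let q'⊑q = Minimal-antitone {q = q} {q' = q'} {q₀ = q₀} (minimal s) (minimal s')
            close = displacement {pt c'} {pt c} {rep c'} {rep c} (maps c') (maps c) (Near-mono q'⊑q (moves c')) (moves c)
            close' : Near (row x (i ⊹ 1#)) (row x i) q
            close' = Near-graphs (λ n v → proj₂ (is-centre c' n v)) (λ n v → proj₂ (is-centre c n v)) close
        return (R , d , ⊔-≤ᴿ {gr R} {row r (i ⊹ 1#)} {row r i}
          (≤ᴿ-intro (IsReal⇒Regular (row-real s)) λ u →
            Dist-elim₂ (row-point s') (row-point s) d (Near-mono (U-radius⁻ s u) close'))
          (≤ᴿ-intro (IsReal⇒Regular (row-real s)) λ u → U-mono (⊑-trans q'⊑q (U-radius⁻ s u)) (U-radius s')))

      intersection : ¬¬ (Σ SetPoint λ z → ∀ i a q → At i a q → Near (row x i) (gr (set z)) q)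
      intersection = do
        z , z-point , h ← spherical x r
          ((λ i → is-point i , is-real i , positive i) , nested)
        return (IsPoint⇒SetPoint z-point , λ i a q s →
          Dist≤-elim {C = row r i} (row-point s) (point z-point) (IsReal⇒Regular (row-real s)) (h i) (U-radius s))
        where
        is-point : ∀ i → IsPoint (row x i)
        is-point i = do
          a , q , s ← at i
          Point⇒IsPoint (λ n v w (k , k') → ≈-trans (proj₁ (centre s) k) (≈-sym (proj₁ (centre s) k'))) (row-point s)
        is-real : ∀ i → IsReal (row r i)
        is-real i = do
          a , q , s ← at i
          row-real s
        positive : ∀ i → [ 0ᴿ ] <ᴿ [ row r i ]
        positive i = do
          a , q , s ← at i
          <ᴿ-intro (total (rat-regular {0ℚ})) (IsReal⇒Regular (row-real s)) U-0ᴿ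
            (⊏-⊒-absurd (target (fact (good-at s))) ∘ U-radius⁻ s)

      fixed : (z : SetPoint) → (∀ i a q → At i a q → Near (row x i) (gr (set z)) q) →
              ∀ f → Maps z f → d≤ z f 0ℚ
      fixed z inside-balls f m = stable λ moved → do
        g , m' ← value f
        q , near-g , far ← contract {z} {f} {f} {g} m m' moved
        let 0⊑q = d≤-nonneg f g near-g
        -- Replacing f(z) by an element `a` of X and passing to an admissible radius for it each
        -- cost 2⁻ᵏ; ε leaves room for both.
        ε , ε>0 , far' ← room q far
        k , c , _ , p , l ← split 0# ε>0
        a , fa ← values (isPoint f) k
        A , rA ← represent-const a
        let a∈ = inside (isPoint f) fa
            y = constant-point a∈ rA
            e = 1/1+ c
            near-y : d≤ f y (q +ℚ e)
            near-y = Near-mono (⊑-+e' c 0⊑q) (Near-graphs (λ _ _ → id) (λ i v → proj₁ (rA i v)) (Near-approx (isPoint f) p fa))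
        u , m'' ← value y
        let y-moves : d≤ y u (q +ℚ e)
            y-moves = d≤-trans y f u (d≤-sym f y near-y)
              (d≤-trans f g u (Near-mono (⊑-+e c) near-g) (nonexpansive {f} {y} {g} {u} m' m'' near-y))
        good-a ← Good-intro {ε = e} y u a∈ (λ {i} {v} → rA i v) m'' y-moves (0⊏1/1+ c)
          (linear (⊏⇒⊑ l ⊞ 0⊑1/1+ c ⊞ 0⊑1/1+ c) (solveℚ 3 (λ q e ε →
            ((q :⊕ e) :⊕ e) :⊕ (ε :⊕ (e :⊕ e)) :⊜ (q :⊕ ε) :⊕ (((e :⊕ e) :⊕ (e :⊕ e)) :⊕ (:0 :⊕ :0))) ≈ℚ-refl q e ε))
        n , at-n ← Good⇒GoodAt good-a
        -- `Minimal` takes account of the elements strictly below its index, so n + 1 is the first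
        -- index that includes n.
        b , s , at-b ← at (n ⊹ 1#)
        let s⊑ = Minimal-below {q = s} {q₀ = q₀} {q' = q +ℚ ε} (minimal at-b) (≤⇒<suc ≤-refl) at-n
        ctr ← centre-point at-b
        let near-z : d≤ (pt ctr) z s
            near-z = Near-graphs (λ i v → proj₁ (is-centre ctr i v)) (λ _ _ → id) (inside-balls _ _ _ at-b)
        -- The path leads from z to the centre, to its image and to f(z). Each step is at most s,
        -- the last one because f is nonexpansive.
        far' (Near-mono s⊑ (d≤-trans z (pt ctr) f (d≤-sym (pt ctr) z near-z)
          (d≤-trans (pt ctr) (rep ctr) f (moves ctr) (nonexpansive {pt ctr} {z} {rep ctr} {f} (maps ctr) m near-z))))
        where
        room : ∀ q → ¬ˢ d≤ z f q → ¬¬ (Σ Q λ ε → 0ℚ ⊏ ε × ¬ˢ d≤ z f (q +ℚ ε))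
        room q far k = far (Near-closed λ {ε} l → stable λ n → k (ε , l , n))

  unique-fixed-point : HasUniqueFixedPoint Φ
  unique-fixed-point = do
    a₀ , q₀ , good₀ ← seed
    G , G-fun , G-min ← minimal-sequence a₀ q₀
    x , xs ← centres good₀ G-fun G-min
    r , rs ← radii good₀ G-fun G-min
    z , balls ← intersection good₀ G-fun G-min xs rs
    f , m ← value z
    let near = fixed good₀ G-fun G-min xs rs z balls f m
        m' : Maps z z
        m' = λ a r₁ r₂ r₃ b s₁ s₂ s₃ (h , d) → do
          let s = frac s₁ s₂ s₃ ; r = frac r₁ r₂ r₃
              R = Rel⇒Related {a} {r} {b} {s} h
              pb = constant (b∈X R)
          B , rB ← represent-const b
          Dist≤-intro {A = set z} {B = B} {C = rat s} (isPoint z) pb (represents {set z}) rB (rat-regular {s}) λ u →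
            let u' = Dist≤-elim {C = rat s} (isPoint f) pb (rat-regular {s}) (m a r₁ r₂ r₃ b s₁ s₂ s₃ (h , d)) u
            in Near-trans (isPoint z) (isPoint f) pb (Near-mono (Near-nonneg (isPoint f) pb u') near) u'
    return (set z , (Point⇒IsPoint (singleValued z) (isPoint z) , m') , λ y (y-point , my) →
      let y' = IsPoint⇒SetPoint y-point in
      EqPoint-intro {z} {y'} (displacement {z} {y'} {z} {y'} m' my
        (Near-refl (isPoint z) ⊑-refl) (Near-refl (isPoint y') ⊑-refl)))

-- The theorem in an arbitrary model

module Theorem (𝓜 : Model RCA₀) where

  open Semantics 𝓜

  -- Without the function i ↦ 2ⁱ no real would be less than another, and no
  -- point would lie in the domain of Φ.
  powers-exist : ∀ {X D Φ} → Spaces.IsSpace X D → Spaces.IsContinuous X D Φ → ∃S IsPow2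
  powers-exist {X} {D} {Φ} space continuous none = do
    a , a∈ ← proj₁ space
    A , r ← represent-const a
    _ , h ← proj₂ continuous A
      ( (λ i v w (p , q) → ≈-trans (proj₁ (r i v) p) (≈-sym (proj₁ (r i w) q)))
      , (λ i → return (a , a∈ , proj₂ (r i a) ≈-refl))
      -- If there are no powers, the Cauchy condition for the constant point is vacuous.
      , λ _ _ _ _ _ (_ , p , _) _ _ _ _ _ _ _ _ _ → absurd (no-power p))
      1# 0# 0# (⊏-elim (0⊏1/1+ 0#))
    _ , h ← h
    _ , h ← h
    _ , h ← h
    _ , h ← h
    _ , h ← h
    _ , h ← h
    _ , _ , d , _ ← h
    _ , _ , l ← d
    l λ _ _ _ _ _ _ _ _ (p , _) → absurd (no-power p)
    where
    no-power : ∀ {k p} → Pow2 k p → Bot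
    no-power h = h λ (E , sv , t , z , s , _) → none (E , sv , t , z , s)

  fixed-point-theorem : Target
  fixed-point-theorem X D Φ (space , ultra , spherical , continuous , contracting) = do
    E , E-pow ← powers-exist space continuous
    FixedPoint.unique-fixed-point 𝓜 E E-pow X D space ultra Φ continuous spherical contracting

open import Defs

theorem4p1 : RCA₀⊢
    (∀ˢ 3 λ X D Φ →
    IsSpace (space X D) ∧
    IsUltrametric (space X D) ∧
    IsSphericallyComplete (space X D) ∧
    IsContinuous (space X D) Φ ∧
    IsStrictlyContracting (space X D) Φ ⇒
    HasUniqueFixedPoint (space X D) Φ)
theorem4p1 = completeness _ λ 𝓜 _ _ → Theorem.fixed-point-theorem 𝓜
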